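{- For every prime power $q$, $$\frac{\pi^2}{6} - \frac{q}{q-1}\, \mathrm{Li}_2\!\left(\frac{1}{\sqrt{q}}\right) \le \mathcal{F}(\mathcal{I}_q) \le \frac{\pi^2}{6}.$$ In particular, $\mathcal{F}(\mathcal{I}_q) \to \frac{\pi^2}{6}$ as $q \to \infty$ (through prime powers).
   Context: $\mathcal{I}_q$ is the set of monic irreducible polynomials in $\mathbb{F}_q[x]$, and for a set $A$ of nonconstant monic polynomials in $\mathbb{F}_q[x]$, $\mathcal{F}(A) = \sum_{a \in A} \frac{1}{q^{\deg a} \deg a}$. $\mathrm{Li}_2$ is the dilogarithm, $\mathrm{Li}_2(x) = \sum_{k=1}^{\infty} \frac{x^k}{k^2}$. -}

module Defs where

open import Algebra.Bundles using (CommutativeRing; RawSemiring)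
open import Algebra.Definitions.RawSemiring using (Irreducible)
open import Data.Bool using (true; false; if_then_else_)
open import Data.Fin using (Fin)
open import Data.Integer using (+_; -[1+_]; +[1+_]; +0)
import Data.Integer as ℤ
import Data.Integer.Properties as ℤP
open import Data.List using (List; []; _∷_; map; foldr; _++_)
open import Data.List.Relation.Unary.All using (All)
open import Data.List.Relation.Unary.AllPairs using (AllPairs)
open import Data.Nat using (ℕ; zero; suc)
import Data.Nat as ℕ
import Data.Nat.Properties as ℕP
open import Data.Nat.Primality using (Prime; prime⇒nonZero; prime⇒nonTrivial)
open import Data.Product using (∃; ∃₂; _×_; _,_; proj₁; proj₂)
open import Data.Rational using (ℚ; mkℚ; 0ℚ; 1ℚ; ½; _+_; _*_; _-_; -_; ∣_∣; 1/_; _≤_; _<_; *≤*; *<*)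
import Data.Rational as ℚ
open import Data.Rational.Literals using (fromℤ)
open import Data.Rational.Properties
open import Data.Rational.Solver using (module +-*-Solver)
open import Data.Sum using (inj₁; inj₂; [_,_]′)
open import Data.Vec using (Vec; toList)
open import Function.Bundles using (Inverse)
open import Level using (Level; _⊔_) renaming (suc to lsuc)
open import Relation.Binary.PropositionalEquality using (_≡_; refl; sym; trans; cong; cong₂; subst; subst₂; setoid)
open import Relation.Nullary using (¬_; ofʸ; ofⁿ)
open import Relation.Unary using (Pred)

open +-*-Solver using (solve; _:+_; _:*_; _:-_; :-_; _:=_; con)

ι : ℕ → ℚ
ι n = fromℤ (+ n)

-- The reciprocal, with the convention 0 ⁻¹ = 0.
infix 9 _⁻¹
_⁻¹ : ℚ → ℚ
(mkℚ +0 _ _)         ⁻¹ = 0ℚ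
p@(mkℚ +[1+ _ ] _ _) ⁻¹ = 1/ p
p@(mkℚ -[1+ _ ] _ _) ⁻¹ = 1/ p

_^ℚ_ : ℚ → ℕ → ℚ
x ^ℚ zero  = 1ℚ
x ^ℚ suc k = x * (x ^ℚ k)

∑ : (ℕ → ℚ) → ℕ → ℚ
∑ f zero    = 0ℚ
∑ f (suc n) = ∑ f n + f n

*-⁻¹ : ∀ {p} → 0ℚ < p → p * p ⁻¹ ≡ 1ℚ
*-⁻¹ {mkℚ +0 _ _} (*<* (ℤ.+<+ ()))
*-⁻¹ {p@(mkℚ +[1+ _ ] _ _)} _ = *-inverseʳ p
*-⁻¹ {mkℚ -[1+ _ ] _ _} (*<* ())

⁻¹-pos : ∀ {p} → 0ℚ < p → 0ℚ < p ⁻¹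
⁻¹-pos {mkℚ +0 _ _} (*<* (ℤ.+<+ ()))
⁻¹-pos {p@(mkℚ +[1+ _ ] _ _)} _ = positive⁻¹ (1/ p)
⁻¹-pos {mkℚ -[1+ _ ] _ _} (*<* ())

ι-+ : ∀ m n → ι (m ℕ.+ n) ≡ ι m + ι n
ι-+ m n = sym (trans (cong (ℚ._/ 1) (cong₂ ℤ._+_ (ℤP.*-identityʳ (+ m)) (ℤP.*-identityʳ (+ n)))) (↥p/↧p≡p (ι (m ℕ.+ n))))

ι-* : ∀ m n → ι (m ℕ.* n) ≡ ι m * ι n
ι-* m n = sym (trans (cong (ℚ._/ 1) (sym (ℤP.pos-* m n))) (↥p/↧p≡p (ι (m ℕ.* n))))

ι-≤ : ∀ {m n} → m ℕ.≤ n → ι m ≤ ι n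
ι-≤ {m} {n} m≤n = *≤* (subst₂ ℤ._≤_ (sym (ℤP.*-identityʳ (+ m))) (sym (ℤP.*-identityʳ (+ n))) (ℤ.+≤+ m≤n))

ι-suc-pos : ∀ n → 0ℚ < ι (suc n)
ι-suc-pos n = positive⁻¹ (ι (suc n))

0≤ι : ∀ n → 0ℚ ≤ ι n
0≤ι n = ι-≤ ℕ.z≤n

*-monoˡ : ∀ {r p q} → 0ℚ ≤ r → p ≤ q → r * p ≤ r * q
*-monoˡ {r} 0≤r = *-monoˡ-≤-nonNeg r {{ℚ.nonNegative 0≤r}}

*-monoʳ : ∀ {r p q} → 0ℚ ≤ r → p ≤ q → p * r ≤ q * r
*-monoʳ {r} 0≤r = *-monoʳ-≤-nonNeg r {{ℚ.nonNegative 0≤r}}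

*-mono : ∀ {p q r s} → 0ℚ ≤ r → 0ℚ ≤ q → p ≤ q → r ≤ s → p * r ≤ q * s
*-mono 0≤r 0≤q p≤q r≤s = ≤-trans (*-monoʳ 0≤r p≤q) (*-monoˡ 0≤q r≤s)

*-pos : ∀ {p q} → 0ℚ < p → 0ℚ < q → 0ℚ < p * q
*-pos {p} {q} 0<p 0<q = positive⁻¹ (p * q) {{pos*pos⇒pos p {{ℚ.positive 0<p}} q {{ℚ.positive 0<q}}}}

*-nonNeg : ∀ {p q} → 0ℚ ≤ p → 0ℚ ≤ q → 0ℚ ≤ p * q
*-nonNeg {p} {q} 0≤p 0≤q = nonNegative⁻¹ (p * q) {{nonNeg*nonNeg⇒nonNeg p {{ℚ.nonNegative 0≤p}} q {{ℚ.nonNegative 0≤q}}}}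

⁻¹-anti : ∀ {p q} → 0ℚ < p → p ≤ q → q ⁻¹ ≤ p ⁻¹
⁻¹-anti {p} {q} 0<p p≤q = subst₂ _≤_ lhs rhs
  (*-monoʳ (<⇒≤ (*-pos (⁻¹-pos 0<p) (⁻¹-pos 0<q))) p≤q)
  where
  0<q : 0ℚ < q
  0<q = <-≤-trans 0<p p≤q
  lhs : p * (p ⁻¹ * q ⁻¹) ≡ q ⁻¹
  lhs = trans (sym (*-assoc p (p ⁻¹) (q ⁻¹))) (trans (cong (_* q ⁻¹) (*-⁻¹ 0<p)) (*-identityˡ (q ⁻¹)))
  rhs : q * (p ⁻¹ * q ⁻¹) ≡ p ⁻¹
  rhs = trans (solve 3 (λ a b c → a :* (b :* c) := b :* (a :* c)) refl q (p ⁻¹) (q ⁻¹))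
          (trans (cong (p ⁻¹ *_) (*-⁻¹ 0<q)) (*-identityʳ (p ⁻¹)))

½-pos : ∀ {ε} → 0ℚ < ε → 0ℚ < ½ * ε
½-pos = *-pos (positive⁻¹ ½)

halves : ∀ ε → ½ * ε + ½ * ε ≡ ε
halves ε = trans (sym (*-distribʳ-+ ε ½ ½)) (*-identityˡ ε)

≤∣∣ : ∀ p → p ≤ ∣ p ∣
≤∣∣ p = [ (λ 0≤p → ≤-reflexive (sym (0≤p⇒∣p∣≡p 0≤p))) , (λ p≤0 → ≤-trans p≤0 (0≤∣p∣ p)) ]′ (≤-total 0ℚ p)

∣-∣-comm : ∀ p q → ∣ p - q ∣ ≡ ∣ q - p ∣
∣-∣-comm p q = trans (sym (∣-p∣≡∣p∣ (p - q))) (cong ∣_∣ (solve 2 (λ a b → :- (a :- b) := b :- a) refl p q))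

∣∣-intro : ∀ {p q r} → p ≤ q + r → q ≤ p + r → ∣ p - q ∣ ≤ r
∣∣-intro {p} {q} {r} h k with ∣p∣≡p∨∣p∣≡-p (p - q)
... | inj₁ e = ≤-trans (≤-reflexive e) (≤-trans (+-monoˡ-≤ (- q) h)
                 (≤-reflexive (solve 2 (λ a b → (a :+ b) :- a := b) refl q r)))
... | inj₂ e = ≤-trans (≤-reflexive (trans e (solve 2 (λ a b → :- (a :- b) := b :- a) refl p q)))
                 (≤-trans (+-monoˡ-≤ (- p) k) (≤-reflexive (solve 2 (λ a b → (a :+ b) :- a := b) refl p r)))

∣∣-elim : ∀ {p q r} → ∣ p - q ∣ ≤ r → p ≤ q + r
∣∣-elim {p} {q} {r} h = ≤-trans (≤-reflexive (solve 2 (λ a b → a := b :+ (a :- b)) refl p q))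
  (+-monoʳ-≤ q (≤-trans (≤∣∣ (p - q)) h))

triangle : ∀ p q r → ∣ p - r ∣ ≤ ∣ p - q ∣ + ∣ q - r ∣
triangle p q r = ≤-trans (≤-reflexive (cong ∣_∣ (solve 3 (λ a b c → a :- c := (a :- b) :+ (b :- c)) refl p q r)))
  (∣p+q∣≤∣p∣+∣q∣ (p - q) (q - r))

∣∣-diff : ∀ p q → ∣ ∣ p ∣ - ∣ q ∣ ∣ ≤ ∣ p - q ∣
∣∣-diff p q = ∣∣-intro (step p q) (≤-trans (step q p) (≤-reflexive (cong (∣ p ∣ ℚ.+_) (∣-∣-comm q p))))
  where
  step : ∀ a b → ∣ a ∣ ≤ ∣ b ∣ + ∣ a - b ∣
  step a b = ≤-trans (≤-reflexive (cong ∣_∣ (solve 2 (λ a b → a := b :+ (a :- b)) refl a b))) (∣p+q∣≤∣p∣+∣q∣ b (a - b))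

ι⁻¹-archimedean : ∀ ε → 0ℚ < ε → ∃ λ N → ∀ n → N ℕ.≤ n → ι (suc n) ⁻¹ ≤ ε
ι⁻¹-archimedean (mkℚ +0 _ _) (*<* (ℤ.+<+ ()))
ι⁻¹-archimedean (mkℚ -[1+ _ ] _ _) (*<* ())
ι⁻¹-archimedean (mkℚ +[1+ a ] d _) _ = d , λ n d≤n → *≤* (subst₂ ℤ._≤_
  (ℤP.pos-* 1 (suc d)) (ℤP.pos-* (suc a) (suc n))
  (ℤ.+≤+ (ℕP.*-mono-≤ {1} {suc a} {suc d} {suc n} (ℕ.s≤s ℕ.z≤n) (ℕ.s≤s d≤n))))

scaled-archimedean : ∀ c ε → 0ℚ < c → 0ℚ < ε → ∃ λ N → ∀ n → N ℕ.≤ n → c * ι (suc n) ⁻¹ ≤ ε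
scaled-archimedean c ε 0<c 0<ε = go (ι⁻¹-archimedean (ε * c ⁻¹) (*-pos 0<ε (⁻¹-pos 0<c)))
  where
  go : (∃ λ N → ∀ n → N ℕ.≤ n → ι (suc n) ⁻¹ ≤ ε * c ⁻¹) → ∃ λ N → ∀ n → N ℕ.≤ n → c * ι (suc n) ⁻¹ ≤ ε
  go (N , small) = N , λ n N≤n → ≤-trans (*-monoˡ (<⇒≤ 0<c) (small n N≤n))
    (≤-reflexive (trans (solve 3 (λ c e d → c :* (e :* d) := e :* (c :* d)) refl c ε (c ⁻¹))
      (trans (cong (ε *_) (*-⁻¹ 0<c)) (*-identityʳ ε))))

-- A real is a Cauchy sequence of rationals; x and y are the same real when x ≤ᵣ y and y ≤ᵣ x.

Cauchy : (ℕ → ℚ) → Set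
Cauchy s = ∀ ε → 0ℚ < ε → ∃ λ N → ∀ m n → N ℕ.≤ m → N ℕ.≤ n → ∣ s m - s n ∣ ≤ ε

record ℝ : Set where
  constructor mkℝ
  field
    seq    : ℕ → ℚ
    cauchy : Cauchy seq

open ℝ public

infix 4 _≤ᵣ_ _<ᵣ_

_≤ᵣ_ : ℝ → ℝ → Set
x ≤ᵣ y = ∀ ε → 0ℚ < ε → ∃ λ N → ∀ n → N ℕ.≤ n → seq x n ≤ seq y n + ε

_<ᵣ_ : ℝ → ℝ → Set
x <ᵣ y = ∃ λ ε → 0ℚ < ε × ∃ λ N → ∀ n → N ℕ.≤ n → seq x n + ε ≤ seq y n

Close : (ℕ → ℚ) → ℚ → ℕ → Set
Close s ε N = ∀ m n → N ℕ.≤ m → N ℕ.≤ n → ∣ s m - s n ∣ ≤ ε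

⊔ˡ : ∀ a b {n} → a ℕ.⊔ b ℕ.≤ n → a ℕ.≤ n
⊔ˡ a b = ℕP.≤-trans (ℕP.m≤m⊔n a b)

⊔ʳ : ∀ a b {n} → a ℕ.⊔ b ℕ.≤ n → b ℕ.≤ n
⊔ʳ a b = ℕP.≤-trans (ℕP.m≤n⊔m a b)

tail-close : ∀ (s w : ℕ → ℚ) ε N → (∀ n j → ∣ s (n ℕ.+ j) - s n ∣ ≤ w n) →
             (∀ n → N ℕ.≤ n → w n ≤ ε) → Close s ε N
tail-close s w ε N tail small m n N≤m N≤n =
  [ (λ m≤n → ≤-trans (≤-reflexive (∣-∣-comm (s m) (s n))) (go m n N≤m m≤n)) , go n m N≤n ]′ (ℕP.≤-total m n)
  where
  go : ∀ a b → N ℕ.≤ a → a ℕ.≤ b → ∣ s b - s a ∣ ≤ ε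
  go a b N≤a a≤b = ≤-trans (subst (λ c → ∣ s c - s a ∣ ≤ w a) (ℕP.m+[n∸m]≡n a≤b) (tail a (b ℕ.∸ a))) (small a N≤a)

tail-cauchy : ∀ (s : ℕ → ℚ) c → 0ℚ < c → (∀ n j → ∣ s (n ℕ.+ j) - s n ∣ ≤ c * ι (suc n) ⁻¹) → Cauchy s
tail-cauchy s c 0<c tail ε 0<ε = go (scaled-archimedean c ε 0<c 0<ε)
  where
  go : (∃ λ N → ∀ n → N ℕ.≤ n → c * ι (suc n) ⁻¹ ≤ ε) → ∃ (Close s ε)
  go (N , small) = N , tail-close s (λ n → c * ι (suc n) ⁻¹) ε N tail small

bounded : ∀ x → ∃ λ B → 0ℚ < B × ∃ λ N → ∀ n → N ℕ.≤ n → ∣ seq x n ∣ ≤ B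
bounded x with cauchy x 1ℚ (positive⁻¹ 1ℚ)
... | N , close = ∣ seq x N ∣ + 1ℚ
    , ≤-<-trans (0≤∣p∣ (seq x N)) (≤-<-trans (≤-reflexive (sym (+-identityʳ ∣ seq x N ∣))) (+-monoʳ-< ∣ seq x N ∣ (positive⁻¹ 1ℚ)))
    , N , λ n N≤n → ∣∣-elim (≤-trans (∣∣-diff (seq x n) (seq x N)) (close n N N≤n ℕP.≤-refl))

fromℚ : ℚ → ℝ
fromℚ p = mkℝ (λ _ → p) (λ ε 0<ε → 0 , λ _ _ _ _ → ≤-trans (≤-reflexive (cong ∣_∣ (+-inverseʳ p))) (<⇒≤ 0<ε))

infixl 6 _+ᵣ_ _-ᵣ_
infixl 7 _*ᵣ_
infix  8 -ᵣ_
infixr 8 _^ᵣ_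

_+ᵣ_ : ℝ → ℝ → ℝ
x +ᵣ y = mkℝ (λ n → seq x n + seq y n) proof
  where
  proof : Cauchy (λ n → seq x n + seq y n)
  proof ε 0<ε with cauchy x (½ * ε) (½-pos 0<ε) | cauchy y (½ * ε) (½-pos 0<ε)
  ... | M , cx | N , cy = M ℕ.⊔ N , λ m n hm hn → ≤-trans
    (≤-reflexive (cong ∣_∣ (solve 4 (λ a b c d → (a :+ b) :- (c :+ d) := (a :- c) :+ (b :- d)) refl
      (seq x m) (seq y m) (seq x n) (seq y n))))
    (≤-trans (∣p+q∣≤∣p∣+∣q∣ (seq x m - seq x n) (seq y m - seq y n))
    (≤-trans (+-mono-≤ (cx m n (⊔ˡ M N hm) (⊔ˡ M N hn)) (cy m n (⊔ʳ M N hm) (⊔ʳ M N hn)))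
    (≤-reflexive (halves ε))))

-ᵣ_ : ℝ → ℝ
-ᵣ x = mkℝ (λ n → - seq x n) proof
  where
  proof : Cauchy (λ n → - seq x n)
  proof ε 0<ε with cauchy x ε 0<ε
  ... | N , c = N , λ m n hm hn → ≤-trans (≤-reflexive (trans
    (cong ∣_∣ (solve 2 (λ a b → :- a :- :- b := b :- a) refl (seq x m) (seq x n)))
    (∣-∣-comm (seq x n) (seq x m)))) (c m n hm hn)

_-ᵣ_ : ℝ → ℝ → ℝ
x -ᵣ y = x +ᵣ -ᵣ y

∣_∣ᵣ : ℝ → ℝ
∣ x ∣ᵣ = mkℝ (λ n → ∣ seq x n ∣) proof
  where
  proof : Cauchy (λ n → ∣ seq x n ∣)
  proof ε 0<ε with cauchy x ε 0<ε
  ... | N , c = N , λ m n hm hn → ≤-trans (∣∣-diff (seq x m) (seq x n)) (c m n hm hn)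

*-close : ∀ a b c d A B h → 0ℚ < A → 0ℚ < B → ∣ a ∣ ≤ A → ∣ d ∣ ≤ B →
          ∣ b - d ∣ ≤ h * A ⁻¹ → ∣ a - c ∣ ≤ h * B ⁻¹ → ∣ a * b - c * d ∣ ≤ h + h
*-close a b c d A B h 0<A 0<B a≤A d≤B b-d a-c = begin
  ∣ a * b - c * d ∣                     ≡⟨ cong ∣_∣ (solve 4 (λ a b c d → a :* b :- c :* d := a :* (b :- d) :+ d :* (a :- c)) refl a b c d) ⟩
  ∣ a * (b - d) + d * (a - c) ∣         ≤⟨ ∣p+q∣≤∣p∣+∣q∣ (a * (b - d)) (d * (a - c)) ⟩
  ∣ a * (b - d) ∣ + ∣ d * (a - c) ∣     ≤⟨ +-mono-≤ (bound a (b - d) A 0<A a≤A b-d) (bound d (a - c) B 0<B d≤B a-c) ⟩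
  h + h                                 ∎
  where
  open ≤-Reasoning
  bound : ∀ u v C → 0ℚ < C → ∣ u ∣ ≤ C → ∣ v ∣ ≤ h * C ⁻¹ → ∣ u * v ∣ ≤ h
  bound u v C 0<C hu hv = begin
    ∣ u * v ∣         ≡⟨ ∣p*q∣≡∣p∣*∣q∣ u v ⟩
    ∣ u ∣ * ∣ v ∣     ≤⟨ *-mono (0≤∣p∣ v) (<⇒≤ 0<C) hu hv ⟩
    C * (h * C ⁻¹)    ≡⟨ solve 3 (λ c e d → c :* (e :* d) := e :* (c :* d)) refl C h (C ⁻¹) ⟩
    h * (C * C ⁻¹)    ≡⟨ cong (h *_) (*-⁻¹ 0<C) ⟩
    h * 1ℚ            ≡⟨ *-identityʳ h ⟩
    h                 ∎

_*ᵣ_ : ℝ → ℝ → ℝ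
x *ᵣ y = mkℝ (λ n → seq x n * seq y n) (λ ε 0<ε → proof ε 0<ε (bounded x) (bounded y))
  where
  Bounded : ℝ → Set
  Bounded z = ∃ λ B → 0ℚ < B × ∃ λ N → ∀ n → N ℕ.≤ n → ∣ seq z n ∣ ≤ B
  proof : ∀ ε → 0ℚ < ε → Bounded x → Bounded y → ∃ (Close (λ n → seq x n * seq y n) ε)
  proof ε 0<ε (A , 0<A , M , bx) (B , 0<B , N , by) =
      combine (cauchy y (h * A ⁻¹) (*-pos 0<h (⁻¹-pos 0<A))) (cauchy x (h * B ⁻¹) (*-pos 0<h (⁻¹-pos 0<B)))
    where
    h : ℚ
    h = ½ * ε
    0<h : 0ℚ < h
    0<h = ½-pos 0<ε
    combine : ∃ (Close (seq y) (h * A ⁻¹)) → ∃ (Close (seq x) (h * B ⁻¹)) → ∃ (Close (λ n → seq x n * seq y n) ε)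
    combine (K , cy) (L , cx) = (M ℕ.⊔ N) ℕ.⊔ (K ℕ.⊔ L) , λ m n hm hn →
      let hm₁ = ⊔ˡ (M ℕ.⊔ N) (K ℕ.⊔ L) hm
          hm₂ = ⊔ʳ (M ℕ.⊔ N) (K ℕ.⊔ L) hm
          hn₁ = ⊔ˡ (M ℕ.⊔ N) (K ℕ.⊔ L) hn
          hn₂ = ⊔ʳ (M ℕ.⊔ N) (K ℕ.⊔ L) hn
      in ≤-trans
        (*-close (seq x m) (seq y m) (seq x n) (seq y n) A B h 0<A 0<B
          (bx m (⊔ˡ M N hm₁)) (by n (⊔ʳ M N hn₁))
          (cy m n (⊔ˡ K L hm₂) (⊔ˡ K L hn₂)) (cx m n (⊔ʳ K L hm₂) (⊔ʳ K L hn₂)))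
        (≤-reflexive (halves ε))

_^ᵣ_ : ℝ → ℕ → ℝ
x ^ᵣ zero  = fromℚ 1ℚ
x ^ᵣ suc k = x *ᵣ x ^ᵣ k

∑ᵣ : (ℕ → ℝ) → ℕ → ℝ
∑ᵣ f zero    = fromℚ 0ℚ
∑ᵣ f (suc n) = ∑ᵣ f n +ᵣ f n

inv : (x : ℝ) → fromℚ 0ℚ <ᵣ x → ℝ
inv x (δ , 0<δ , M , pos) = mkℝ (λ n → seq x n ⁻¹) proof
  where
  δ≤ : ∀ {n} → M ℕ.≤ n → δ ≤ seq x n
  δ≤ {n} h = subst (_≤ seq x n) (+-identityˡ δ) (pos n h)
  proof : Cauchy (λ n → seq x n ⁻¹)
  proof ε 0<ε with cauchy x (ε * (δ * δ)) (*-pos 0<ε (*-pos 0<δ 0<δ))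
  ... | N , c = M ℕ.⊔ N , λ m n hm hn → bound (δ≤ (⊔ˡ M N hm)) (δ≤ (⊔ˡ M N hn)) (c m n (⊔ʳ M N hm) (⊔ʳ M N hn))
    where
    bound : ∀ {a b} → δ ≤ a → δ ≤ b → ∣ a - b ∣ ≤ ε * (δ * δ) → ∣ a ⁻¹ - b ⁻¹ ∣ ≤ ε
    bound {a} {b} δ≤a δ≤b h = begin
      ∣ a ⁻¹ - b ⁻¹ ∣                     ≡⟨ cong ∣_∣ identity ⟩
      ∣ (b - a) * (a ⁻¹ * b ⁻¹) ∣         ≡⟨ ∣p*q∣≡∣p∣*∣q∣ (b - a) (a ⁻¹ * b ⁻¹) ⟩
      ∣ b - a ∣ * ∣ a ⁻¹ * b ⁻¹ ∣         ≡⟨ cong₂ _*_ (∣-∣-comm b a) (0≤p⇒∣p∣≡p (<⇒≤ (*-pos (⁻¹-pos 0<a) (⁻¹-pos 0<b)))) ⟩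
      ∣ a - b ∣ * (a ⁻¹ * b ⁻¹)           ≤⟨ *-mono (<⇒≤ (*-pos (⁻¹-pos 0<a) (⁻¹-pos 0<b))) (<⇒≤ (*-pos 0<ε (*-pos 0<δ 0<δ))) h
                                               (*-mono (<⇒≤ (⁻¹-pos 0<b)) (<⇒≤ (⁻¹-pos 0<δ)) (⁻¹-anti 0<δ δ≤a) (⁻¹-anti 0<δ δ≤b)) ⟩
      (ε * (δ * δ)) * (δ ⁻¹ * δ ⁻¹)       ≡⟨ solve 3 (λ e d i → (e :* (d :* d)) :* (i :* i) := e :* ((d :* i) :* (d :* i))) refl ε δ (δ ⁻¹) ⟩
      ε * ((δ * δ ⁻¹) * (δ * δ ⁻¹))       ≡⟨ cong (λ t → ε * (t * t)) (*-⁻¹ 0<δ) ⟩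
      ε * 1ℚ                              ≡⟨ *-identityʳ ε ⟩
      ε                                   ∎
      where
      open ≤-Reasoning
      0<a = <-≤-trans 0<δ δ≤a
      0<b = <-≤-trans 0<δ δ≤b
      identity : a ⁻¹ - b ⁻¹ ≡ (b - a) * (a ⁻¹ * b ⁻¹)
      identity = sym (trans (solve 4 (λ a b i j → (b :- a) :* (i :* j) := i :* (b :* j) :- j :* (a :* i)) refl a b (a ⁻¹) (b ⁻¹))
        (cong₂ _-_ (trans (cong (a ⁻¹ *_) (*-⁻¹ 0<b)) (*-identityʳ (a ⁻¹)))
                   (trans (cong (b ⁻¹ *_) (*-⁻¹ 0<a)) (*-identityʳ (b ⁻¹)))))

_⟶_ : (ℕ → ℝ) → ℝ → Set
a ⟶ x = ∀ ε → 0ℚ < ε → ∃ λ N → ∀ n → N ℕ.≤ n → ∣ a n -ᵣ x ∣ᵣ ≤ᵣ fromℚ ε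

Cauchyᵣ : (ℕ → ℝ) → Set
Cauchyᵣ a = ∀ ε → 0ℚ < ε → ∃ λ N → ∀ m n → N ℕ.≤ m → N ℕ.≤ n → ∣ a m -ᵣ a n ∣ᵣ ≤ᵣ fromℚ ε

lim-index : (ℕ → ℝ) → ℕ → ℕ
lim-index a n = proj₁ (cauchy (a n) (ι (suc n) ⁻¹) (⁻¹-pos (ι-suc-pos n)))

-- A rational within 1/(n+1) of a n.
lim-approx : (ℕ → ℝ) → ℕ → ℚ
lim-approx a n = seq (a n) (lim-index a n)

lim-near : ∀ a n i → lim-index a n ℕ.≤ i → ∣ lim-approx a n - seq (a n) i ∣ ≤ ι (suc n) ⁻¹
lim-near a n i h = proj₂ (cauchy (a n) (ι (suc n) ⁻¹) (⁻¹-pos (ι-suc-pos n))) (lim-index a n) i ℕP.≤-refl h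

lim : (a : ℕ → ℝ) → Cauchyᵣ a → ℝ
lim a c = mkℝ approx proof
  where
  index : ℕ → ℕ
  index = lim-index a
  approx : ℕ → ℚ
  approx = lim-approx a
  near : ∀ n i → index n ℕ.≤ i → ∣ approx n - seq (a n) i ∣ ≤ ι (suc n) ⁻¹
  near = lim-near a
  proof : Cauchy approx
  proof ε 0<ε = combine (c η 0<η) (ι⁻¹-archimedean η 0<η)
    where
    η : ℚ
    η = ½ * (½ * ε)
    0<η : 0ℚ < η
    0<η = ½-pos (½-pos 0<ε)
    sum : (η + (η + η)) + η ≡ ε
    sum = trans (solve 1 (λ h → (h :+ (h :+ h)) :+ h := (h :+ h) :+ (h :+ h)) refl η)
            (trans (cong₂ _+_ (halves (½ * ε)) (halves (½ * ε))) (halves ε))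
    combine : (∃ λ N → ∀ m n → N ℕ.≤ m → N ℕ.≤ n → ∣ a m -ᵣ a n ∣ᵣ ≤ᵣ fromℚ η) →
              (∃ λ N → ∀ n → N ℕ.≤ n → ι (suc n) ⁻¹ ≤ η) → ∃ (Close approx ε)
    combine (M , hM) (N , hN) = M ℕ.⊔ N , λ m n hm hn → step m n hm hn (hM m n (⊔ˡ M N hm) (⊔ˡ M N hn) η 0<η)
      where
      step : ∀ m n → M ℕ.⊔ N ℕ.≤ m → M ℕ.⊔ N ℕ.≤ n →
             (∃ λ K → ∀ i → K ℕ.≤ i → ∣ seq (a m) i - seq (a n) i ∣ ≤ η + η) → ∣ approx m - approx n ∣ ≤ ε
      step m n hm hn (K , hK) = begin
        ∣ approx m - approx n ∣
          ≤⟨ triangle (approx m) (seq (a n) i) (approx n) ⟩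
        ∣ approx m - seq (a n) i ∣ + ∣ seq (a n) i - approx n ∣
          ≤⟨ +-mono-≤ (triangle (approx m) (seq (a m) i) (seq (a n) i)) (≤-reflexive (∣-∣-comm (seq (a n) i) (approx n))) ⟩
        (∣ approx m - seq (a m) i ∣ + ∣ seq (a m) i - seq (a n) i ∣) + ∣ approx n - seq (a n) i ∣
          ≤⟨ +-mono-≤ (+-mono-≤ (≤-trans (near m i m≤i) (hN m (⊔ʳ M N hm))) (hK i K≤i)) (≤-trans (near n i n≤i) (hN n (⊔ʳ M N hn))) ⟩
        (η + (η + η)) + η
          ≡⟨ sum ⟩
        ε ∎
        where
        open ≤-Reasoning
        i : ℕ
        i = K ℕ.⊔ (index m ℕ.⊔ index n)
        K≤i : K ℕ.≤ i
        K≤i = ℕP.m≤m⊔n K (index m ℕ.⊔ index n)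
        m≤i : index m ℕ.≤ i
        m≤i = ⊔ˡ (index m) (index n) (ℕP.m≤n⊔m K (index m ℕ.⊔ index n))
        n≤i : index n ℕ.≤ i
        n≤i = ⊔ʳ (index m) (index n) (ℕP.m≤n⊔m K (index m ℕ.⊔ index n))

lim-converges : ∀ a (c : Cauchyᵣ a) → a ⟶ lim a c
lim-converges a c ε 0<ε = proj₁ (c ε 0<ε) , λ n M≤n η 0<η →
    combine n M≤n η (½ * (½ * η)) (½-pos (½-pos 0<η)) (halves⁴ η)
      (cauchy (a n) (½ * (½ * η)) (½-pos (½-pos 0<η))) (ι⁻¹-archimedean (½ * (½ * η)) (½-pos (½-pos 0<η)))
  where
  M : ℕ
  M = proj₁ (c ε 0<ε)
  halves⁴ : ∀ η → (½ * (½ * η) + ½ * (½ * η)) + (½ * (½ * η) + ½ * (½ * η)) ≡ η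
  halves⁴ η = trans (cong₂ _+_ (halves (½ * η)) (halves (½ * η))) (halves η)
  combine : ∀ n → M ℕ.≤ n → ∀ η h → 0ℚ < h → (h + h) + (h + h) ≡ η → ∃ (Close (seq (a n)) h) →
            (∃ λ N → ∀ i → N ℕ.≤ i → ι (suc i) ⁻¹ ≤ h) →
            ∃ λ K → ∀ i → K ℕ.≤ i → ∣ seq (a n) i - lim-approx a i ∣ ≤ ε + η
  combine n M≤n η h 0<h 4h≡η (L , hL) (N , hN) = M ℕ.⊔ (L ℕ.⊔ N) , λ i K≤i →
      step i (⊔ˡ L N (⊔ʳ M (L ℕ.⊔ N) K≤i)) (⊔ʳ L N (⊔ʳ M (L ℕ.⊔ N) K≤i))
        (proj₂ (c ε 0<ε) n i M≤n (⊔ˡ M (L ℕ.⊔ N) K≤i) h 0<h)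
    where
    step : ∀ i → L ℕ.≤ i → N ℕ.≤ i → (∃ λ K → ∀ j → K ℕ.≤ j → ∣ seq (a n) j - seq (a i) j ∣ ≤ ε + h) →
           ∣ seq (a n) i - lim-approx a i ∣ ≤ ε + η
    step i L≤i N≤i (K , hK) = begin
      ∣ seq (a n) i - lim-approx a i ∣
        ≤⟨ triangle (seq (a n) i) (seq (a n) j) (lim-approx a i) ⟩
      ∣ seq (a n) i - seq (a n) j ∣ + ∣ seq (a n) j - lim-approx a i ∣
        ≤⟨ +-mono-≤ (hL i j L≤i L≤j) (triangle (seq (a n) j) (seq (a i) j) (lim-approx a i)) ⟩
      h + (∣ seq (a n) j - seq (a i) j ∣ + ∣ seq (a i) j - lim-approx a i ∣)
        ≤⟨ +-monoʳ-≤ h (+-mono-≤ (hK j K≤j) (≤-trans (≤-reflexive (∣-∣-comm (seq (a i) j) (lim-approx a i)))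
             (≤-trans (lim-near a i j I≤j) (hN i N≤i)))) ⟩
      h + ((ε + h) + h)
        ≡⟨ solve 2 (λ h e → h :+ ((e :+ h) :+ h) := e :+ ((h :+ h) :+ h)) refl h ε ⟩
      ε + ((h + h) + h)
        ≤⟨ +-monoʳ-≤ ε (+-monoʳ-≤ (h + h) (≤-trans (≤-reflexive (sym (+-identityʳ h))) (+-monoʳ-≤ h (<⇒≤ 0<h)))) ⟩
      ε + ((h + h) + (h + h))
        ≡⟨ cong (λ t → ε + t) 4h≡η ⟩
      ε + η ∎
      where
      open ≤-Reasoning
      j : ℕ
      j = K ℕ.⊔ (L ℕ.⊔ lim-index a i)
      K≤j : K ℕ.≤ j
      K≤j = ℕP.m≤m⊔n K (L ℕ.⊔ lim-index a i)
      L≤j : L ℕ.≤ j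
      L≤j = ⊔ˡ L (lim-index a i) (ℕP.m≤n⊔m K (L ℕ.⊔ lim-index a i))
      I≤j : lim-index a i ℕ.≤ j
      I≤j = ⊔ʳ L (lim-index a i) (ℕP.m≤n⊔m K (L ℕ.⊔ lim-index a i))

-- π = 4 (1 - 1/3 + 1/5 - 1/7 + ⋯)

sign : ℕ → ℚ
sign zero    = 1ℚ
sign (suc k) = - sign k

leibniz : ℕ → ℚ
leibniz k = sign k * (ι 4 * ι (suc (2 ℕ.* k)) ⁻¹)

π : ℝ
π = mkℝ (∑ leibniz) (tail-cauchy (∑ leibniz) (ι 4) (ι-suc-pos 3) tail)
  where
  b : ℕ → ℚ
  b k = ι 4 * ι (suc (2 ℕ.* k)) ⁻¹
  S : ℕ → ℚ
  S = ∑ leibniz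
  ⁻¹-nonNeg : ∀ n → 0ℚ ≤ ι (suc n) ⁻¹
  ⁻¹-nonNeg n = <⇒≤ (⁻¹-pos (ι-suc-pos n))
  b-nonNeg : ∀ k → 0ℚ ≤ b k
  b-nonNeg k = *-nonNeg (0≤ι 4) (⁻¹-nonNeg (2 ℕ.* k))
  b-anti : ∀ {j k} → j ℕ.≤ k → b k ≤ b j
  b-anti {j} h = *-monoˡ (0≤ι 4) (⁻¹-anti (ι-suc-pos (2 ℕ.* j)) (ι-≤ (ℕ.s≤s (ℕP.*-monoʳ-≤ 2 h))))
  ∣sign∣ : ∀ k → ∣ sign k ∣ ≡ 1ℚ
  ∣sign∣ zero    = refl
  ∣sign∣ (suc k) = trans (∣-p∣≡∣p∣ (sign k)) (∣sign∣ k)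
  alternating : ∀ j n → ∃ λ r → 0ℚ ≤ r × r ≤ b n × S (n ℕ.+ j) - S n ≡ sign n * r
  alternating zero n = 0ℚ , ≤-refl , b-nonNeg n ,
    trans (cong (λ k → S k - S n) (ℕP.+-identityʳ n)) (trans (+-inverseʳ (S n)) (sym (*-zeroʳ (sign n))))
  alternating (suc j) n = step (alternating j (suc n))
    where
    step : (∃ λ r → 0ℚ ≤ r × r ≤ b (suc n) × S (suc n ℕ.+ j) - S (suc n) ≡ sign (suc n) * r) →
           ∃ λ r → 0ℚ ≤ r × r ≤ b n × S (n ℕ.+ suc j) - S n ≡ sign n * r
    step (r , 0≤r , r≤b , e) = b n - r
      , ≤-trans (≤-reflexive (sym (+-inverseʳ r))) (+-monoˡ-≤ (- r) (≤-trans r≤b (b-anti (ℕP.n≤1+n n))))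
      , ≤-trans (+-monoʳ-≤ (b n) (neg-antimono-≤ 0≤r)) (≤-reflexive (+-identityʳ (b n)))
      , trans (cong (λ k → S k - S n) (ℕP.+-suc n j))
          (trans (solve 3 (λ t s u → t :- s := (t :- (s :+ u)) :+ u) refl (S (suc n ℕ.+ j)) (S n) (sign n * b n))
          (trans (cong (_+ sign n * b n) e)
            (solve 3 (λ s b r → (:- s) :* r :+ s :* b := s :* (b :- r)) refl (sign n) (b n) r)))
  tail : ∀ n j → ∣ S (n ℕ.+ j) - S n ∣ ≤ ι 4 * ι (suc n) ⁻¹
  tail n j = bound (alternating j n)
    where
    bound : (∃ λ r → 0ℚ ≤ r × r ≤ b n × S (n ℕ.+ j) - S n ≡ sign n * r) → ∣ S (n ℕ.+ j) - S n ∣ ≤ ι 4 * ι (suc n) ⁻¹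
    bound (r , 0≤r , r≤b , e) = begin
      ∣ S (n ℕ.+ j) - S n ∣       ≡⟨ cong ∣_∣ e ⟩
      ∣ sign n * r ∣              ≡⟨ ∣p*q∣≡∣p∣*∣q∣ (sign n) r ⟩
      ∣ sign n ∣ * ∣ r ∣          ≡⟨ cong₂ _*_ (∣sign∣ n) (0≤p⇒∣p∣≡p 0≤r) ⟩
      1ℚ * r                      ≡⟨ *-identityˡ r ⟩
      r                           ≤⟨ r≤b ⟩
      b n                         ≤⟨ *-monoˡ (0≤ι 4) (⁻¹-anti (ι-suc-pos n) (ι-≤ (ℕ.s≤s (ℕP.m≤m+n n (n ℕ.+ 0))))) ⟩
      ι 4 * ι (suc n) ⁻¹          ∎
      where open ≤-Reasoning

-- isqrt m = ⌊√m⌋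
isqrt : ℕ → ℕ
isqrt zero    = 0
isqrt (suc m) = if (suc (isqrt m) ℕ.* suc (isqrt m)) ℕ.≤ᵇ suc m then suc (isqrt m) else isqrt m

isqrt-spec : ∀ m → isqrt m ℕ.* isqrt m ℕ.≤ m × m ℕ.< suc (isqrt m) ℕ.* suc (isqrt m)
isqrt-spec zero = ℕ.z≤n , ℕ.s≤s ℕ.z≤n
isqrt-spec (suc m) with isqrt m | isqrt-spec m
... | a | lo , hi with (suc a ℕ.* suc a) ℕ.≤ᵇ suc m | ℕP.≤ᵇ-reflects-≤ (suc a ℕ.* suc a) (suc m)
... | true  | ofʸ le = le , ℕP.≤-<-trans hi (ℕP.*-mono-< (ℕP.n<1+n (suc a)) (ℕP.n<1+n (suc a)))
... | false | ofⁿ ¬le = ℕP.m≤n⇒m≤1+n lo , ℕP.≰⇒> ¬le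

square-cancel-< : ∀ a b → a ℕ.* a ℕ.< b ℕ.* b → a ℕ.< b
square-cancel-< a b h = ℕP.≰⇒> (λ b≤a → ℕP.<⇒≱ h (ℕP.*-mono-≤ b≤a b≤a))

ι-⁻¹-* : ∀ n → ι (suc n) * ι (suc n) ⁻¹ ≡ 1ℚ
ι-⁻¹-* n = *-⁻¹ (ι-suc-pos n)

-- The n-th approximation of √q is ⌊(n+1)√q⌋ / (n+1).
√ : ℕ → ℝ
√ q = mkℝ approx proof
  where
  root : ℕ → ℕ
  root n = isqrt (q ℕ.* (suc n ℕ.* suc n))
  approx : ℕ → ℚ
  approx n = ι (root n) * ι (suc n) ⁻¹
  cross : ∀ m n → root m ℕ.* suc n ℕ.≤ suc (root n) ℕ.* suc m
  cross m n = ℕP.<⇒≤ (square-cancel-< (root m ℕ.* suc n) (suc (root n) ℕ.* suc m) (begin-strict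
    (root m ℕ.* suc n) ℕ.* (root m ℕ.* suc n)      ≡⟨ ℕP.[m*n]*[o*p]≡[m*o]*[n*p] (root m) (suc n) (root m) (suc n) ⟩
    (root m ℕ.* root m) ℕ.* (suc n ℕ.* suc n)      ≤⟨ ℕP.*-monoˡ-≤ (suc n ℕ.* suc n) (proj₁ (isqrt-spec (q ℕ.* (suc m ℕ.* suc m)))) ⟩
    (q ℕ.* (suc m ℕ.* suc m)) ℕ.* (suc n ℕ.* suc n)  ≡⟨ ℕP.*-assoc q (suc m ℕ.* suc m) (suc n ℕ.* suc n) ⟩
    q ℕ.* ((suc m ℕ.* suc m) ℕ.* (suc n ℕ.* suc n))  ≡⟨ cong (q ℕ.*_) (ℕP.*-comm (suc m ℕ.* suc m) (suc n ℕ.* suc n)) ⟩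
    q ℕ.* ((suc n ℕ.* suc n) ℕ.* (suc m ℕ.* suc m))  ≡⟨ ℕP.*-assoc q (suc n ℕ.* suc n) (suc m ℕ.* suc m) ⟨
    (q ℕ.* (suc n ℕ.* suc n)) ℕ.* (suc m ℕ.* suc m)  <⟨ ℕP.*-monoˡ-< (suc m ℕ.* suc m) (proj₂ (isqrt-spec (q ℕ.* (suc n ℕ.* suc n)))) ⟩
    (suc (root n) ℕ.* suc (root n)) ℕ.* (suc m ℕ.* suc m)  ≡⟨ ℕP.[m*n]*[o*p]≡[m*o]*[n*p] (suc (root n)) (suc (root n)) (suc m) (suc m) ⟩
    (suc (root n) ℕ.* suc m) ℕ.* (suc (root n) ℕ.* suc m)  ∎))
    where open ℕP.≤-Reasoning
  one-sided : ∀ m n → approx m ≤ approx n + ι (suc n) ⁻¹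
  one-sided m n = begin
    ι (root m) * u                                ≡⟨ *-identityʳ (ι (root m) * u) ⟨
    (ι (root m) * u) * 1ℚ                         ≡⟨ cong ((ι (root m) * u) *_) (ι-⁻¹-* n) ⟨
    (ι (root m) * u) * (ι (suc n) * v)            ≡⟨ solve 4 (λ r u s v → (r :* u) :* (s :* v) := (r :* s) :* (u :* v)) refl (ι (root m)) u (ι (suc n)) v ⟩
    (ι (root m) * ι (suc n)) * (u * v)            ≡⟨ cong (_* (u * v)) (ι-* (root m) (suc n)) ⟨
    ι (root m ℕ.* suc n) * (u * v)                ≤⟨ *-monoʳ (<⇒≤ (*-pos (⁻¹-pos (ι-suc-pos m)) (⁻¹-pos (ι-suc-pos n)))) (ι-≤ (cross m n)) ⟩
    ι (suc (root n) ℕ.* suc m) * (u * v)          ≡⟨ cong (_* (u * v)) (ι-* (suc (root n)) (suc m)) ⟩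
    (ι (suc (root n)) * ι (suc m)) * (u * v)      ≡⟨ solve 4 (λ r s u v → (r :* s) :* (u :* v) := (r :* v) :* (s :* u)) refl (ι (suc (root n))) (ι (suc m)) u v ⟩
    (ι (suc (root n)) * v) * (ι (suc m) * u)      ≡⟨ cong ((ι (suc (root n)) * v) *_) (ι-⁻¹-* m) ⟩
    (ι (suc (root n)) * v) * 1ℚ                   ≡⟨ *-identityʳ (ι (suc (root n)) * v) ⟩
    ι (suc (root n)) * v                          ≡⟨ cong (_* v) (trans (ι-+ 1 (root n)) (+-comm 1ℚ (ι (root n)))) ⟩
    (ι (root n) + 1ℚ) * v                         ≡⟨ *-distribʳ-+ v (ι (root n)) 1ℚ ⟩
    ι (root n) * v + 1ℚ * v                       ≡⟨ cong (λ t → ι (root n) * v + t) (*-identityˡ v) ⟩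
    ι (root n) * v + v                            ∎
    where
    open ≤-Reasoning
    u v : ℚ
    u = ι (suc m) ⁻¹
    v = ι (suc n) ⁻¹
  proof : Cauchy approx
  proof ε 0<ε = go (ι⁻¹-archimedean ε 0<ε)
    where
    go : (∃ λ N → ∀ n → N ℕ.≤ n → ι (suc n) ⁻¹ ≤ ε) → ∃ (Close approx ε)
    go (N , small) = N , λ m n hm hn → ∣∣-intro
      (≤-trans (one-sided m n) (+-monoʳ-≤ (approx n) (small n hn)))
      (≤-trans (one-sided n m) (+-monoʳ-≤ (approx m) (small m hm)))

1<√ : ∀ q → 1 ℕ.< q → fromℚ 1ℚ <ᵣ √ q
1<√ q 1<q = ι 8 ⁻¹ , ⁻¹-pos (ι-suc-pos 7) , 7 , bound
  where
  lower : ∀ m a → 8 ℕ.≤ m → q ℕ.* (m ℕ.* m) ℕ.< suc a ℕ.* suc a → 9 ℕ.* m ℕ.≤ 8 ℕ.* a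
  lower m a 8≤m hi = ℕP.≮⇒≥ (λ lt → ℕP.<-irrefl refl (absurd lt))
    where
    open ℕP.≤-Reasoning
    absurd : 8 ℕ.* a ℕ.< 9 ℕ.* m → 128 ℕ.* (m ℕ.* m) ℕ.< 128 ℕ.* (m ℕ.* m)
    absurd lt = begin-strict
      128 ℕ.* (m ℕ.* m)                    ≡⟨ ℕP.*-assoc 64 2 (m ℕ.* m) ⟩
      64 ℕ.* (2 ℕ.* (m ℕ.* m))             ≤⟨ ℕP.*-monoʳ-≤ 64 (ℕP.*-monoˡ-≤ (m ℕ.* m) 1<q) ⟩
      64 ℕ.* (q ℕ.* (m ℕ.* m))             <⟨ ℕP.*-monoʳ-< 64 hi ⟩
      64 ℕ.* (suc a ℕ.* suc a)             ≡⟨ ℕP.[m*n]*[o*p]≡[m*o]*[n*p] 8 8 (suc a) (suc a) ⟩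
      (8 ℕ.* suc a) ℕ.* (8 ℕ.* suc a)      ≤⟨ ℕP.*-mono-≤ 8[a+1]≤10m 8[a+1]≤10m ⟩
      (10 ℕ.* m) ℕ.* (10 ℕ.* m)            ≡⟨ ℕP.[m*n]*[o*p]≡[m*o]*[n*p] 10 m 10 m ⟩
      100 ℕ.* (m ℕ.* m)                    ≤⟨ ℕP.*-monoˡ-≤ (m ℕ.* m) (ℕP.m≤m+n 100 28) ⟩
      128 ℕ.* (m ℕ.* m)                    ∎
      where
      8[a+1]≤10m : 8 ℕ.* suc a ℕ.≤ 10 ℕ.* m
      8[a+1]≤10m = begin
        8 ℕ.* suc a        ≡⟨ ℕP.*-suc 8 a ⟩
        8 ℕ.+ 8 ℕ.* a      ≤⟨ ℕP.+-mono-≤ 8≤m (ℕP.<⇒≤ lt) ⟩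
        m ℕ.+ 9 ℕ.* m      ∎
  bound : ∀ n → 7 ℕ.≤ n → 1ℚ + ι 8 ⁻¹ ≤ seq (√ q) n
  bound n 7≤n = begin
    ι 9 * w                                    ≡⟨ *-identityʳ (ι 9 * w) ⟨
    (ι 9 * w) * 1ℚ                             ≡⟨ cong ((ι 9 * w) *_) (ι-⁻¹-* n) ⟨
    (ι 9 * w) * (ι (suc n) * u)                ≡⟨ solve 4 (λ p w m u → (p :* w) :* (m :* u) := (p :* m) :* (w :* u)) refl (ι 9) w (ι (suc n)) u ⟩
    (ι 9 * ι (suc n)) * (w * u)                ≡⟨ cong (_* (w * u)) (ι-* 9 (suc n)) ⟨
    ι (9 ℕ.* suc n) * (w * u)                  ≤⟨ *-monoʳ (<⇒≤ (*-pos (⁻¹-pos (ι-suc-pos 7)) (⁻¹-pos (ι-suc-pos n)))) (ι-≤ (lower (suc n) a (ℕ.s≤s 7≤n) (proj₂ (isqrt-spec (q ℕ.* (suc n ℕ.* suc n)))))) ⟩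
    ι (8 ℕ.* a) * (w * u)                      ≡⟨ cong (_* (w * u)) (ι-* 8 a) ⟩
    (ι 8 * ι a) * (w * u)                      ≡⟨ solve 4 (λ p a w u → (p :* a) :* (w :* u) := (p :* w) :* (a :* u)) refl (ι 8) (ι a) w u ⟩
    (ι 8 * w) * (ι a * u)                      ≡⟨ cong (_* (ι a * u)) (ι-⁻¹-* 7) ⟩
    1ℚ * (ι a * u)                             ≡⟨ *-identityˡ (ι a * u) ⟩
    ι a * u                                    ∎
    where
    open ≤-Reasoning
    a : ℕ
    a = isqrt (q ℕ.* (suc n ℕ.* suc n))
    u w : ℚ
    u = ι (suc n) ⁻¹
    w = ι 8 ⁻¹

1<⇒0< : ∀ x → fromℚ 1ℚ <ᵣ x → fromℚ 0ℚ <ᵣ x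
1<⇒0< x (ε , 0<ε , N , h) = ε , 0<ε , N , λ n N≤n → ≤-trans (+-monoˡ-≤ ε (<⇒≤ (positive⁻¹ 1ℚ))) (h n N≤n)

1<⇒∣inv∣<1 : ∀ x (1<x : fromℚ 1ℚ <ᵣ x) → ∣ inv x (1<⇒0< x 1<x) ∣ᵣ <ᵣ fromℚ 1ℚ
1<⇒∣inv∣<1 x (ε , 0<ε , N , h) = ε * c ⁻¹ , *-pos 0<ε (⁻¹-pos 0<c) , N , bound
  where
  c : ℚ
  c = 1ℚ + ε
  0<c : 0ℚ < c
  0<c = +-mono-< (positive⁻¹ 1ℚ) 0<ε
  bound : ∀ n → N ℕ.≤ n → ∣ seq x n ⁻¹ ∣ + ε * c ⁻¹ ≤ 1ℚ
  bound n N≤n = begin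
    ∣ seq x n ⁻¹ ∣ + ε * c ⁻¹     ≡⟨ cong (_+ ε * c ⁻¹) (0≤p⇒∣p∣≡p (<⇒≤ (⁻¹-pos (<-≤-trans 0<c (h n N≤n))))) ⟩
    seq x n ⁻¹ + ε * c ⁻¹         ≤⟨ +-monoˡ-≤ (ε * c ⁻¹) (⁻¹-anti 0<c (h n N≤n)) ⟩
    c ⁻¹ + ε * c ⁻¹               ≡⟨ cong (_+ ε * c ⁻¹) (*-identityˡ (c ⁻¹)) ⟨
    1ℚ * c ⁻¹ + ε * c ⁻¹          ≡⟨ *-distribʳ-+ (c ⁻¹) 1ℚ ε ⟨
    c * c ⁻¹                      ≡⟨ *-⁻¹ 0<c ⟩
    1ℚ                            ∎
    where open ≤-Reasoning

1/√ : (q : ℕ) → 1 ℕ.< q → ℝ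
1/√ q 1<q = inv (√ q) (1<⇒0< (√ q) (1<√ q 1<q))

∣1/√∣<1 : ∀ q (1<q : 1 ℕ.< q) → ∣ 1/√ q 1<q ∣ᵣ <ᵣ fromℚ 1ℚ
∣1/√∣<1 q 1<q = 1<⇒∣inv∣<1 (√ q) (1<√ q 1<q)

-- The terms x^(k+1) / (k+1)², indexed from k = 0.
dilog-term : ℝ → ℕ → ℝ
dilog-term x k = x ^ᵣ suc k *ᵣ fromℚ (ι (suc k ℕ.^ 2) ⁻¹)

seq-^ : ∀ x k i → seq (x ^ᵣ k) i ≡ seq x i ^ℚ k
seq-^ x zero    i = refl
seq-^ x (suc k) i = cong (seq x i *_) (seq-^ x k i)

seq-∑ : ∀ f n i → seq (∑ᵣ f n) i ≡ ∑ (λ k → seq (f k) i) n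
seq-∑ f zero    i = refl
seq-∑ f (suc n) i = cong (_+ seq (f n) i) (seq-∑ f n i)

∣^∣≤1 : ∀ y k → ∣ y ∣ ≤ 1ℚ → ∣ y ^ℚ k ∣ ≤ 1ℚ
∣^∣≤1 y zero    h = ≤-refl
∣^∣≤1 y (suc k) h = ≤-trans (≤-reflexive (∣p*q∣≡∣p∣*∣q∣ y (y ^ℚ k)))
  (*-mono (0≤∣p∣ (y ^ℚ k)) (<⇒≤ (positive⁻¹ 1ℚ)) h (∣^∣≤1 y k h))

ι-square : ∀ k → ι (suc k ℕ.^ 2) ≡ ι (suc k) * ι (suc k)
ι-square k = trans (cong (λ t → ι (suc k ℕ.* t)) (ℕP.*-identityʳ (suc k))) (ι-* (suc k) (suc k))

ι-square-pos : ∀ k → 0ℚ < ι (suc k ℕ.^ 2)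
ι-square-pos k = subst (0ℚ <_) (sym (ι-square k)) (*-pos (ι-suc-pos k) (ι-suc-pos k))

inverse-square-bound : ∀ k → ι (suc k ℕ.^ 2) ⁻¹ ≤ ι 2 * ι (suc k) ⁻¹ - ι 2 * ι (suc (suc k)) ⁻¹
inverse-square-bound k = begin
  ι (suc k ℕ.^ 2) ⁻¹                        ≡⟨ inverse-square ⟩
  u * u                                     ≤⟨ *-monoˡ (<⇒≤ (⁻¹-pos (ι-suc-pos k))) u≤2v ⟩
  u * (ι 2 * v)                             ≡⟨ solve 3 (λ p u v → u :* (p :* v) := p :* (u :* v)) refl (ι 2) u v ⟩
  ι 2 * (u * v)                             ≡⟨ cong (ι 2 *_) difference ⟨
  ι 2 * (u - v)                             ≡⟨ solve 3 (λ p u v → p :* (u :- v) := p :* u :- p :* v) refl (ι 2) u v ⟩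
  ι 2 * u - ι 2 * v                         ∎
  where
  open ≤-Reasoning
  a b u v : ℚ
  a = ι (suc k)
  b = ι (suc (suc k))
  u = a ⁻¹
  v = b ⁻¹
  au≡1 : a * u ≡ 1ℚ
  au≡1 = *-⁻¹ (ι-suc-pos k)
  bv≡1 : b * v ≡ 1ℚ
  bv≡1 = *-⁻¹ (ι-suc-pos (suc k))
  b≡1+a : b ≡ 1ℚ + a
  b≡1+a = ι-+ 1 (suc k)
  inverse-square : ι (suc k ℕ.^ 2) ⁻¹ ≡ u * u
  inverse-square = let c = ι (suc k ℕ.^ 2) ⁻¹ in begin-equality
    c                          ≡⟨ *-identityʳ c ⟨
    c * 1ℚ                     ≡⟨ cong (λ t → c * (t * t)) au≡1 ⟨
    c * ((a * u) * (a * u))    ≡⟨ solve 3 (λ c a u → c :* ((a :* u) :* (a :* u)) := ((a :* a) :* c) :* (u :* u)) refl c a u ⟩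
    ((a * a) * c) * (u * u)    ≡⟨ cong (_* (u * u)) (trans (cong (_* c) (sym (ι-square k))) (*-⁻¹ (ι-square-pos k))) ⟩
    1ℚ * (u * u)               ≡⟨ *-identityˡ (u * u) ⟩
    u * u                      ∎
  difference : u - v ≡ u * v
  difference = begin-equality
    u - v                            ≡⟨ cong₂ _-_ (*-identityʳ u) (*-identityʳ v) ⟨
    u * 1ℚ - v * 1ℚ                  ≡⟨ cong₂ (λ s t → u * s - v * t) bv≡1 au≡1 ⟨
    u * (b * v) - v * (a * u)        ≡⟨ cong (λ t → u * (t * v) - v * (a * u)) b≡1+a ⟩
    u * ((1ℚ + a) * v) - v * (a * u) ≡⟨ solve 3 (λ a u v → u :* ((con 1ℚ :+ a) :* v) :- v :* (a :* u) := u :* v) refl a u v ⟩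
    u * v                            ∎
  u≤2v : u ≤ ι 2 * v
  u≤2v = begin
    u                        ≡⟨ *-identityʳ u ⟨
    u * 1ℚ                   ≡⟨ cong (u *_) bv≡1 ⟨
    u * (b * v)              ≡⟨ solve 3 (λ u b v → u :* (b :* v) := b :* (u :* v)) refl u b v ⟩
    b * (u * v)              ≤⟨ *-monoʳ (<⇒≤ (*-pos (⁻¹-pos (ι-suc-pos k)) (⁻¹-pos (ι-suc-pos (suc k))))) (ι-≤ (ℕ.s≤s (ℕ.s≤s (ℕP.m≤m+n k (k ℕ.+ 0))))) ⟩
    ι (2 ℕ.+ (k ℕ.+ (k ℕ.+ 0))) * (u * v)  ≡⟨ cong (λ t → ι t * (u * v)) (cong suc (sym (ℕP.+-suc k (k ℕ.+ 0)))) ⟩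
    ι (2 ℕ.* suc k) * (u * v)              ≡⟨ cong (_* (u * v)) (ι-* 2 (suc k)) ⟩
    (ι 2 * a) * (u * v)      ≡⟨ solve 4 (λ p a u v → (p :* a) :* (u :* v) := (a :* u) :* (p :* v)) refl (ι 2) a u v ⟩
    (a * u) * (ι 2 * v)      ≡⟨ cong (_* (ι 2 * v)) au≡1 ⟩
    1ℚ * (ι 2 * v)           ≡⟨ *-identityˡ (ι 2 * v) ⟩
    ι 2 * v                  ∎

dilog-tail : ∀ t → (∀ k → ∣ t k ∣ ≤ ι (suc k ℕ.^ 2) ⁻¹) → ∀ n j → ∣ ∑ t (n ℕ.+ j) - ∑ t n ∣ ≤ ι 2 * ι (suc n) ⁻¹
dilog-tail t small n j = ≤-trans (telescope j)
  (≤-trans (+-monoʳ-≤ (w n) (neg-antimono-≤ (<⇒≤ (*-pos (ι-suc-pos 1) (⁻¹-pos (ι-suc-pos (n ℕ.+ j)))))))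
  (≤-reflexive (+-identityʳ (w n))))
  where
  w : ℕ → ℚ
  w k = ι 2 * ι (suc k) ⁻¹
  telescope : ∀ j → ∣ ∑ t (n ℕ.+ j) - ∑ t n ∣ ≤ w n - w (n ℕ.+ j)
  telescope zero = ≤-reflexive (trans
    (cong ∣_∣ (trans (cong (λ k → ∑ t k - ∑ t n) (ℕP.+-identityʳ n)) (+-inverseʳ (∑ t n))))
    (sym (trans (cong (λ k → w n - w k) (ℕP.+-identityʳ n)) (+-inverseʳ (w n)))))
  telescope (suc j) = begin
    ∣ ∑ t (n ℕ.+ suc j) - ∑ t n ∣                  ≡⟨ cong (λ k → ∣ ∑ t k - ∑ t n ∣) (ℕP.+-suc n j) ⟩
    ∣ (∑ t m + t m) - ∑ t n ∣                      ≡⟨ cong ∣_∣ (solve 3 (λ a b c → (a :+ b) :- c := (a :- c) :+ b) refl (∑ t m) (t m) (∑ t n)) ⟩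
    ∣ (∑ t m - ∑ t n) + t m ∣                      ≤⟨ ∣p+q∣≤∣p∣+∣q∣ (∑ t m - ∑ t n) (t m) ⟩
    ∣ ∑ t m - ∑ t n ∣ + ∣ t m ∣                    ≤⟨ +-mono-≤ (telescope j) (≤-trans (small m) (inverse-square-bound m)) ⟩
    (w n - w m) + (w m - w (suc m))                ≡⟨ solve 3 (λ a b c → (a :- b) :+ (b :- c) := a :- c) refl (w n) (w m) (w (suc m)) ⟩
    w n - w (suc m)                                ≡⟨ cong (λ k → w n - w k) (ℕP.+-suc n j) ⟨
    w n - w (n ℕ.+ suc j)                          ∎
    where
    open ≤-Reasoning
    m : ℕ
    m = n ℕ.+ j

dilog-cauchy : ∀ x → ∣ x ∣ᵣ <ᵣ fromℚ 1ℚ → Cauchyᵣ (∑ᵣ (dilog-term x))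
dilog-cauchy x (δ , 0<δ , M , h) ε 0<ε = go (scaled-archimedean (ι 2) ε (ι-suc-pos 1) 0<ε)
  where
  term : ℕ → ℕ → ℚ
  term i k = seq (dilog-term x k) i
  ∣x∣≤1 : ∀ i → M ℕ.≤ i → ∣ seq x i ∣ ≤ 1ℚ
  ∣x∣≤1 i M≤i = ≤-trans (≤-trans (≤-reflexive (sym (+-identityʳ ∣ seq x i ∣))) (+-monoʳ-≤ ∣ seq x i ∣ (<⇒≤ 0<δ))) (h i M≤i)
  small : ∀ i → M ℕ.≤ i → ∀ k → ∣ term i k ∣ ≤ ι (suc k ℕ.^ 2) ⁻¹
  small i M≤i k = begin
    ∣ seq (x ^ᵣ suc k) i * c ∣          ≡⟨ cong (λ t → ∣ t * c ∣) (seq-^ x (suc k) i) ⟩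
    ∣ seq x i ^ℚ suc k * c ∣            ≡⟨ ∣p*q∣≡∣p∣*∣q∣ (seq x i ^ℚ suc k) c ⟩
    ∣ seq x i ^ℚ suc k ∣ * ∣ c ∣        ≤⟨ *-monoʳ (0≤∣p∣ c) (∣^∣≤1 (seq x i) (suc k) (∣x∣≤1 i M≤i)) ⟩
    1ℚ * ∣ c ∣                          ≡⟨ *-identityˡ ∣ c ∣ ⟩
    ∣ c ∣                               ≡⟨ 0≤p⇒∣p∣≡p (<⇒≤ (⁻¹-pos (ι-square-pos k))) ⟩
    c                                   ∎
    where
    open ≤-Reasoning
    c : ℚ
    c = ι (suc k ℕ.^ 2) ⁻¹
  go : (∃ λ N → ∀ n → N ℕ.≤ n → ι 2 * ι (suc n) ⁻¹ ≤ ε) →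
       ∃ λ N → ∀ m n → N ℕ.≤ m → N ℕ.≤ n → ∣ ∑ᵣ (dilog-term x) m -ᵣ ∑ᵣ (dilog-term x) n ∣ᵣ ≤ᵣ fromℚ ε
  go (N , hN) = N , λ m n N≤m N≤n η 0<η → M , λ i M≤i → begin
    ∣ seq (∑ᵣ (dilog-term x) m) i - seq (∑ᵣ (dilog-term x) n) i ∣
      ≡⟨ cong₂ (λ s t → ∣ s - t ∣) (seq-∑ (dilog-term x) m i) (seq-∑ (dilog-term x) n i) ⟩
    ∣ ∑ (term i) m - ∑ (term i) n ∣
      ≤⟨ tail-close (∑ (term i)) (λ n → ι 2 * ι (suc n) ⁻¹) ε N (dilog-tail (term i) (small i M≤i)) hN m n N≤m N≤n ⟩
    ε                ≡⟨ +-identityʳ ε ⟨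
    ε + 0ℚ           ≤⟨ +-monoʳ-≤ ε (<⇒≤ 0<η) ⟩
    ε + η            ∎
    where open ≤-Reasoning

Li₂ : (x : ℝ) → ∣ x ∣ᵣ <ᵣ fromℚ 1ℚ → ℝ
Li₂ x ∣x∣<1 = lim (∑ᵣ (dilog-term x)) (dilog-cauchy x ∣x∣<1)

π²/6 : ℝ
π²/6 = π ^ᵣ 2 *ᵣ fromℚ (ι 6 ⁻¹)

IsPrimePower : ℕ → Set
IsPrimePower q = ∃₂ λ p k → Prime p × q ≡ p ℕ.^ suc k

primePower>1 : ∀ {q} → IsPrimePower q → 1 ℕ.< q
primePower>1 (p , k , p-prime , refl) = ℕP.<-≤-trans (ℕ.nonTrivial⇒n>1 p {{prime⇒nonTrivial p-prime}})
  (ℕP.m≤m*n p (p ℕ.^ k) {{ℕP.m^n≢0 p k {{prime⇒nonZero p-prime}}}})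

-- A field with exactly q elements (up to its equality _≈_).
record FiniteField (c ℓ : Level) (q : ℕ) : Set (lsuc (c ⊔ ℓ)) where
  field
    commutativeRing : CommutativeRing c ℓ
  private module R = CommutativeRing commutativeRing
  field
    1≉0         : ¬ (R.1# R.≈ R.0#)
    inverse     : ∀ x → ¬ (x R.≈ R.0#) → ∃ λ y → (x R.* y) R.≈ R.1#
    enumeration : Inverse R.setoid (setoid (Fin q))

module Polynomials {c ℓ : Level} {q : ℕ} (F : FiniteField c ℓ q) where

  private module K = CommutativeRing (FiniteField.commutativeRing F)

  -- Coefficients in order of increasing degree; trailing zeros are allowed.
  Poly : Set c
  Poly = List K.Carrier

  coeff : Poly → ℕ → K.Carrier
  coeff []      _       = K.0#
  coeff (a ∷ _) zero    = a
  coeff (_ ∷ f) (suc n) = coeff f n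

  infix 4 _≈ₚ_
  _≈ₚ_ : Poly → Poly → Set ℓ
  f ≈ₚ g = ∀ n → coeff f n K.≈ coeff g n

  _+ₚ_ : Poly → Poly → Poly
  []      +ₚ g       = g
  (a ∷ f) +ₚ []      = a ∷ f
  (a ∷ f) +ₚ (b ∷ g) = (a K.+ b) ∷ (f +ₚ g)

  _*ₚ_ : Poly → Poly → Poly
  []      *ₚ g = []
  (a ∷ f) *ₚ g = map (a K.*_) g +ₚ (K.0# ∷ (f *ₚ g))

  polynomialSemiring : RawSemiring c ℓ
  polynomialSemiring = record
    { Carrier = Poly
    ; _≈_     = _≈ₚ_
    ; _+_     = _+ₚ_
    ; _*_     = _*ₚ_
    ; 0#      = []
    ; 1#      = K.1# ∷ []
    }

  -- A monic polynomial of degree d ≥ 1 is given by its d non-leading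
  -- coefficients, in order of increasing degree.
  record NonconstantMonic : Set c where
    constructor monic
    field
      degree-1 : ℕ
      lower    : Vec K.Carrier (suc degree-1)

    degree : ℕ
    degree = suc degree-1

    poly : Poly
    poly = toList lower ++ (K.1# ∷ [])

  open NonconstantMonic public

  _≉ₘ_ : NonconstantMonic → NonconstantMonic → Set ℓ
  a ≉ₘ b = ¬ (poly a ≈ₚ poly b)

  -- Irreducible elements are nonconstant, so 𝓘 contains every monic irreducible polynomial.
  𝓘 : Pred NonconstantMonic (c ⊔ ℓ)
  𝓘 a = Irreducible polynomialSemiring (poly a)

  weight : NonconstantMonic → ℚ
  weight a = ι (q ℕ.^ degree a ℕ.* degree a) ⁻¹

  weights : List NonconstantMonic → ℚ
  weights = foldr (λ a s → weight a + s) 0ℚ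

  -- 𝓕 A ≔ s says that the (unordered, possibly infinite) sum of the positive
  -- terms weight a over a ∈ A converges to s: s is the supremum of the sums over
  -- finite subsets of A, a finite subset being a list of distinct elements.
  infix 4 𝓕_≔_
  record 𝓕_≔_ {p : Level} (A : Pred NonconstantMonic p) (s : ℝ) : Set (c ⊔ ℓ ⊔ p) where
    field
      upper-bound : ∀ as → AllPairs _≉ₘ_ as → All A as → fromℚ (weights as) ≤ᵣ s
      approached  : ∀ ε → 0ℚ < ε → ∃ λ as → AllPairs _≉ₘ_ as × All A as × s ≤ᵣ fromℚ (weights as + ε)

-- Count the monic polynomials of degree n together with their irreducible factors: deg f is the sum of deg p
-- over all prime powers pᵏ dividing f, and pᵏ has q^(n - k deg p) multiples of degree n. Comparing degrees n + 1
-- and n gives Gauss's formula qⁿ = ∑_{d ∣ n} d I_d for the number I_d of irreducibles of degree d. Hence n I_n ≤ qⁿ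
-- and, as proper divisors are at most n/2, (q-1) n I_n ≥ (q-1) qⁿ - q q^⌊n/2⌋. After division by (q-1) n² qⁿ
-- and summation this compares the sum of the weights with ∑ 1/n² and with the series of Li₂ at 1/√q. The value
-- ∑ 1/n² = π²/6 comes from squaring the Leibniz series (J. and P. Borwein).
module Submission where

open import Defs
open import Algebra.Bundles using (CommutativeRing)
open import Algebra.Definitions.RawMagma using (_∣ʳ_)
import Algebra.Definitions.RawSemiring
open import Algebra.Definitions.RawSemiring using (Irreducible; mkIrred)
import Algebra.Properties.AbelianGroup
import Algebra.Properties.CommutativeSemigroup
import Algebra.Properties.Ring
open import Data.Empty using (⊥; ⊥-elim)
open import Data.Fin using (Fin)
import Data.Fin as Fin
import Data.Fin.Properties as FinP
open import Data.List using (List; []; _∷_; map; _++_; length; allFin; upTo; cartesianProductWith)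
open import Data.List.Membership.Propositional using (_∈_; lose; find)
open import Data.List.Membership.Propositional.Properties using (∈-cartesianProductWith⁺; ∈-cartesianProductWith⁻; ∈-allFin; ∈-upTo⁺; ∈-++⁻)
import Data.List.Properties as ListP
open import Data.List.Relation.Unary.All using (All; []; _∷_)
import Data.List.Relation.Unary.All as All
open import Data.List.Relation.Unary.AllPairs using (AllPairs; []; _∷_)
open import Data.List.Relation.Unary.Any using (Any; here; there; any?)
open import Data.List.Relation.Unary.Unique.Propositional using (Unique)
import Data.List.Relation.Unary.Unique.Propositional.Properties as Unique
open import Data.Nat using (ℕ; zero; suc; _∸_)
open import Data.Nat using () renaming (_≤_ to _≤ℕ_; _<_ to _<ℕ_)
import Data.Nat as ℕ
open import Data.Nat.Induction using (<-wellFounded)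
import Data.Nat.Properties as ℕP
open import Data.Nat.Tactic.RingSolver using (solve-∀)
open import Data.Product using (∃; ∃₂; _×_; _,_; proj₁; proj₂)
open import Data.Sum using (_⊎_; inj₁; inj₂; [_,_]′)
open import Data.Vec using (toList; fromList)
import Data.Vec.Properties as VecP
open import Function using (_∘_)
open import Function.Bundles using (Inverse)
open import Induction.WellFounded using (Acc; acc)
open import Level using (Level; _⊔_)
open import Relation.Binary.Bundles using (Setoid)
open import Relation.Binary.PropositionalEquality using (_≡_; _≢_; refl; sym; trans; cong; cong₂; subst; module ≡-Reasoning)
import Relation.Binary.Reasoning.Setoid
open import Relation.Nullary using (¬_; Dec; yes; no; map′; _×-dec_)

-- Monic polynomials over a finite field

-- Coefficients form a setoid and coefficient lists may carry trailing zeros, so polynomials as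
-- given cannot be enumerated. A monic polynomial of degree n is therefore encoded as a word of
-- length n over `Fin q`: equality becomes propositional and decidable, degree becomes length, and
-- the counting sees only a commutative cancellative monoid with additive length and Euclid's lemma.
-- Units of the field appear only where arbitrary polynomials are normalised to words. In the lower
-- bound, q/(q - 1) comes from the geometric sum over the possible proper divisors, and the power
-- (1/√q)ⁿ is q^⌊n/2⌋ / qⁿ rounded up. The approximations of √q lie below it, so this estimate
-- already holds, without error term, between rationals for each approximation that is at least 1;
-- real numbers enter only at the very end. The limit does not pass through Li₂: the same error is
-- also at most 1/(q - 1) times ∑ 1/n².

Word : ℕ → Set
Word q = List (Fin q)

module PolynomialRing {c ℓ} {q : ℕ} (F : FiniteField c ℓ q) where

  open Polynomials F
  open FiniteField F using (commutativeRing; 1≉0; inverse; enumeration)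
  module K = CommutativeRing commutativeRing
  open Algebra.Properties.CommutativeSemigroup K.+-commutativeSemigroup using (interchange; x∙yz≈y∙xz)
  open Algebra.Properties.CommutativeSemigroup K.*-commutativeSemigroup using () renaming (interchange to *-interchange)

  infix 6 _⋆_
  _⋆_ : K.Carrier → Poly → Poly
  a ⋆ f = map (a K.*_) f

  shift : Poly → Poly
  shift f = K.0# ∷ f

  coeff-+ : ∀ f g n → coeff (f +ₚ g) n K.≈ coeff f n K.+ coeff g n
  coeff-+ []      g       n       = K.sym (K.+-identityˡ _)
  coeff-+ (a ∷ f) []      n       = K.sym (K.+-identityʳ _)
  coeff-+ (a ∷ f) (b ∷ g) zero    = K.refl
  coeff-+ (a ∷ f) (b ∷ g) (suc n) = coeff-+ f g n

  coeff-⋆ : ∀ a f n → coeff (a ⋆ f) n K.≈ a K.* coeff f n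
  coeff-⋆ a []      n       = K.sym (K.zeroʳ a)
  coeff-⋆ a (b ∷ f) zero    = K.refl
  coeff-⋆ a (b ∷ f) (suc n) = coeff-⋆ a f n

  -- A record, unlike _≈ₚ_ itself, lets the polynomials be inferred from their equality.
  infix 4 _≋_
  record _≋_ (f g : Poly) : Set ℓ where
    constructor coefficients
    field at : f ≈ₚ g
  open _≋_

  ≋-setoid : Setoid c ℓ
  ≋-setoid = record
    { Carrier       = Poly
    ; _≈_           = _≋_
    ; isEquivalence = record
      { refl  = coefficients λ _ → K.refl
      ; sym   = λ e → coefficients λ n → K.sym (at e n)
      ; trans = λ e e′ → coefficients λ n → K.trans (at e n) (at e′ n)
      }
    }

  module ≋ = Setoid ≋-setoid
  module ≋-Reasoning = Relation.Binary.Reasoning.Setoid ≋-setoid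
  module K-Reasoning = Relation.Binary.Reasoning.Setoid K.setoid

  via-coeff : ∀ {f g} {u v : ℕ → K.Carrier} → (∀ n → coeff f n K.≈ u n) → (∀ n → coeff g n K.≈ v n) → (∀ n → u n K.≈ v n) → f ≋ g
  via-coeff f≈u g≈v u≈v = coefficients λ n → K.trans (f≈u n) (K.trans (u≈v n) (K.sym (g≈v n)))

  +ₚ-cong : ∀ {f f′ g g′} → f ≋ f′ → g ≋ g′ → (f +ₚ g) ≋ (f′ +ₚ g′)
  +ₚ-cong {f} {f′} {g} {g′} e e′ = via-coeff (coeff-+ f g) (coeff-+ f′ g′) (λ n → K.+-cong (at e n) (at e′ n))

  +ₚ-congˡ : ∀ h {f g} → f ≋ g → (h +ₚ f) ≋ (h +ₚ g)
  +ₚ-congˡ h e = +ₚ-cong (≋.refl {h}) e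

  +ₚ-congʳ : ∀ h {f g} → f ≋ g → (f +ₚ h) ≋ (g +ₚ h)
  +ₚ-congʳ h e = +ₚ-cong e (≋.refl {h})

  +ₚ-comm : ∀ f g → (f +ₚ g) ≋ (g +ₚ f)
  +ₚ-comm f g = via-coeff (coeff-+ f g) (coeff-+ g f) (λ n → K.+-comm _ _)

  +ₚ-assoc : ∀ f g h → ((f +ₚ g) +ₚ h) ≋ (f +ₚ (g +ₚ h))
  +ₚ-assoc f g h = via-coeff
    (λ n → K.trans (coeff-+ (f +ₚ g) h n) (K.+-congʳ (coeff-+ f g n)))
    (λ n → K.trans (coeff-+ f (g +ₚ h) n) (K.+-congˡ (coeff-+ g h n)))
    (λ n → K.+-assoc _ _ _)

  +ₚ-identityʳ : ∀ f → (f +ₚ []) ≋ f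
  +ₚ-identityʳ []      = ≋.refl
  +ₚ-identityʳ (a ∷ f) = ≋.refl

  +ₚ-interchange : ∀ f g h k → ((f +ₚ g) +ₚ (h +ₚ k)) ≋ ((f +ₚ h) +ₚ (g +ₚ k))
  +ₚ-interchange f g h k = via-coeff
    (λ n → K.trans (coeff-+ (f +ₚ g) _ n) (K.+-cong (coeff-+ f g n) (coeff-+ h k n)))
    (λ n → K.trans (coeff-+ (f +ₚ h) _ n) (K.+-cong (coeff-+ f h n) (coeff-+ g k n)))
    (λ n → interchange _ _ _ _)

  ⋆-cong : ∀ {a b f g} → a K.≈ b → f ≋ g → (a ⋆ f) ≋ (b ⋆ g)
  ⋆-cong {a} {b} {f} {g} a≈b f≈g = via-coeff (coeff-⋆ a f) (coeff-⋆ b g) (λ n → K.*-cong a≈b (at f≈g n))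

  ⋆-distrib-+ₚ : ∀ a f g → (a ⋆ (f +ₚ g)) ≋ ((a ⋆ f) +ₚ (a ⋆ g))
  ⋆-distrib-+ₚ a f g = via-coeff
    (λ n → K.trans (coeff-⋆ a (f +ₚ g) n) (K.*-congˡ (coeff-+ f g n)))
    (λ n → K.trans (coeff-+ (a ⋆ f) (a ⋆ g) n) (K.+-cong (coeff-⋆ a f n) (coeff-⋆ a g n)))
    (λ n → K.distribˡ _ _ _)

  ⋆-distrib-+ : ∀ a b f → ((a K.+ b) ⋆ f) ≋ ((a ⋆ f) +ₚ (b ⋆ f))
  ⋆-distrib-+ a b f = via-coeff (coeff-⋆ (a K.+ b) f)
    (λ n → K.trans (coeff-+ (a ⋆ f) (b ⋆ f) n) (K.+-cong (coeff-⋆ a f n) (coeff-⋆ b f n)))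
    (λ n → K.distribʳ _ _ _)

  ⋆-assoc : ∀ a b f → ((a K.* b) ⋆ f) ≋ (a ⋆ (b ⋆ f))
  ⋆-assoc a b f = via-coeff (coeff-⋆ (a K.* b) f)
    (λ n → K.trans (coeff-⋆ a (b ⋆ f) n) (K.*-congˡ (coeff-⋆ b f n))) (λ n → K.*-assoc _ _ _)

  ⋆-identity : ∀ f → (K.1# ⋆ f) ≋ f
  ⋆-identity f = coefficients λ n → K.trans (coeff-⋆ K.1# f n) (K.*-identityˡ _)

  ⋆-zero : ∀ f → (K.0# ⋆ f) ≋ []
  ⋆-zero f = coefficients λ n → K.trans (coeff-⋆ K.0# f n) (K.zeroˡ _)

  ∷-cong : ∀ {a b f g} → a K.≈ b → f ≋ g → (a ∷ f) ≋ (b ∷ g)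
  ∷-cong a≈b f≈g = coefficients λ where
    zero    → a≈b
    (suc n) → at f≈g n

  shift-zero : shift [] ≋ []
  shift-zero = coefficients λ where
    zero    → K.refl
    (suc n) → K.refl

  shift-+ : ∀ f g → shift (f +ₚ g) ≋ (shift f +ₚ shift g)
  shift-+ f g = ∷-cong (K.sym (K.+-identityˡ _)) ≋.refl

  ⋆-shift : ∀ a f → (a ⋆ shift f) ≋ shift (a ⋆ f)
  ⋆-shift a f = ∷-cong (K.zeroʳ a) ≋.refl

  *ₚ-congˡ : ∀ f {g g′} → g ≋ g′ → (f *ₚ g) ≋ (f *ₚ g′)
  *ₚ-congˡ []      e = ≋.refl
  *ₚ-congˡ (a ∷ f) e = +ₚ-cong (⋆-cong K.refl e) (∷-cong K.refl (*ₚ-congˡ f e))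

  *ₚ-zeroʳ : ∀ f → (f *ₚ []) ≋ []
  *ₚ-zeroʳ []      = ≋.refl
  *ₚ-zeroʳ (a ∷ f) = ≋.trans (∷-cong K.refl (*ₚ-zeroʳ f)) shift-zero

  -- Multiplication recurses on its left factor; this is the mirror recursion on the right factor,
  -- and commutativity follows by playing one against the other.
  *ₚ-∷ : ∀ f b g → (f *ₚ (b ∷ g)) ≋ ((b ⋆ f) +ₚ shift (f *ₚ g))
  *ₚ-∷ []      b g = ≋.sym shift-zero
  *ₚ-∷ (a ∷ f) b g = ∷-cong (K.+-congʳ (K.*-comm a b)) tails
    where
    open ≋-Reasoning
    tails : ((a ⋆ g) +ₚ (f *ₚ (b ∷ g))) ≋ ((b ⋆ f) +ₚ ((a ⋆ g) +ₚ shift (f *ₚ g)))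
    tails = begin
      (a ⋆ g) +ₚ (f *ₚ (b ∷ g))               ≈⟨ +ₚ-cong (≋.refl {a ⋆ g}) (*ₚ-∷ f b g) ⟩
      (a ⋆ g) +ₚ ((b ⋆ f) +ₚ shift (f *ₚ g))  ≈⟨ +ₚ-assoc (a ⋆ g) (b ⋆ f) _ ⟨
      ((a ⋆ g) +ₚ (b ⋆ f)) +ₚ shift (f *ₚ g)  ≈⟨ +ₚ-cong (+ₚ-comm (a ⋆ g) (b ⋆ f)) (≋.refl {shift (f *ₚ g)}) ⟩
      ((b ⋆ f) +ₚ (a ⋆ g)) +ₚ shift (f *ₚ g)  ≈⟨ +ₚ-assoc (b ⋆ f) (a ⋆ g) _ ⟩
      (b ⋆ f) +ₚ ((a ⋆ g) +ₚ shift (f *ₚ g))  ∎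

  *ₚ-comm : ∀ f g → (f *ₚ g) ≋ (g *ₚ f)
  *ₚ-comm []      g = ≋.sym (*ₚ-zeroʳ g)
  *ₚ-comm (a ∷ f) g = ≋.trans (+ₚ-cong (≋.refl {a ⋆ g}) (∷-cong K.refl (*ₚ-comm f g))) (≋.sym (*ₚ-∷ g a f))

  *ₚ-cong : ∀ {f f′ g g′} → f ≋ f′ → g ≋ g′ → (f *ₚ g) ≋ (f′ *ₚ g′)
  *ₚ-cong {f} {f′} {g} {g′} e e′ = ≋.trans (*ₚ-congˡ f e′)
    (≋.trans (*ₚ-comm f g′) (≋.trans (*ₚ-congˡ g′ e) (*ₚ-comm g′ f′)))

  *ₚ-congʳ : ∀ h {f g} → f ≋ g → (f *ₚ h) ≋ (g *ₚ h)
  *ₚ-congʳ h e = *ₚ-cong e (≋.refl {h})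

  *ₚ-distribʳ : ∀ h f g → ((f +ₚ g) *ₚ h) ≋ ((f *ₚ h) +ₚ (g *ₚ h))
  *ₚ-distribʳ h []      g       = ≋.refl
  *ₚ-distribʳ h (a ∷ f) []      = ≋.sym (+ₚ-identityʳ ((a ∷ f) *ₚ h))
  *ₚ-distribʳ h (a ∷ f) (b ∷ g) = begin
    ((a K.+ b) ⋆ h) +ₚ shift ((f +ₚ g) *ₚ h)
      ≈⟨ +ₚ-cong (⋆-distrib-+ a b h) (≋.trans (∷-cong K.refl (*ₚ-distribʳ h f g)) (shift-+ (f *ₚ h) (g *ₚ h))) ⟩
    ((a ⋆ h) +ₚ (b ⋆ h)) +ₚ (shift (f *ₚ h) +ₚ shift (g *ₚ h))
      ≈⟨ +ₚ-interchange (a ⋆ h) (b ⋆ h) _ _ ⟩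
    ((a ⋆ h) +ₚ shift (f *ₚ h)) +ₚ ((b ⋆ h) +ₚ shift (g *ₚ h)) ∎
    where open ≋-Reasoning

  ⋆-*ₚ : ∀ a f g → ((a ⋆ f) *ₚ g) ≋ (a ⋆ (f *ₚ g))
  ⋆-*ₚ a []      g = ≋.refl
  ⋆-*ₚ a (b ∷ f) g = begin
    ((a K.* b) ⋆ g) +ₚ shift ((a ⋆ f) *ₚ g)
      ≈⟨ +ₚ-cong (⋆-assoc a b g) (≋.trans (∷-cong K.refl (⋆-*ₚ a f g)) (≋.sym (⋆-shift a (f *ₚ g)))) ⟩
    (a ⋆ (b ⋆ g)) +ₚ (a ⋆ shift (f *ₚ g))
      ≈⟨ ⋆-distrib-+ₚ a (b ⋆ g) (shift (f *ₚ g)) ⟨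
    a ⋆ ((b ⋆ g) +ₚ shift (f *ₚ g)) ∎
    where open ≋-Reasoning

  shift-*ₚ : ∀ f g → (shift f *ₚ g) ≋ shift (f *ₚ g)
  shift-*ₚ f g = +ₚ-cong (⋆-zero g) (≋.refl {shift (f *ₚ g)})

  *ₚ-assoc : ∀ f g h → ((f *ₚ g) *ₚ h) ≋ (f *ₚ (g *ₚ h))
  *ₚ-assoc []      g h = ≋.refl
  *ₚ-assoc (a ∷ f) g h = begin
    ((a ⋆ g) +ₚ shift (f *ₚ g)) *ₚ h
      ≈⟨ *ₚ-distribʳ h (a ⋆ g) (shift (f *ₚ g)) ⟩
    ((a ⋆ g) *ₚ h) +ₚ (shift (f *ₚ g) *ₚ h)
      ≈⟨ +ₚ-cong (⋆-*ₚ a g h) (≋.trans (shift-*ₚ (f *ₚ g) h) (∷-cong K.refl (*ₚ-assoc f g h))) ⟩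
    (a ⋆ (g *ₚ h)) +ₚ shift (f *ₚ (g *ₚ h)) ∎
    where open ≋-Reasoning

  const : K.Carrier → Poly
  const a = a ∷ []

  const-*ₚ : ∀ a f → (const a *ₚ f) ≋ (a ⋆ f)
  const-*ₚ a f = ≋.trans (+ₚ-cong (≋.refl {a ⋆ f}) shift-zero) (+ₚ-identityʳ (a ⋆ f))

  *ₚ-identityˡ : ∀ f → (const K.1# *ₚ f) ≋ f
  *ₚ-identityˡ f = ≋.trans (const-*ₚ K.1# f) (⋆-identity f)

  -ₚ_ : Poly → Poly
  -ₚ f = (K.- K.1#) ⋆ f

  -ₚ-inverseˡ : ∀ f → ((-ₚ f) +ₚ f) ≋ []
  -ₚ-inverseˡ f = begin
    ((K.- K.1#) ⋆ f) +ₚ f           ≈⟨ +ₚ-cong (≋.refl { -ₚ f}) (⋆-identity f) ⟨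
    ((K.- K.1#) ⋆ f) +ₚ (K.1# ⋆ f)  ≈⟨ ⋆-distrib-+ (K.- K.1#) K.1# f ⟨
    ((K.- K.1#) K.+ K.1#) ⋆ f       ≈⟨ ⋆-cong (K.-‿inverseˡ K.1#) (≋.refl {f}) ⟩
    K.0# ⋆ f                        ≈⟨ ⋆-zero f ⟩
    []                              ∎
    where open ≋-Reasoning

  polynomialRing : CommutativeRing c ℓ
  polynomialRing = record
    { Carrier = Poly ; _≈_ = _≋_ ; _+_ = _+ₚ_ ; _*_ = _*ₚ_ ; -_ = -ₚ_ ; 0# = [] ; 1# = const K.1#
    ; isCommutativeRing = record
      { isRing = record
        { +-isAbelianGroup = record
          { isGroup = record
            { isMonoid = record
              { isSemigroup = record
                { isMagma = record { isEquivalence = ≋.isEquivalence ; ∙-cong = +ₚ-cong }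
                ; assoc = +ₚ-assoc }
              ; identity = (λ f → ≋.refl) , +ₚ-identityʳ }
            ; inverse = -ₚ-inverseˡ , λ f → ≋.trans (+ₚ-comm f (-ₚ f)) (-ₚ-inverseˡ f)
            ; ⁻¹-cong = ⋆-cong K.refl }
          ; comm = +ₚ-comm }
        ; *-cong = *ₚ-cong
        ; *-assoc = *ₚ-assoc
        ; *-identity = *ₚ-identityˡ , λ f → ≋.trans (*ₚ-comm f (const K.1#)) (*ₚ-identityˡ f)
        ; distrib = (λ h f g → ≋.trans (*ₚ-comm h (f +ₚ g)) (≋.trans (*ₚ-distribʳ h f g) (+ₚ-cong (*ₚ-comm f h) (*ₚ-comm g h))))
                  , *ₚ-distribʳ }
      ; *-comm = *ₚ-comm } }

  -- Words as canonical monic polynomials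

  open Inverse enumeration using (to; from; to-cong; strictlyInverseˡ; strictlyInverseʳ)

  infix 4 _≟ₖ_
  _≟ₖ_ : ∀ x y → Dec (x K.≈ y)
  x ≟ₖ y = map′ (λ e → K.trans (K.sym (strictlyInverseʳ x)) (K.trans (K.reflexive (cong from e)) (strictlyInverseʳ y)))
    to-cong (to x FinP.≟ to y)

  unit-nonzero : ∀ {u v} → u K.* v K.≈ K.1# → ¬ (u K.≈ K.0#)
  unit-nonzero uv u≈0 = 1≉0 (K.trans (K.sym uv) (K.trans (K.*-congʳ u≈0) (K.zeroˡ _)))

  tail-≋ : ∀ {x y f g} → (x ∷ f) ≋ (y ∷ g) → f ≋ g
  tail-≋ e = coefficients λ n → at e (suc n)

  tail-≋[] : ∀ {x f} → (x ∷ f) ≋ [] → f ≋ []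
  tail-≋[] e = coefficients λ n → at e (suc n)

  monic-of : Poly → Poly
  monic-of l = l ++ const K.1#

  -- A word of length n lists the lower coefficients of a monic polynomial of degree n, constant term first.
  mon : Word q → Poly
  mon a = monic-of (map from a)

  monic-of-from-to : ∀ l → monic-of (map from (map to l)) ≋ monic-of l
  monic-of-from-to []      = ≋.refl
  monic-of-from-to (x ∷ l) = ∷-cong (strictlyInverseʳ x) (monic-of-from-to l)

  ⋆-mon-nonzero : ∀ {u} a → ¬ (u K.≈ K.0#) → ¬ ((u ⋆ mon a) ≋ [])
  ⋆-mon-nonzero []      u≉0 e = u≉0 (K.trans (K.sym (K.*-identityʳ _)) (at e 0))
  ⋆-mon-nonzero (x ∷ a) u≉0 e = ⋆-mon-nonzero a u≉0 (tail-≋[] e)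

  ⋆-cancel : ∀ {u v x y} → ¬ (u K.≈ K.0#) → u K.≈ v → u K.* x K.≈ v K.* y → x K.≈ y
  ⋆-cancel {u} {v} {x} {y} u≉0 u≈v e with inverse u u≉0
  ... | w , uw = begin
    x                ≈⟨ K.*-identityˡ x ⟨
    K.1# K.* x       ≈⟨ K.*-congʳ (K.trans (K.*-comm w u) uw) ⟨
    (w K.* u) K.* x  ≈⟨ K.*-assoc w u x ⟩
    w K.* (u K.* x)  ≈⟨ K.*-congˡ (K.trans e (K.*-congʳ (K.sym u≈v))) ⟩
    w K.* (u K.* y)  ≈⟨ K.*-assoc w u y ⟨
    (w K.* u) K.* y  ≈⟨ K.*-congʳ (K.trans (K.*-comm w u) uw) ⟩
    K.1# K.* y       ≈⟨ K.*-identityˡ y ⟩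
    y                ∎
    where open K-Reasoning

  from-injective : ∀ {x y} → from x K.≈ from y → x ≡ y
  from-injective {x} {y} e = trans (sym (strictlyInverseˡ x)) (trans (to-cong e) (strictlyInverseˡ y))

  -- At the end of the shorter list its leading coefficient faces either the other leading
  -- coefficient, which gives u ≈ v, or a remainder that would have to vanish. With the units equal,
  -- the lower coefficients cancel on the way back.
  ⋆-mon-injective : ∀ {u v} a b → ¬ (u K.≈ K.0#) → ¬ (v K.≈ K.0#) → (u ⋆ mon a) ≋ (v ⋆ mon b) → a ≡ b × u K.≈ v
  ⋆-mon-injective []      []      u≉0 v≉0 e = refl , K.trans (K.sym (K.*-identityʳ _)) (K.trans (at e 0) (K.*-identityʳ _))
  ⋆-mon-injective []      (y ∷ b) u≉0 v≉0 e = ⊥-elim (⋆-mon-nonzero b v≉0 (≋.sym (tail-≋ e)))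
  ⋆-mon-injective (x ∷ a) []      u≉0 v≉0 e = ⊥-elim (⋆-mon-nonzero a u≉0 (tail-≋ e))
  ⋆-mon-injective (x ∷ a) (y ∷ b) u≉0 v≉0 e with ⋆-mon-injective a b u≉0 v≉0 (tail-≋ e)
  ... | a≡b , u≈v = cong₂ _∷_ (from-injective (⋆-cancel u≉0 u≈v (at e 0))) a≡b , u≈v

  mon-injective : ∀ {a b} → mon a ≋ mon b → a ≡ b
  mon-injective {a} {b} e = proj₁ (⋆-mon-injective a b 1≉0 1≉0 (⋆-cong K.refl e))

  +ₚ-++ : ∀ f g h → length f ≤ℕ length g → f +ₚ (g ++ h) ≡ (f +ₚ g) ++ h
  +ₚ-++ []      g       h le         = refl
  +ₚ-++ (x ∷ f) (y ∷ g) h (ℕ.s≤s le) = cong ((x K.+ y) ∷_) (+ₚ-++ f g h le)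

  length-+ₚ : ∀ f g → length f ≤ℕ length g → length (f +ₚ g) ≡ length g
  length-+ₚ []      g       le         = refl
  length-+ₚ (x ∷ f) (y ∷ g) (ℕ.s≤s le) = cong suc (length-+ₚ f g le)

  infixl 7 _⊗_
  -- The lower coefficients of a product of two monic polynomials, its leading 1 kept apart: in x·M
  -- + X·(L·M) the summand x·M has too low a degree to reach that 1.
  _⊗_ : Poly → Poly → Poly
  []      ⊗ m = m
  (x ∷ l) ⊗ m = (x ⋆ monic-of m) +ₚ shift (l ⊗ m)

  -- Mutual with `⊗-fits`: a sum has the length of its second summand only when the first is no
  -- longer, and to see that it is no longer one must know the length of the shorter product.
  length-⊗ : ∀ l m → length (l ⊗ m) ≡ length l ℕ.+ length m
  ⊗-fits : ∀ x l m → length (x ⋆ monic-of m) ≤ℕ length (shift (l ⊗ m))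

  length-⊗ []      m = refl
  length-⊗ (x ∷ l) m = trans (length-+ₚ (x ⋆ monic-of m) (shift (l ⊗ m)) (⊗-fits x l m)) (cong suc (length-⊗ l m))

  ⊗-fits x l m = begin
    length (x ⋆ monic-of m)      ≡⟨ trans (ListP.length-map _ (monic-of m)) (ListP.length-++ m) ⟩
    length m ℕ.+ 1               ≡⟨ ℕP.+-comm (length m) 1 ⟩
    suc (length m)               ≤⟨ ℕ.s≤s (ℕP.m≤n+m (length m) (length l)) ⟩
    suc (length l ℕ.+ length m)  ≡⟨ cong suc (length-⊗ l m) ⟨
    suc (length (l ⊗ m))         ∎
    where open ℕP.≤-Reasoning

  monic-of-⊗ : ∀ l m → (monic-of l *ₚ monic-of m) ≋ monic-of (l ⊗ m)
  monic-of-⊗ []      m = *ₚ-identityˡ (monic-of m)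
  monic-of-⊗ (x ∷ l) m = ≋.trans (+ₚ-cong ≋.refl (∷-cong K.refl (monic-of-⊗ l m)))
    (≋.reflexive (+ₚ-++ (x ⋆ monic-of m) (shift (l ⊗ m)) (const K.1#) (⊗-fits x l m)))

  infixl 7 _·_
  opaque
    -- Opaque, so that products never unfold; all that follows rests on the length and the
    -- polynomial of a product.
    _·_ : Word q → Word q → Word q
    a · b = map to (map from a ⊗ map from b)

    length-· : ∀ a b → length (a · b) ≡ length a ℕ.+ length b
    length-· a b = trans (ListP.length-map to (map from a ⊗ map from b)) (trans (length-⊗ (map from a) (map from b))
      (cong₂ ℕ._+_ (ListP.length-map from a) (ListP.length-map from b)))

    mon-· : ∀ a b → mon (a · b) ≋ (mon a *ₚ mon b)
    mon-· a b = ≋.trans (monic-of-from-to (map from a ⊗ map from b)) (≋.sym (monic-of-⊗ (map from a) (map from b)))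

  -- `mon-injective` turns ring laws that hold up to `_≋_` into propositional equalities of words.
  ·-comm : ∀ a b → a · b ≡ b · a
  ·-comm a b = mon-injective (≋.trans (mon-· a b) (≋.trans (*ₚ-comm (mon a) (mon b)) (≋.sym (mon-· b a))))

  ·-assoc : ∀ a b c → (a · b) · c ≡ a · (b · c)
  ·-assoc a b c = mon-injective (begin
    mon ((a · b) · c)          ≈⟨ mon-· (a · b) c ⟩
    mon (a · b) *ₚ mon c       ≈⟨ *ₚ-cong (mon-· a b) ≋.refl ⟩
    (mon a *ₚ mon b) *ₚ mon c  ≈⟨ *ₚ-assoc (mon a) (mon b) (mon c) ⟩
    mon a *ₚ (mon b *ₚ mon c)  ≈⟨ *ₚ-congˡ (mon a) (mon-· b c) ⟨
    mon a *ₚ mon (b · c)       ≈⟨ mon-· a (b · c) ⟨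
    mon (a · (b · c))          ∎)
    where open ≋-Reasoning

  ·-identityˡ : ∀ a → [] · a ≡ a
  ·-identityˡ a = mon-injective (≋.trans (mon-· [] a) (*ₚ-identityˡ (mon a)))

  -- Normal forms and division with remainder

  *ₚ-⋆ : ∀ f a g → (f *ₚ (a ⋆ g)) ≋ (a ⋆ (f *ₚ g))
  *ₚ-⋆ f a g = ≋.trans (*ₚ-comm f (a ⋆ g)) (≋.trans (⋆-*ₚ a g f) (⋆-cong K.refl (*ₚ-comm g f)))

  -- Over a field every nonzero polynomial is a unit times a monic one. The field `shorter` bounds
  -- the degree and makes the Euclidean descent terminate.
  record Normal (f : Poly) : Set (c ⊔ ℓ) where
    field
      {unit unit⁻¹} : K.Carrier
      word          : Word q
      invertible    : unit K.* unit⁻¹ K.≈ K.1#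
      shorter       : length word <ℕ length f
      normal        : f ≋ (unit ⋆ mon word)

  -- The list is evaluated from its far end: trailing zeros disappear, the first nonzero coefficient
  -- met becomes the unit, and the lower ones are divided by it.
  normalise : ∀ f → f ≋ [] ⊎ Normal f
  normalise [] = inj₁ ≋.refl
  normalise (x ∷ f) with normalise f | x ≟ₖ K.0#
  ... | inj₁ f≋0 | yes x≈0 = inj₁ (≋.trans (∷-cong x≈0 f≋0) shift-zero)
  ... | inj₁ f≋0 | no  x≉0 = inj₂ (record
    { word = [] ; invertible = proj₂ (inverse x x≉0) ; shorter = ℕ.s≤s ℕ.z≤n
    ; normal = ∷-cong (K.sym (K.*-identityʳ x)) f≋0 })
  ... | inj₂ N | _ = inj₂ (record
    { word = to (unit⁻¹ K.* x) ∷ word ; invertible = invertible ; shorter = ℕ.s≤s shorter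
    ; normal = ∷-cong lowest normal })
    where
    open Normal N
    open K-Reasoning
    lowest : x K.≈ unit K.* from (to (unit⁻¹ K.* x))
    lowest = begin
      x                                  ≈⟨ K.*-identityˡ x ⟨
      K.1# K.* x                         ≈⟨ K.*-congʳ invertible ⟨
      (unit K.* unit⁻¹) K.* x            ≈⟨ K.*-assoc unit unit⁻¹ x ⟩
      unit K.* (unit⁻¹ K.* x)            ≈⟨ K.*-congˡ (strictlyInverseʳ (unit⁻¹ K.* x)) ⟨
      unit K.* from (to (unit⁻¹ K.* x))  ∎

  reduce : ∀ l g → length g ≤ℕ suc (length l) → ∃₂ λ a s → length s ≤ℕ length l × g ≋ ((a ⋆ monic-of l) +ₚ s)
  reduce l [] le = K.0# , [] , ℕ.z≤n , ≋.sym (≋.trans (+ₚ-identityʳ _) (⋆-zero (monic-of l)))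
  reduce [] (y ∷ []) le = y , [] , ℕ.z≤n , ∷-cong (K.sym (K.*-identityʳ y)) ≋.refl
  reduce [] (y ∷ _ ∷ _) (ℕ.s≤s ())
  reduce (x ∷ l) (y ∷ g) (ℕ.s≤s le) with reduce l g le
  ... | a , s , le′ , e = a , (y K.- a K.* x) ∷ s , ℕ.s≤s le′ , ∷-cong lowest e
    where
    open K-Reasoning
    lowest : y K.≈ a K.* x K.+ (y K.- a K.* x)
    lowest = begin
      y                            ≈⟨ K.+-identityʳ y ⟨
      y K.+ K.0#                   ≈⟨ K.+-congˡ (K.-‿inverseʳ (a K.* x)) ⟨
      y K.+ (a K.* x K.- a K.* x)  ≈⟨ x∙yz≈y∙xz y (a K.* x) _ ⟩
      a K.* x K.+ (y K.- a K.* x)  ∎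

  -- Long division in Horner form: if f = L·k + s, then x + X·f = L·(X·k) + (x + X·s), and x + X·s
  -- is short enough for a single call of `reduce`, whose multiplier becomes the new lowest
  -- coefficient of the quotient.
  divide : ∀ l f → ∃₂ λ k s → length s ≤ℕ length l × f ≋ ((monic-of l *ₚ k) +ₚ s)
  divide l [] = [] , [] , ℕ.z≤n , ≋.sym (≋.trans (+ₚ-identityʳ _) (*ₚ-zeroʳ (monic-of l)))
  divide l (x ∷ f) with divide l f
  ... | k , s , le , e with reduce l (x ∷ s) (ℕ.s≤s le)
  ... | a , s′ , le′ , e′ = a ∷ k , s′ , le′ , (begin
    x ∷ f                                                ≈⟨ ∷-cong (K.sym (K.+-identityˡ x)) e ⟩
    shift (monic-of l *ₚ k) +ₚ (x ∷ s)                   ≈⟨ +ₚ-congˡ (shift (monic-of l *ₚ k)) e′ ⟩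
    shift (monic-of l *ₚ k) +ₚ ((a ⋆ monic-of l) +ₚ s′)  ≈⟨ +ₚ-assoc (shift (monic-of l *ₚ k)) (a ⋆ monic-of l) s′ ⟨
    (shift (monic-of l *ₚ k) +ₚ (a ⋆ monic-of l)) +ₚ s′  ≈⟨ +ₚ-cong (+ₚ-comm (shift (monic-of l *ₚ k)) (a ⋆ monic-of l)) (≋.refl {s′}) ⟩
    ((a ⋆ monic-of l) +ₚ shift (monic-of l *ₚ k)) +ₚ s′  ≈⟨ +ₚ-congʳ s′ (*ₚ-∷ (monic-of l) a k) ⟨
    (monic-of l *ₚ (a ∷ k)) +ₚ s′                        ∎)
    where open ≋-Reasoning

  unit-word : ∀ {u v} a b → u K.* v K.≈ K.1# → mon a ≋ (u ⋆ mon b) → a ≡ b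
  unit-word a b uv e = proj₁ (⋆-mon-injective a b 1≉0 (unit-nonzero uv) (≋.trans (⋆-identity (mon a)) e))

  mon-nonzero : ∀ a → ¬ (mon a ≋ [])
  mon-nonzero a e = ⋆-mon-nonzero a 1≉0 (≋.trans (⋆-identity (mon a)) e)

  -- A quotient of monic polynomials is monic: the unit in the normal form of `k` would also be a
  -- unit in front of `a · word`, and `unit-word` disposes of it.
  word-quotient : ∀ a b k → mon b ≋ (mon a *ₚ k) → ∃ λ w → b ≡ a · w
  word-quotient a b k e with normalise k
  ... | inj₁ k≋0 = ⊥-elim (mon-nonzero b (≋.trans e (≋.trans (*ₚ-congˡ (mon a) k≋0) (*ₚ-zeroʳ (mon a)))))
  ... | inj₂ N = word , unit-word b (a · word) invertible (begin
    mon b                       ≈⟨ e ⟩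
    mon a *ₚ k                  ≈⟨ *ₚ-congˡ (mon a) normal ⟩
    mon a *ₚ (unit ⋆ mon word)  ≈⟨ *ₚ-⋆ (mon a) unit (mon word) ⟩
    unit ⋆ (mon a *ₚ mon word)  ≈⟨ ⋆-cong K.refl (mon-· a word) ⟨
    unit ⋆ mon (a · word)       ∎)
    where
    open Normal N
    open ≋-Reasoning

  module P = CommutativeRing polynomialRing
  open Algebra.Properties.Ring P.ring using (x[y-z]≈xy-xz)
  open Algebra.Properties.AbelianGroup P.+-abelianGroup using (xyx⁻¹≈y; x∙y⁻¹≈ε⇒x≈y; x≈y⇒x∙y⁻¹≈ε)

  -- There are no zero divisors: a nonzero `k` is a unit times a word, so `mon a *ₚ k` is the same
  -- unit times the word `a · word` and cannot vanish. This is applied to the difference of `mon b`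
  -- and `mon c`.
  ·-cancelˡ : ∀ a b c → a · b ≡ a · c → b ≡ c
  ·-cancelˡ a b c e = mon-injective (x∙y⁻¹≈ε⇒x≈y (mon b) (mon c) (zero-factor (mon b P.- mon c) product))
    where
    open ≋-Reasoning
    product : (mon a *ₚ (mon b P.- mon c)) ≋ []
    product = ≋.trans (x[y-z]≈xy-xz (mon a) (mon b) (mon c)) (x≈y⇒x∙y⁻¹≈ε (begin
      mon a *ₚ mon b  ≈⟨ mon-· a b ⟨
      mon (a · b)     ≡⟨ cong mon e ⟩
      mon (a · c)     ≈⟨ mon-· a c ⟩
      mon a *ₚ mon c  ∎))
    zero-factor : ∀ k → (mon a *ₚ k) ≋ [] → k ≋ []
    zero-factor k e with normalise k
    ... | inj₁ k≋0 = k≋0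
    ... | inj₂ N = ⊥-elim (⋆-mon-nonzero (a · word) (unit-nonzero invertible) (begin
      unit ⋆ mon (a · word)       ≈⟨ ⋆-cong K.refl (mon-· a word) ⟩
      unit ⋆ (mon a *ₚ mon word)  ≈⟨ *ₚ-⋆ (mon a) unit (mon word) ⟨
      mon a *ₚ (unit ⋆ mon word)  ≈⟨ *ₚ-congˡ (mon a) normal ⟨
      mon a *ₚ k                  ≈⟨ e ⟩
      []                          ∎))
      where open Normal N

  -- Irreducible words and Euclid's lemma

  IrreducibleWord : Word q → Set
  IrreducibleWord p = 0 <ℕ length p × (∀ a b → p ≡ a · b → a ≡ [] ⊎ b ≡ [])

  remainder-multiple : ∀ {f k m s} x → f ≋ (x *ₚ k) → f ≋ ((x *ₚ m) +ₚ s) → s ≋ (x *ₚ (k P.- m))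
  remainder-multiple {f} {k} {m} {s} x e e′ = begin
    s                             ≈⟨ xyx⁻¹≈y (x *ₚ m) s ⟨
    ((x *ₚ m) +ₚ s) P.- (x *ₚ m)  ≈⟨ +ₚ-cong (≋.trans (≋.sym e′) e) ≋.refl ⟩
    (x *ₚ k) P.- (x *ₚ m)         ≈⟨ x[y-z]≈xy-xz x k m ⟨
    x *ₚ (k P.- m)                ∎
    where open ≋-Reasoning

  normal-multiple : ∀ {s} (N : Normal s) g x z → (s *ₚ g) ≋ (x *ₚ z) → (mon (Normal.word N) *ₚ g) ≋ (x *ₚ (Normal.unit⁻¹ N ⋆ z))
  normal-multiple {s} N g x z e = begin
    mon word *ₚ g                        ≈⟨ *ₚ-congʳ g (⋆-identity (mon word)) ⟨
    (K.1# ⋆ mon word) *ₚ g               ≈⟨ *ₚ-congʳ g (⋆-cong (K.trans (K.*-comm unit⁻¹ unit) invertible) (≋.refl {mon word})) ⟨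
    ((unit⁻¹ K.* unit) ⋆ mon word) *ₚ g  ≈⟨ *ₚ-congʳ g (⋆-assoc unit⁻¹ unit (mon word)) ⟩
    (unit⁻¹ ⋆ (unit ⋆ mon word)) *ₚ g    ≈⟨ *ₚ-congʳ g (⋆-cong K.refl normal) ⟨
    (unit⁻¹ ⋆ s) *ₚ g                    ≈⟨ ⋆-*ₚ unit⁻¹ s g ⟩
    unit⁻¹ ⋆ (s *ₚ g)                    ≈⟨ ⋆-cong K.refl e ⟩
    unit⁻¹ ⋆ (x *ₚ z)                    ≈⟨ *ₚ-⋆ x unit⁻¹ z ⟨
    x *ₚ (unit⁻¹ ⋆ z)                    ∎
    where
    open Normal N
    open ≋-Reasoning

  -- Replacing r by p mod r keeps p ∣ r g and lowers the degree, until r divides p.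
  euclid-descent : ∀ {p} → IrreducibleWord p → ∀ r g k → Acc _<ℕ_ (length r) → length r <ℕ length p →
    (mon r *ₚ g) ≋ (mon p *ₚ k) → ∃ λ k′ → g ≋ (mon p *ₚ k′)
  euclid-descent {p} (0<p , split) r g k (acc rec) r<p e with divide (map from r) (mon p)
  ... | k₁ , s , s≤r , e₁ with normalise s
  ... | inj₁ s≋0 with word-quotient r p k₁ (≋.trans e₁ (≋.trans (+ₚ-congˡ (mon r *ₚ k₁) s≋0) (+ₚ-identityʳ _)))
  ... | w , p≡rw with split r w p≡rw
  -- Here r is 1, and the hypothesis p ∣ r·g already reads p ∣ g; in the other case r would be p
  -- itself, against its length.
  ... | inj₁ refl = k , ≋.trans (≋.sym (*ₚ-identityˡ g)) e
  ... | inj₂ refl = ⊥-elim (ℕP.<-irrefl (sym (trans (cong length p≡rw) (trans (length-· r []) (ℕP.+-identityʳ _)))) r<p)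
  euclid-descent {p} irr r g k (acc rec) r<p e | k₁ , s , s≤r , e₁ | inj₂ N =
    -- From p = r·k₁ + s and r·g = p·k follows s·g = p·(g - k₁·k); dividing by the unit of s
    -- replaces s by a word.
    euclid-descent irr word g (unit⁻¹ ⋆ (g P.- (k₁ *ₚ k))) (rec word<r) (ℕP.<-trans word<r r<p)
      (normal-multiple N g (mon p) (g P.- (k₁ *ₚ k)) (remainder-multiple (mon p) (≋.refl {mon p *ₚ g}) (begin
        mon p *ₚ g                        ≈⟨ *ₚ-congʳ g e₁ ⟩
        ((mon r *ₚ k₁) +ₚ s) *ₚ g         ≈⟨ *ₚ-distribʳ g (mon r *ₚ k₁) s ⟩
        ((mon r *ₚ k₁) *ₚ g) +ₚ (s *ₚ g)  ≈⟨ +ₚ-congʳ (s *ₚ g) (*ₚ-congʳ g (*ₚ-comm (mon r) k₁)) ⟩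
        ((k₁ *ₚ mon r) *ₚ g) +ₚ (s *ₚ g)  ≈⟨ +ₚ-congʳ (s *ₚ g) (*ₚ-assoc k₁ (mon r) g) ⟩
        (k₁ *ₚ (mon r *ₚ g)) +ₚ (s *ₚ g)  ≈⟨ +ₚ-congʳ (s *ₚ g) (*ₚ-congˡ k₁ e) ⟩
        (k₁ *ₚ (mon p *ₚ k)) +ₚ (s *ₚ g)  ≈⟨ +ₚ-congʳ (s *ₚ g) (*ₚ-assoc k₁ (mon p) k) ⟨
        ((k₁ *ₚ mon p) *ₚ k) +ₚ (s *ₚ g)  ≈⟨ +ₚ-congʳ (s *ₚ g) (*ₚ-congʳ k (*ₚ-comm k₁ (mon p))) ⟩
        ((mon p *ₚ k₁) *ₚ k) +ₚ (s *ₚ g)  ≈⟨ +ₚ-congʳ (s *ₚ g) (*ₚ-assoc (mon p) k₁ k) ⟩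
        (mon p *ₚ (k₁ *ₚ k)) +ₚ (s *ₚ g)  ∎)))
    where
    open Normal N
    open ≋-Reasoning
    word<r : length word <ℕ length r
    word<r = ℕP.<-≤-trans shorter (ℕP.≤-trans s≤r (ℕP.≤-reflexive (ListP.length-map from r)))

  -- `a` is first reduced modulo `p`. Remainder zero is the left alternative; otherwise the
  -- remainder s satisfies s·b = p·(w - k₁·b) and is shorter than `p`, which is where the descent
  -- may start.
  euclid : ∀ {p} → IrreducibleWord p → ∀ a b w → a · b ≡ p · w → (∃ λ k → a ≡ p · k) ⊎ (∃ λ k → b ≡ p · k)
  euclid {p} irr a b w e with divide (map from p) (mon a)
  ... | k₁ , s , s≤p , e₁ with normalise s
  ... | inj₁ s≋0 = inj₁ (word-quotient p a k₁ (≋.trans e₁ (≋.trans (+ₚ-congˡ (mon p *ₚ k₁) s≋0) (+ₚ-identityʳ _))))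
  ... | inj₂ N with euclid-descent irr word (mon b) (unit⁻¹ ⋆ (mon w P.- (k₁ *ₚ mon b))) (<-wellFounded _)
      (ℕP.<-≤-trans shorter (ℕP.≤-trans s≤p (ℕP.≤-reflexive (ListP.length-map from p))))
      (normal-multiple N (mon b) (mon p) (mon w P.- (k₁ *ₚ mon b)) (remainder-multiple (mon p) products (begin
        mon a *ₚ mon b                            ≈⟨ *ₚ-congʳ (mon b) e₁ ⟩
        ((mon p *ₚ k₁) +ₚ s) *ₚ mon b             ≈⟨ *ₚ-distribʳ (mon b) (mon p *ₚ k₁) s ⟩
        ((mon p *ₚ k₁) *ₚ mon b) +ₚ (s *ₚ mon b)  ≈⟨ +ₚ-congʳ (s *ₚ mon b) (*ₚ-assoc (mon p) k₁ (mon b)) ⟩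
        (mon p *ₚ (k₁ *ₚ mon b)) +ₚ (s *ₚ mon b)  ∎)))
    where
    open Normal N
    open ≋-Reasoning
    products : (mon a *ₚ mon b) ≋ (mon p *ₚ mon w)
    products = ≋.trans (≋.sym (mon-· a b)) (≋.trans (≋.reflexive (cong mon e)) (mon-· p w))
  ... | k , b≋pk = inj₂ (word-quotient p b k b≋pk)

  mon-unit : ∀ a k → (k *ₚ mon a) ≋ const K.1# → a ≡ []
  mon-unit a k e with word-quotient a [] k (≋.trans (≋.sym e) (*ₚ-comm k (mon a)))
  mon-unit []      k e | w , e′ = refl
  mon-unit (x ∷ a) k e | w , e′ = ⊥-elim (ℕP.0≢1+n (trans (cong length e′) (length-· (x ∷ a) w)))

  irreducible⇒word : ∀ {f a} → f ≋ mon a → 0 <ℕ length a → Irreducible polynomialSemiring f → IrreducibleWord a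
  irreducible⇒word {f} {a} f≋a 0<a (mkIrred _ split) = 0<a , factors
    where
    factors : ∀ b d → a ≡ b · d → b ≡ [] ⊎ d ≡ []
    factors b d e with split {mon b} {mon d} (at (≋.trans f≋a (≋.trans (≋.reflexive (cong mon e)) (mon-· b d))))
    ... | inj₁ b∣1 = inj₁ (mon-unit b (_∣ʳ_.quotient b∣1) (coefficients (_∣ʳ_.equality b∣1)))
    ... | inj₂ d∣1 = inj₂ (mon-unit d (_∣ʳ_.quotient d∣1) (coefficients (_∣ʳ_.equality d∣1)))

  -- `Irreducible` tests factorisations into arbitrary polynomials. Both factors are normalised,
  -- their units collected into one, and the resulting words multiply to `a`; a factor whose word is
  -- empty is a constant with inverse `unit⁻¹`.
  word⇒irreducible : ∀ {f a} → f ≋ mon a → IrreducibleWord a → Irreducible polynomialSemiring f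
  word⇒irreducible {f} {a} f≋a (0<a , factors) = mkIrred nonunit split
    where
    open ≋-Reasoning
    open Algebra.Definitions.RawSemiring polynomialSemiring using (_∣_)
    nonunit : ∀ d → ⊥
    nonunit d = ℕP.<-irrefl (sym (cong length (mon-unit a (_∣ʳ_.quotient d)
      (≋.trans (*ₚ-congˡ (_∣ʳ_.quotient d) (≋.sym f≋a)) (coefficients (_∣ʳ_.equality d)))))) 0<a
    constant-unit : ∀ {x} (N : Normal x) → Normal.word N ≡ [] → (const (Normal.unit⁻¹ N) *ₚ x) ≈ₚ const K.1#
    constant-unit {x} N e = at (begin
      const unit⁻¹ *ₚ x             ≈⟨ const-*ₚ unit⁻¹ x ⟩
      unit⁻¹ ⋆ x                    ≈⟨ ⋆-cong K.refl normal ⟩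
      unit⁻¹ ⋆ (unit ⋆ mon word)    ≈⟨ ⋆-assoc unit⁻¹ unit (mon word) ⟨
      (unit⁻¹ K.* unit) ⋆ mon word  ≈⟨ ⋆-cong (K.trans (K.*-comm unit⁻¹ unit) invertible) (≋.reflexive (cong mon e)) ⟩
      K.1# ⋆ const K.1#             ≈⟨ ⋆-identity (const K.1#) ⟩
      const K.1#                    ∎)
      where open Normal N
    zero-product : ∀ x y → f ≋ (x *ₚ y) → x ≋ [] → ⊥
    zero-product x y e x≋0 = mon-nonzero a (≋.trans (≋.sym f≋a) (≋.trans e (*ₚ-cong x≋0 (≋.refl {y}))))
    split : ∀ {x y} → f ≈ₚ (x *ₚ y) → x ∣ const K.1# ⊎ y ∣ const K.1#
    split {x} {y} e with normalise x | normalise y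
    ... | inj₁ x≋0 | _ = ⊥-elim (zero-product x y (coefficients e) x≋0)
    ... | inj₂ _ | inj₁ y≋0 = ⊥-elim (zero-product y x (≋.trans (coefficients e) (*ₚ-comm x y)) y≋0)
    ... | inj₂ M | inj₂ N with factors (word M) (word N) (unit-word a (word M · word N) units (begin
        mon a                                                 ≈⟨ f≋a ⟨
        f                                                     ≈⟨ coefficients e ⟩
        x *ₚ y                                                ≈⟨ *ₚ-cong (normal M) (normal N) ⟩
        (unit M ⋆ mon (word M)) *ₚ (unit N ⋆ mon (word N))    ≈⟨ ⋆-*ₚ (unit M) (mon (word M)) _ ⟩
        unit M ⋆ (mon (word M) *ₚ (unit N ⋆ mon (word N)))    ≈⟨ ⋆-cong K.refl (*ₚ-⋆ (mon (word M)) (unit N) (mon (word N))) ⟩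
        unit M ⋆ (unit N ⋆ (mon (word M) *ₚ mon (word N)))    ≈⟨ ⋆-assoc (unit M) (unit N) _ ⟨
        (unit M K.* unit N) ⋆ (mon (word M) *ₚ mon (word N))  ≈⟨ ⋆-cong K.refl (mon-· (word M) (word N)) ⟨
        (unit M K.* unit N) ⋆ mon (word M · word N)           ∎))
      where
      open Normal
      units : (unit M K.* unit N) K.* (unit⁻¹ M K.* unit⁻¹ N) K.≈ K.1#
      units = K.trans (*-interchange (unit M) (unit N) (unit⁻¹ M) (unit⁻¹ N)) (K.trans (K.*-cong (invertible M) (invertible N)) (K.*-identityˡ K.1#))
    ... | inj₁ M≡[] = inj₁ (record { quotient = const (Normal.unit⁻¹ M) ; equality = constant-unit M M≡[] })
    ... | inj₂ N≡[] = inj₂ (record { quotient = const (Normal.unit⁻¹ N) ; equality = constant-unit N N≡[] })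

-- Gauss's formula

module Counting where

  open import Data.Nat using (_+_; _*_; _^_; _≤_; _<_; z≤n; s≤s)
  open import Data.Nat.Properties using (_≟_)

  -- Indicators and finite sums of natural numbers

  𝟙 : ∀ {a} {A : Set a} → Dec A → ℕ
  𝟙 (yes _) = 1
  𝟙 (no  _) = 0

  𝟙-yes : ∀ {a} {A : Set a} (d : Dec A) → A → 𝟙 d ≡ 1
  𝟙-yes (yes _) _ = refl
  𝟙-yes (no ¬a) a = ⊥-elim (¬a a)

  𝟙-no : ∀ {a} {A : Set a} (d : Dec A) → ¬ A → 𝟙 d ≡ 0
  𝟙-no (yes a) ¬a = ⊥-elim (¬a a)
  𝟙-no (no _)  _  = refl

  𝟙-⇔ : ∀ {a b} {A : Set a} {B : Set b} (d : Dec A) (e : Dec B) → (A → B) → (B → A) → 𝟙 d ≡ 𝟙 e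
  𝟙-⇔ (yes a) e f g = sym (𝟙-yes e (f a))
  𝟙-⇔ (no ¬a) e f g = sym (𝟙-no e (¬a ∘ g))

  Σ : ∀ {a} {A : Set a} → (A → ℕ) → List A → ℕ
  Σ f []       = 0
  Σ f (x ∷ xs) = f x + Σ f xs

  Σ< : (ℕ → ℕ) → ℕ → ℕ
  Σ< f zero    = 0
  Σ< f (suc n) = Σ< f n + f n

  +-interchange : ∀ a b c d → (a + b) + (c + d) ≡ (a + c) + (b + d)
  +-interchange = solve-∀

  module _ {a} {A : Set a} where

    Σ-cong : ∀ {f g : A → ℕ} xs → (∀ x → x ∈ xs → f x ≡ g x) → Σ f xs ≡ Σ g xs
    Σ-cong []       e = refl
    Σ-cong (x ∷ xs) e = cong₂ _+_ (e x (here refl)) (Σ-cong xs (λ y y∈xs → e y (there y∈xs)))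

    Σ-zero : ∀ {f : A → ℕ} xs → (∀ x → x ∈ xs → f x ≡ 0) → Σ f xs ≡ 0
    Σ-zero []       e = refl
    Σ-zero (x ∷ xs) e = cong₂ _+_ (e x (here refl)) (Σ-zero xs (λ y y∈xs → e y (there y∈xs)))

    Σ-const : ∀ n (xs : List A) → Σ (λ _ → n) xs ≡ length xs * n
    Σ-const n []       = refl
    Σ-const n (x ∷ xs) = cong (n +_) (Σ-const n xs)

    Σ-+ : ∀ (f g : A → ℕ) xs → Σ (λ x → f x + g x) xs ≡ Σ f xs + Σ g xs
    Σ-+ f g []       = refl
    Σ-+ f g (x ∷ xs) = trans (cong ((f x + g x) +_) (Σ-+ f g xs)) (+-interchange (f x) (g x) (Σ f xs) (Σ g xs))

    Σ-* : ∀ n (f : A → ℕ) xs → Σ (λ x → n * f x) xs ≡ n * Σ f xs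
    Σ-* n f []       = sym (ℕP.*-zeroʳ n)
    Σ-* n f (x ∷ xs) = trans (cong (n * f x +_) (Σ-* n f xs)) (sym (ℕP.*-distribˡ-+ n (f x) (Σ f xs)))

    Σ-++ : ∀ (f : A → ℕ) xs ys → Σ f (xs ++ ys) ≡ Σ f xs + Σ f ys
    Σ-++ f []       ys = refl
    Σ-++ f (x ∷ xs) ys = trans (cong (f x +_) (Σ-++ f xs ys)) (sym (ℕP.+-assoc (f x) (Σ f xs) (Σ f ys)))

    Σ-Σ< : ∀ (f : A → ℕ → ℕ) n xs → Σ (λ x → Σ< (f x) n) xs ≡ Σ< (λ i → Σ (λ x → f x i) xs) n
    Σ-Σ< f zero    xs = trans (Σ-const 0 xs) (ℕP.*-zeroʳ (length xs))
    Σ-Σ< f (suc n) xs = trans (Σ-+ (λ x → Σ< (f x) n) (λ x → f x n) xs) (cong (_+ Σ (λ x → f x n) xs) (Σ-Σ< f n xs))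

  module _ {a b} {A : Set a} {B : Set b} where

    Σ-map : ∀ (f : B → ℕ) (g : A → B) xs → Σ f (map g xs) ≡ Σ (f ∘ g) xs
    Σ-map f g []       = refl
    Σ-map f g (x ∷ xs) = cong (f (g x) +_) (Σ-map f g xs)

    Σ-swap : ∀ (f : A → B → ℕ) xs ys → Σ (λ x → Σ (f x) ys) xs ≡ Σ (λ y → Σ (λ x → f x y) xs) ys
    Σ-swap f []       ys = sym (trans (Σ-const 0 ys) (ℕP.*-zeroʳ (length ys)))
    Σ-swap f (x ∷ xs) ys = trans (cong (Σ (f x) ys +_) (Σ-swap f xs ys)) (sym (Σ-+ (f x) (λ y → Σ (λ x → f x y) xs) ys))

  Σ-cartesianProductWith : ∀ {a b c} {A : Set a} {B : Set b} {C : Set c} (f : C → ℕ) (g : A → B → C) xs ys →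
    Σ f (cartesianProductWith g xs ys) ≡ Σ (λ x → Σ (λ y → f (g x y)) ys) xs
  Σ-cartesianProductWith f g []       ys = refl
  Σ-cartesianProductWith f g (x ∷ xs) ys = trans (Σ-++ f (map (g x) ys) (cartesianProductWith g xs ys))
    (cong₂ _+_ (Σ-map f (g x) ys) (Σ-cartesianProductWith f g xs ys))

  Σ<-cong : ∀ {f g} n → (∀ i → i < n → f i ≡ g i) → Σ< f n ≡ Σ< g n
  Σ<-cong zero    e = refl
  Σ<-cong (suc n) e = cong₂ _+_ (Σ<-cong n (λ i i<n → e i (ℕP.m<n⇒m<1+n i<n))) (e n ℕP.≤-refl)

  Σ<-zero : ∀ {f} n → (∀ i → i < n → f i ≡ 0) → Σ< f n ≡ 0
  Σ<-zero zero    e = refl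
  Σ<-zero (suc n) e = cong₂ _+_ (Σ<-zero n (λ i i<n → e i (ℕP.m<n⇒m<1+n i<n))) (e n ℕP.≤-refl)

  Σ<-mono : ∀ {f g} n → (∀ i → i < n → f i ≤ g i) → Σ< f n ≤ Σ< g n
  Σ<-mono zero    e = z≤n
  Σ<-mono (suc n) e = ℕP.+-mono-≤ (Σ<-mono n (λ i i<n → e i (ℕP.m<n⇒m<1+n i<n))) (e n ℕP.≤-refl)

  Σ<-+ : ∀ f g n → Σ< (λ i → f i + g i) n ≡ Σ< f n + Σ< g n
  Σ<-+ f g zero    = refl
  Σ<-+ f g (suc n) = trans (cong (_+ (f n + g n)) (Σ<-+ f g n)) (+-interchange (Σ< f n) (Σ< g n) (f n) (g n))

  Σ<-* : ∀ k f n → Σ< (λ i → k * f i) n ≡ k * Σ< f n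
  Σ<-* k f zero    = sym (ℕP.*-zeroʳ k)
  Σ<-* k f (suc n) = trans (cong (_+ k * f n) (Σ<-* k f n)) (sym (ℕP.*-distribˡ-+ k (Σ< f n) (f n)))

  Σ<-first : ∀ f n → Σ< f (suc n) ≡ f 0 + Σ< (f ∘ suc) n
  Σ<-first f zero    = ℕP.+-comm 0 (f 0)
  Σ<-first f (suc n) = trans (cong (_+ f (suc n)) (Σ<-first f n)) (ℕP.+-assoc (f 0) (Σ< (f ∘ suc) n) (f (suc n)))

  Σ<-term : ∀ f {i n} → i < n → f i ≤ Σ< f n
  Σ<-term f {i} {suc n} i<1+n with ℕP.m<1+n⇒m<n∨m≡n i<1+n
  ... | inj₁ i<n  = ℕP.≤-trans (Σ<-term f i<n) (ℕP.m≤m+n (Σ< f n) (f n))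
  ... | inj₂ refl = ℕP.m≤n+m (f n) (Σ< f n)

  Σ<-pick : ∀ (f : ℕ → ℕ) {i n} → i < n → Σ< (λ k → f k * 𝟙 (i ≟ k)) n ≡ f i
  Σ<-pick f {i} {suc n} i<1+n with ℕP.m<1+n⇒m<n∨m≡n i<1+n
  ... | inj₁ i<n  = trans (cong₂ _+_ (Σ<-pick f i<n) (trans (cong (f n *_) (𝟙-no (i ≟ n) (ℕP.<⇒≢ i<n))) (ℕP.*-zeroʳ (f n)))) (ℕP.+-identityʳ (f i))
  ... | inj₂ refl = cong₂ _+_
    (Σ<-zero n (λ k k<n → trans (cong (f k *_) (𝟙-no (n ≟ k) (ℕP.>⇒≢ k<n))) (ℕP.*-zeroʳ (f k))))
    (trans (cong (f n *_) (𝟙-yes (n ≟ n) refl)) (ℕP.*-identityʳ (f n)))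

  -- Enumeration of words

  words : ∀ q → ℕ → List (Word q)
  words q zero    = [] ∷ []
  words q (suc n) = cartesianProductWith _∷_ (allFin q) (words q n)

  length-words : ∀ {q} n {w : Word q} → w ∈ words q n → length w ≡ n
  length-words zero (here refl) = refl
  length-words {q} (suc n) w∈ with ∈-cartesianProductWith⁻ _∷_ (allFin q) (words q n) w∈
  ... | x , v , _ , v∈ , refl = cong suc (length-words n v∈)

  words-unique : ∀ q n → Unique (words q n)
  words-unique q zero    = [] ∷ []
  words-unique q (suc n) = Unique.cartesianProductWith⁺ _∷_ ListP.∷-injective (Unique.allFin⁺ q) (words-unique q n)

  ∈-words : ∀ {q} (w : Word q) → w ∈ words q (length w)
  ∈-words []      = here refl
  ∈-words (x ∷ w) = ∈-cartesianProductWith⁺ _∷_ (∈-allFin x) (∈-words w)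

  ∈-words′ : ∀ {q n} (w : Word q) → length w ≡ n → w ∈ words q n
  ∈-words′ w refl = ∈-words w

  Σ-words-suc : ∀ {q} (f : Word q → ℕ) n → Σ f (words q (suc n)) ≡ Σ (λ x → Σ (λ w → f (x ∷ w)) (words q n)) (allFin q)
  Σ-words-suc {q} f n = Σ-cartesianProductWith f _∷_ (allFin q) (words q n)

  count-words : ∀ q n → Σ (λ _ → 1) (words q n) ≡ q ^ n
  count-words q zero    = refl
  count-words q (suc n) = begin
    Σ (λ _ → 1) (words q (suc n))                 ≡⟨ Σ-words-suc {q} (λ _ → 1) n ⟩
    Σ (λ x → Σ (λ w → 1) (words q n)) (allFin q)  ≡⟨ Σ-cong (allFin q) (λ _ _ → count-words q n) ⟩
    Σ (λ _ → q ^ n) (allFin q)                    ≡⟨ Σ-const (q ^ n) (allFin q) ⟩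
    length (allFin q) * q ^ n                     ≡⟨ cong (_* q ^ n) (ListP.length-tabulate {n = q} (λ x → x)) ⟩
    q * q ^ n                                     ∎
    where open ≡-Reasoning

  infix 4 _≟ʷ_
  _≟ʷ_ : ∀ {q} (a b : Word q) → Dec (a ≡ b)
  _≟ʷ_ = ListP.≡-dec FinP._≟_

  δ : ∀ {q} → Word q → Word q → ℕ
  δ a b = 𝟙 (a ≟ʷ b)

  Σ-pick-Fin : ∀ {n} (f : Fin n → ℕ) y → Σ (λ x → f x * 𝟙 (x FinP.≟ y)) (allFin n) ≡ f y
  Σ-pick-Fin {suc n} f y = trans (cong (f Fin.zero * 𝟙 (Fin.zero FinP.≟ y) +_)
      (trans (cong (Σ (λ x → f x * 𝟙 (x FinP.≟ y))) (sym (ListP.map-tabulate {n = n} (λ x → x) Fin.suc)))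
             (Σ-map (λ x → f x * 𝟙 (x FinP.≟ y)) Fin.suc (allFin n)))) (split y)
    where
    split : ∀ y → f Fin.zero * 𝟙 (Fin.zero FinP.≟ y) + Σ (λ x → f (Fin.suc x) * 𝟙 (Fin.suc x FinP.≟ y)) (allFin n) ≡ f y
    split Fin.zero = trans (cong₂ _+_ (ℕP.*-identityʳ (f Fin.zero)) (Σ-zero (allFin n) (λ x _ → ℕP.*-zeroʳ (f (Fin.suc x))))) (ℕP.+-identityʳ _)
    split (Fin.suc y) = trans (cong₂ _+_ (ℕP.*-zeroʳ (f Fin.zero))
        (Σ-cong (allFin n) (λ x _ → cong (f (Fin.suc x) *_) (𝟙-⇔ (Fin.suc x FinP.≟ Fin.suc y) (x FinP.≟ y) FinP.suc-injective (cong Fin.suc)))))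
      (Σ-pick-Fin (f ∘ Fin.suc) y)

  Σ-pick : ∀ {q} (f : Word q → ℕ) n b → length b ≡ n → Σ (λ a → f a * δ a b) (words q n) ≡ f b
  Σ-pick {q} f zero    []      refl = trans (ℕP.+-identityʳ _) (ℕP.*-identityʳ (f []))
  Σ-pick {q} f (suc n) (y ∷ b) e = begin
    Σ (λ a → f a * δ a (y ∷ b)) (words q (suc n))
      ≡⟨ Σ-words-suc (λ a → f a * δ a (y ∷ b)) n ⟩
    Σ (λ x → Σ (λ a → f (x ∷ a) * δ (x ∷ a) (y ∷ b)) (words q n)) (allFin q)
      ≡⟨ Σ-cong (allFin q) (λ x _ → inner x) ⟩
    Σ (λ x → f (x ∷ b) * 𝟙 (x FinP.≟ y)) (allFin q)
      ≡⟨ Σ-pick-Fin (λ x → f (x ∷ b)) y ⟩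
    f (y ∷ b) ∎
    where
    open ≡-Reasoning
    split : ∀ x a → δ (x ∷ a) (y ∷ b) ≡ 𝟙 (x FinP.≟ y) * δ a b
    split x a = on (x FinP.≟ y)
      where
      on : (d : Dec (x ≡ y)) → δ (x ∷ a) (y ∷ b) ≡ 𝟙 d * δ a b
      on (yes refl) = trans (𝟙-⇔ (x ∷ a ≟ʷ x ∷ b) (a ≟ʷ b) ListP.∷-injectiveʳ (cong (x ∷_))) (sym (ℕP.*-identityˡ (δ a b)))
      on (no x≢y)   = 𝟙-no (x ∷ a ≟ʷ y ∷ b) (x≢y ∘ ListP.∷-injectiveˡ)
    shuffle : ∀ u v w → u * (v * w) ≡ v * (u * w)
    shuffle = solve-∀
    inner : ∀ x → Σ (λ a → f (x ∷ a) * δ (x ∷ a) (y ∷ b)) (words q n) ≡ f (x ∷ b) * 𝟙 (x FinP.≟ y)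
    inner x = begin
      Σ (λ a → f (x ∷ a) * δ (x ∷ a) (y ∷ b)) (words q n)
        ≡⟨ Σ-cong (words q n) (λ a _ → trans (cong (f (x ∷ a) *_) (split x a)) (shuffle (f (x ∷ a)) (𝟙 (x FinP.≟ y)) (δ a b))) ⟩
      Σ (λ a → 𝟙 (x FinP.≟ y) * (f (x ∷ a) * δ a b)) (words q n)
        ≡⟨ Σ-* (𝟙 (x FinP.≟ y)) (λ a → f (x ∷ a) * δ a b) (words q n) ⟩
      𝟙 (x FinP.≟ y) * Σ (λ a → f (x ∷ a) * δ a b) (words q n)
        ≡⟨ cong (𝟙 (x FinP.≟ y) *_) (Σ-pick (λ a → f (x ∷ a)) n b (ℕP.suc-injective e)) ⟩
      𝟙 (x FinP.≟ y) * f (x ∷ b)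
        ≡⟨ ℕP.*-comm (𝟙 (x FinP.≟ y)) (f (x ∷ b)) ⟩
      f (x ∷ b) * 𝟙 (x FinP.≟ y) ∎

  Σ-pick-none : ∀ {q} (f : Word q → ℕ) n b → ¬ (length b ≡ n) → Σ (λ a → f a * δ a b) (words q n) ≡ 0
  Σ-pick-none {q} f n b ≢n = Σ-zero (words q n) (λ a a∈ → trans
    (cong (f a *_) (𝟙-no (a ≟ʷ b) (λ a≡b → ≢n (trans (cong length (sym a≡b)) (length-words n a∈))))) (ℕP.*-zeroʳ (f a)))

  Σ-δ : ∀ {q} n (b : Word q) → Σ (λ a → δ a b) (words q n) ≡ 𝟙 (length b ≟ n)
  Σ-δ {q} n b with length b ≟ n
  ... | yes e = trans (Σ-cong (words q n) (λ a _ → sym (ℕP.*-identityˡ (δ a b)))) (Σ-pick (λ _ → 1) n b e)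
  ... | no ¬e = trans (Σ-cong (words q n) (λ a _ → sym (ℕP.*-identityˡ (δ a b)))) (Σ-pick-none (λ _ → 1) n b ¬e)

  Σ<-extend : ∀ f {m n} → m ≤ n → Σ< f m ≤ Σ< f n
  Σ<-extend f {n = zero}  z≤n = z≤n
  Σ<-extend f {n = suc n} m≤n with ℕP.m≤n⇒m<n∨m≡n m≤n
  ... | inj₁ (s≤s m≤n′) = ℕP.≤-trans (Σ<-extend f m≤n′) (ℕP.m≤m+n (Σ< f n) (f n))
  ... | inj₂ refl       = ℕP.≤-refl

  Σ<-restrict : ∀ f h n → Σ< (λ i → f i * 𝟙 (i ℕP.<? h)) n ≤ Σ< f h
  Σ<-restrict f h zero    = z≤n
  Σ<-restrict f h (suc n) = split (n ℕP.<? h)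
    where
    split : (d : Dec (n < h)) → Σ< (λ i → f i * 𝟙 (i ℕP.<? h)) n + f n * 𝟙 d ≤ Σ< f h
    split (yes n<h) = ℕP.≤-trans (ℕP.+-mono-≤ (Σ<-mono n (λ i i<n → ℕP.≤-reflexive (trans
        (cong (f i *_) (𝟙-yes (i ℕP.<? h) (ℕP.<-trans i<n n<h))) (ℕP.*-identityʳ (f i))))) (ℕP.≤-reflexive (ℕP.*-identityʳ (f n))))
      (Σ<-extend f n<h)
    split (no _) = ℕP.≤-trans (ℕP.≤-reflexive (trans (cong (Σ< (λ i → f i * 𝟙 (i ℕP.<? h)) n +_) (ℕP.*-zeroʳ (f n))) (ℕP.+-identityʳ _)))
      (Σ<-restrict f h n)

  Σ<-unique : ∀ {a} {A : ℕ → Set a} (d : ∀ k → Dec (A k)) n → (∀ j k → A j → A k → j ≡ k) → Σ< (λ k → 𝟙 (d k)) n ≤ 1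
  Σ<-unique d zero    unique = z≤n
  Σ<-unique d (suc n) unique = split (d n)
    where
    split : (e : Dec _) → Σ< (λ k → 𝟙 (d k)) n + 𝟙 e ≤ 1
    split (yes a) = ℕP.≤-reflexive (cong (_+ 1) (Σ<-zero n (λ k k<n → 𝟙-no (d k) (λ b → ℕP.<⇒≢ k<n (unique k n b a)))))
    split (no _)  = ℕP.≤-trans (ℕP.≤-reflexive (ℕP.+-identityʳ _)) (Σ<-unique d n unique)

  -- q + q² + ⋯ + q^h = (qʰ⁺¹ - q)/(q - 1) for q = p + 1, cleared of division and subtraction.
  geometric : ∀ p h → p * Σ< (λ i → suc p ^ suc i) h + suc p ≡ suc p * suc p ^ h
  geometric p zero    = trans (cong (_+ suc p) (ℕP.*-zeroʳ p)) (sym (ℕP.*-identityʳ (suc p)))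
  geometric p (suc h) = begin
    p * (T + suc p ^ suc h) + suc p      ≡⟨ shuffle p T (suc p ^ suc h) ⟩
    (p * T + suc p) + p * suc p ^ suc h  ≡⟨ cong (_+ p * suc p ^ suc h) (geometric p h) ⟩
    suc p * suc p ^ suc h                ∎
    where
    open ≡-Reasoning
    T : ℕ
    T = Σ< (λ i → suc p ^ suc i) h
    shuffle : ∀ p t x → p * (t + x) + suc p ≡ (p * t + suc p) + p * x
    shuffle = solve-∀

  module GaussFormula {c ℓ} {q : ℕ} (F : FiniteField c ℓ q) where

    open PolynomialRing F using (_·_; length-·; ·-identityˡ; ·-comm; ·-assoc; ·-cancelˡ; IrreducibleWord; euclid)

    -- Divisibility and the number of multiples

    ·-identityʳ : ∀ a → a · [] ≡ a
    ·-identityʳ a = trans (·-comm a []) (·-identityˡ a)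

    infix 4 _∣ʷ_
    _∣ʷ_ : Word q → Word q → Set
    g ∣ʷ f = ∃ λ h → f ≡ g · h

    -- The indicator of g ∣ f, by cancellation; if g is longer than f the only candidate [] fails.
    quotients : Word q → Word q → ℕ
    quotients g f = Σ (λ h → δ f (g · h)) (words q (length f ∸ length g))

    quotients-multiple : ∀ g h → quotients g (g · h) ≡ 1
    quotients-multiple g h = begin
      quotients g (g · h)
        ≡⟨ Σ-cong (words q (length (g · h) ∸ length g)) (λ h′ _ → 𝟙-⇔ (g · h ≟ʷ g · h′) (h′ ≟ʷ h) (λ e → sym (·-cancelˡ g h h′ e)) (λ e → cong (g ·_) (sym e))) ⟩
      Σ (λ h′ → δ h′ h) (words q (length (g · h) ∸ length g))
        ≡⟨ Σ-δ _ h ⟩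
      𝟙 (length h ≟ length (g · h) ∸ length g)
        ≡⟨ 𝟙-yes (length h ≟ length (g · h) ∸ length g) (sym (trans (cong (_∸ length g) (length-· g h)) (ℕP.m+n∸m≡n (length g) (length h)))) ⟩
      1 ∎
      where open ≡-Reasoning

    quotients-none : ∀ g f → ¬ (g ∣ʷ f) → quotients g f ≡ 0
    quotients-none g f ∤ = Σ-zero (words q (length f ∸ length g)) (λ h _ → 𝟙-no (f ≟ʷ g · h) (λ e → ∤ (h , e)))

    _∣ʷ?_ : ∀ g f → Dec (g ∣ʷ f)
    g ∣ʷ? f = map′ (λ any → let h , _ , e = find any in h , e)
      (λ (h , e) → lose (∈-words′ h (sym (trans (cong (λ t → length t ∸ length g) e)
        (trans (cong (_∸ length g) (length-· g h)) (ℕP.m+n∸m≡n (length g) (length h)))))) e)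
      (any? (λ h → f ≟ʷ g · h) (words q (length f ∸ length g)))

    quotients-⇔ : ∀ {g f g′ f′} → (g ∣ʷ f → g′ ∣ʷ f′) → (g′ ∣ʷ f′ → g ∣ʷ f) → quotients g f ≡ quotients g′ f′
    quotients-⇔ {g} {f} {g′} {f′} to from with g ∣ʷ? f
    ... | no ∤ = trans (quotients-none g f ∤) (sym (quotients-none g′ f′ (∤ ∘ from)))
    ... | yes (h , refl) with to (h , refl)
    ... | h′ , refl = trans (quotients-multiple g h) (sym (quotients-multiple g′ h′))

    -- The number of multiples of degree n of a polynomial of degree m. The indicator repairs the
    -- truncated subtraction, which would give q⁰ = 1 for m > n.
    multiples : ℕ → ℕ → ℕ
    multiples n m = q ^ (n ∸ m) * 𝟙 (m ℕP.≤? n)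

    -- Summing over the cofactor first and over the multiple second, each cofactor of degree n - deg
    -- g has exactly one product.
    count-multiples : ∀ n g → Σ (quotients g) (words q n) ≡ multiples n (length g)
    count-multiples n g = begin
      Σ (quotients g) (words q n)
        ≡⟨ Σ-cong (words q n) (λ f f∈ → cong (λ k → Σ (λ h → δ f (g · h)) (words q (k ∸ length g))) (length-words n f∈)) ⟩
      Σ (λ f → Σ (λ h → δ f (g · h)) (words q m)) (words q n)
        ≡⟨ Σ-swap (λ f h → δ f (g · h)) (words q n) (words q m) ⟩
      Σ (λ h → Σ (λ f → δ f (g · h)) (words q n)) (words q m)
        ≡⟨ Σ-cong (words q m) (λ h h∈ → trans (Σ-δ n (g · h)) (fits h (length-words m h∈))) ⟩
      Σ (λ h → 𝟙 (length g ℕP.≤? n)) (words q m)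
        ≡⟨ trans (Σ-cong (words q m) (λ _ _ → sym (ℕP.*-identityʳ _))) (Σ-* (𝟙 (length g ℕP.≤? n)) (λ _ → 1) (words q m)) ⟩
      𝟙 (length g ℕP.≤? n) * Σ (λ h → 1) (words q m)
        ≡⟨ trans (cong (𝟙 (length g ℕP.≤? n) *_) (count-words q m)) (ℕP.*-comm (𝟙 (length g ℕP.≤? n)) (q ^ m)) ⟩
      multiples n (length g) ∎
      where
      open ≡-Reasoning
      m : ℕ
      m = n ∸ length g
      fits : ∀ h → length h ≡ m → 𝟙 (length (g · h) ≟ n) ≡ 𝟙 (length g ℕP.≤? n)
      fits h e = 𝟙-⇔ (length (g · h) ≟ n) (length g ℕP.≤? n)
        (λ e′ → ℕP.≤-trans (ℕP.m≤m+n (length g) (length h)) (ℕP.≤-reflexive (trans (sym (length-· g h)) e′)))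
        (λ le → trans (length-· g h) (trans (cong (length g +_) e) (ℕP.m+[n∸m]≡n le)))

    -- Irreducible factors and their exponents

    pow : Word q → ℕ → Word q
    pow p zero    = []
    pow p (suc k) = p · pow p k

    length-pow : ∀ p k → length (pow p k) ≡ k * length p
    length-pow p zero    = refl
    length-pow p (suc k) = trans (length-· p (pow p k)) (cong (length p +_) (length-pow p k))

    Factorisation : Word q → Word q → Word q → Set
    Factorisation f a b = f ≡ a · b × 0 < length a × 0 < length b

    factorisation? : ∀ f → Dec (∃₂ (Factorisation f))
    factorisation? f = map′ forward backward
      (any? (λ i → any? (λ a → any? (λ b → (f ≟ʷ a · b) ×-dec ((0 ℕP.<? length a) ×-dec (0 ℕP.<? length b))) (words q (length f ∸ i))) (words q i)) (upTo (suc (length f))))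
      where
      Found : Set
      Found = Any (λ i → Any (λ a → Any (Factorisation f a) (words q (length f ∸ i))) (words q i)) (upTo (suc (length f)))
      forward : Found → ∃₂ (Factorisation f)
      forward any with find any
      ... | i , _ , any′ with find any′
      ... | a , _ , any″ with find any″
      ... | b , _ , e = a , b , e
      backward : ∃₂ (Factorisation f) → Found
      backward (a , b , e , rest) = lose (∈-upTo⁺ (s≤s (ℕP.≤-trans (ℕP.m≤m+n (length a) (length b)) (ℕP.≤-reflexive (sym total)))))
        (lose (∈-words a) (lose (∈-words′ b (sym (trans (cong (_∸ length a) total) (ℕP.m+n∸m≡n (length a) (length b))))) (e , rest)))
        where
        total : length f ≡ length a + length b
        total = trans (cong length e) (length-· a b)

    empty-or-longer : ∀ (a : Word q) → a ≡ [] ⊎ 0 < length a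
    empty-or-longer []      = inj₁ refl
    empty-or-longer (x ∷ a) = inj₂ (s≤s z≤n)

    irreducible : ∀ {f} → 0 < length f → ¬ ∃₂ (Factorisation f) → IrreducibleWord f
    irreducible 0<f none = 0<f , λ a b e → split a b e (empty-or-longer a) (empty-or-longer b)
      where
      split : ∀ a b → _ ≡ a · b → a ≡ [] ⊎ 0 < length a → b ≡ [] ⊎ 0 < length b → a ≡ [] ⊎ b ≡ []
      split a b e (inj₁ a≡[]) _           = inj₁ a≡[]
      split a b e (inj₂ _)    (inj₁ b≡[]) = inj₂ b≡[]
      split a b e (inj₂ 0<a)  (inj₂ 0<b)  = ⊥-elim (none (a , b , e , 0<a , 0<b))

    irreducible? : ∀ f → Dec (IrreducibleWord f)
    irreducible? f with 0 ℕP.<? length f | factorisation? f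
    ... | no ¬0<f | _ = no (¬0<f ∘ proj₁)
    ... | yes 0<f | no none = yes (irreducible 0<f none)
    ... | yes 0<f | yes (a , b , e , 0<a , 0<b) = no λ (_ , split) → [ nonempty 0<a , nonempty 0<b ]′ (split a b e)
      where
      nonempty : ∀ {a} → 0 < length a → ¬ (a ≡ [])
      nonempty 0<a refl = ℕP.<-irrefl refl 0<a

    factor : ∀ f → 0 < length f → Acc _<_ (length f) → ∃₂ λ p g → IrreducibleWord p × f ≡ p · g
    factor f 0<f (acc rec) with factorisation? f
    ... | no none = f , [] , irreducible 0<f none , sym (·-identityʳ f)
    ... | yes (a , b , e , 0<a , 0<b) with factor a 0<a (rec (ℕP.<-≤-trans (ℕP.m<m+n (length a) 0<b) (ℕP.≤-reflexive (sym (trans (cong length e) (length-· a b))))))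
    ... | p , g , irr , e′ = p , g · b , irr , trans e (trans (cong (_· b) e′) (·-assoc p g b))

    irreducible-∣-irreducible : ∀ {p p′} → IrreducibleWord p → IrreducibleWord p′ → p ∣ʷ p′ → p ≡ p′
    irreducible-∣-irreducible {p} (0<p , _) (_ , split) (h , e) with split p h e
    ... | inj₁ refl = ⊥-elim (ℕP.<-irrefl refl 0<p)
    ... | inj₂ refl = sym (trans e (·-identityʳ p))

    ·-exchange : ∀ a b c → a · (b · c) ≡ b · (a · c)
    ·-exchange a b c = trans (sym (·-assoc a b c)) (trans (cong (_· c) (·-comm a b)) (·-assoc b a c))

    -- Factors p are moved off one at a time: Euclid's lemma puts p into p′ or into g, the first is
    -- impossible for distinct irreducibles, and after writing g = p·g′ one p is cancelled.
    pow-∣-other : ∀ {p p′} → IrreducibleWord p → IrreducibleWord p′ → ¬ (p ≡ p′) → ∀ k g → pow p k ∣ʷ p′ · g → pow p k ∣ʷ g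
    pow-∣-other irr irr′ p≢p′ zero g _ = g , sym (·-identityˡ g)
    pow-∣-other {p} {p′} irr irr′ p≢p′ (suc k) g (h , e) with euclid irr p′ g (pow p k · h) (trans e (·-assoc p (pow p k) h))
    ... | inj₁ p∣p′ = ⊥-elim (p≢p′ (irreducible-∣-irreducible irr irr′ p∣p′))
    ... | inj₂ (g′ , refl) with pow-∣-other irr irr′ p≢p′ k g′
      (h , ·-cancelˡ p _ _ (trans (·-exchange p p′ g′) (trans e (·-assoc p (pow p k) h))))
    ... | h′ , refl = h′ , sym (·-assoc p (pow p k) h′)

    ∣-·ˡ : ∀ {d g} f → d ∣ʷ g → d ∣ʷ f · g
    ∣-·ˡ {d} f (h , refl) = f · h , ·-exchange f d h

    quotients-other : ∀ {p p′} → IrreducibleWord p → IrreducibleWord p′ → ¬ (p ≡ p′) → ∀ k g → quotients (pow p k) (p′ · g) ≡ quotients (pow p k) g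
    quotients-other {p} {p′} irr irr′ p≢p′ k g = quotients-⇔ {pow p k} {p′ · g} (pow-∣-other irr irr′ p≢p′ k g) (∣-·ˡ p′)

    quotients-same : ∀ p k g → quotients (pow p (suc k)) (p · g) ≡ quotients (pow p k) g
    quotients-same p k g = quotients-⇔ {pow p (suc k)} {p · g}
      (λ (h , e) → h , ·-cancelˡ p _ _ (trans e (·-assoc p (pow p k) h)))
      (λ (h , e) → h , trans (cong (p ·_) e) (sym (·-assoc p (pow p k) h)))

    quotients-long : ∀ g f → length f < length g → quotients g f ≡ 0
    quotients-long g f f<g = quotients-none g f (λ (h , e) → ℕP.<⇒≱ f<g
      (ℕP.≤-trans (ℕP.m≤m+n (length g) (length h)) (ℕP.≤-reflexive (sym (trans (cong length e) (length-· g h))))))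

    -- The exponent of p in f is the number of k ≥ 1 with pᵏ ∣ f; for p of positive degree a cut-off
    -- N ≥ deg f loses nothing.
    valuation : ℕ → Word q → Word q → ℕ
    valuation N p f = Σ< (λ k → quotients (pow p (suc k)) f) N

    quotients-pow-long : ∀ p k f → 0 < length p → length f < k → quotients (pow p k) f ≡ 0
    quotients-pow-long p k f 0<p f<k = quotients-long (pow p k) f (ℕP.<-≤-trans f<k
      (ℕP.≤-trans (ℕP.≤-reflexive (sym (ℕP.*-identityʳ k))) (ℕP.≤-trans (ℕP.*-monoʳ-≤ k 0<p) (ℕP.≤-reflexive (sym (length-pow p k))))))

    valuation-irreducible : ∀ {N p p′} g → IrreducibleWord p → IrreducibleWord p′ → length (p′ · g) ≤ N → valuation N p (p′ · g) ≡ valuation N p g + δ p p′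
    valuation-irreducible {N} {p} {p′} g irr irr′ le with p ≟ʷ p′
    ... | no p≢p′ = trans (Σ<-cong N (λ k _ → quotients-other irr irr′ p≢p′ (suc k) g)) (sym (ℕP.+-identityʳ (valuation N p g)))
    ... | yes refl = begin
      Σ< (λ k → quotients (pow p (suc k)) (p · g)) N  ≡⟨ Σ<-cong N (λ k _ → quotients-same p k g) ⟩
      Σ< (λ k → quotients (pow p k) g) N              ≡⟨ ℕP.+-identityʳ _ ⟨
      -- The index has been shifted by one. A term for k = N may be appended, since p^N is longer
      -- than g, and the term for k = 0 then splits off as the extra 1.
      Σ< (λ k → quotients (pow p k) g) N + 0          ≡⟨ cong (Σ< (λ k → quotients (pow p k) g) N +_) (quotients-pow-long p N g (proj₁ irr) g<N) ⟨
      Σ< (λ k → quotients (pow p k) g) (suc N)        ≡⟨ Σ<-first (λ k → quotients (pow p k) g) N ⟩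
      quotients [] g + valuation N p g                ≡⟨ cong (_+ valuation N p g) (trans (cong (quotients []) (sym (·-identityˡ g))) (quotients-multiple [] g)) ⟩
      1 + valuation N p g                             ≡⟨ ℕP.+-comm 1 (valuation N p g) ⟩
      valuation N p g + 1                             ∎
      where
      open ≡-Reasoning
      g<N : length g < N
      g<N = ℕP.<-≤-trans (ℕP.m<n+m (length g) (proj₁ irr)) (ℕP.≤-trans (ℕP.≤-reflexive (sym (length-· p g))) le)

    is-irreducible : Word q → ℕ
    is-irreducible p = 𝟙 (irreducible? p)

    -- ∑ deg p · vₚ(f) over the irreducible p, where N ≥ deg f bounds both deg p and the exponents.
    valuation-degree : ℕ → Word q → ℕ
    valuation-degree N f = Σ< (λ i → Σ (λ p → is-irreducible p * (suc i * valuation N p f)) (words q (suc i))) N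

    valuation-degree-step : ∀ {N p} g → IrreducibleWord p → length (p · g) ≤ N → valuation-degree N (p · g) ≡ valuation-degree N g + length p
    valuation-degree-step {N} {p} g irr-p le = begin
      Σ< (λ i → Σ (λ p′ → is-irreducible p′ * (suc i * valuation N p′ (p · g))) (words q (suc i))) N
        ≡⟨ Σ<-cong N (λ i _ → trans (Σ-cong (words q (suc i)) (λ p′ _ → term i p′ (irreducible? p′))) (Σ-+ _ _ (words q (suc i)))) ⟩
      Σ< (λ i → Σ (λ p′ → is-irreducible p′ * (suc i * valuation N p′ g)) (words q (suc i)) + Σ (λ p′ → is-irreducible p′ * suc i * δ p′ p) (words q (suc i))) N
        ≡⟨ Σ<-+ _ _ N ⟩
      valuation-degree N g + Σ< (λ i → Σ (λ p′ → is-irreducible p′ * suc i * δ p′ p) (words q (suc i))) N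
        ≡⟨ cong (valuation-degree N g +_) (trans (Σ<-cong N (λ i _ → pick i (length p ≟ suc i))) (only (length p) (proj₁ irr-p) p≤N)) ⟩
      valuation-degree N g + length p ∎
      where
      open ≡-Reasoning
      p≤N : length p ≤ N
      p≤N = ℕP.≤-trans (ℕP.m≤m+n (length p) (length g)) (ℕP.≤-trans (ℕP.≤-reflexive (sym (length-· p g))) le)
      shuffle : ∀ i v d → 1 * (suc i * (v + d)) ≡ 1 * (suc i * v) + 1 * suc i * d
      shuffle = solve-∀
      term : ∀ i p′ (d : Dec (IrreducibleWord p′)) → 𝟙 d * (suc i * valuation N p′ (p · g)) ≡ 𝟙 d * (suc i * valuation N p′ g) + 𝟙 d * suc i * δ p′ p
      term i p′ (no _)       = refl
      term i p′ (yes irr-p′) = trans (cong (λ t → 1 * (suc i * t)) (valuation-irreducible g irr-p′ irr-p le)) (shuffle i (valuation N p′ g) (δ p′ p))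
      pick : ∀ i (d : Dec (length p ≡ suc i)) → Σ (λ p′ → is-irreducible p′ * suc i * δ p′ p) (words q (suc i)) ≡ suc i * 𝟙 d
      pick i (yes e) = trans (Σ-pick (λ p′ → is-irreducible p′ * suc i) (suc i) p e)
        (trans (cong (_* suc i) (𝟙-yes (irreducible? p) irr-p)) (trans (ℕP.*-identityˡ (suc i)) (sym (ℕP.*-identityʳ (suc i)))))
      pick i (no ¬e) = trans (Σ-pick-none (λ p′ → is-irreducible p′ * suc i) (suc i) p ¬e) (sym (ℕP.*-zeroʳ (suc i)))
      only : ∀ m → 0 < m → m ≤ N → Σ< (λ i → suc i * 𝟙 (m ≟ suc i)) N ≡ m
      only (suc m) _ m<N = trans (Σ<-cong N (λ i _ → cong (suc i *_) (𝟙-⇔ (suc m ≟ suc i) (m ≟ i) ℕP.suc-injective (cong suc)))) (Σ<-pick (λ i → suc i) m<N)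

    -- Both sides vanish at 1 and grow by deg p when an irreducible factor p is put on. Induction on
    -- the degree therefore suffices, and the factorisation of f is never formed.
    degree-identity : ∀ N f → length f ≤ N → Acc _<_ (length f) → valuation-degree N f ≡ length f
    degree-identity N [] _ _ = Σ<-zero N (λ i _ → Σ-zero (words q (suc i)) (λ p p∈ → trans
      (cong (λ t → is-irreducible p * (suc i * t)) (Σ<-zero N (λ k _ → quotients-pow-long p (suc k) [] (ℕP.≤-trans (s≤s z≤n) (ℕP.≤-reflexive (sym (length-words (suc i) p∈)))) (s≤s z≤n))))
      (trans (cong (is-irreducible p *_) (ℕP.*-zeroʳ (suc i))) (ℕP.*-zeroʳ (is-irreducible p)))))
    degree-identity N f@(_ ∷ _) le (acc rec) with factor f (s≤s z≤n) (<-wellFounded _)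
    ... | p , g , irr-p , e = trans (cong (valuation-degree N) e) (trans (valuation-degree-step g irr-p (ℕP.≤-trans (ℕP.≤-reflexive (sym (cong length e))) le))
      (trans (cong (_+ length p) (degree-identity N g (ℕP.≤-trans (ℕP.<⇒≤ g<f) le) (rec g<f)))
        (trans (ℕP.+-comm (length g) (length p)) (sym (trans (cong length e) (length-· p g))))))
      where
      g<f : length g < length f
      g<f = ℕP.<-≤-trans (ℕP.m<n+m (length g) (proj₁ irr-p)) (ℕP.≤-reflexive (sym (trans (cong length e) (length-· p g))))

    -- Double counting of the total degree

    #irreducible : ℕ → ℕ
    #irreducible d = Σ is-irreducible (words q d)

    -- The degrees of all monic polynomials of degree n are added in two ways. The cut-off N is kept
    -- apart from n so that the sums for two consecutive degrees can be compared term by term.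
    total-degree : ∀ N n → n ≤ N → n * q ^ n ≡ Σ< (λ i → suc i * #irreducible (suc i) * Σ< (λ k → multiples n (suc k * suc i)) N) N
    total-degree N n n≤N = begin
      n * q ^ n
        ≡⟨ cong (n *_) (sym (count-words q n)) ⟩
      n * Σ (λ _ → 1) (words q n)
        ≡⟨ sym (Σ-* n (λ _ → 1) (words q n)) ⟩
      Σ (λ _ → n * 1) (words q n)
        ≡⟨ Σ-cong (words q n) (λ f f∈ → trans (ℕP.*-identityʳ n) (sym (trans
             (degree-identity N f (ℕP.≤-trans (ℕP.≤-reflexive (length-words n f∈)) n≤N) (<-wellFounded _)) (length-words n f∈)))) ⟩
      Σ (valuation-degree N) (words q n)
        ≡⟨ Σ-Σ< _ N (words q n) ⟩
      Σ< (λ i → Σ (λ f → Σ (λ p → is-irreducible p * (suc i * valuation N p f)) (words q (suc i))) (words q n)) N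
        ≡⟨ Σ<-cong N (λ i _ → trans (Σ-swap (λ f p → is-irreducible p * (suc i * valuation N p f)) (words q n) (words q (suc i))) (inner i)) ⟩
      Σ< (λ i → suc i * #irreducible (suc i) * Σ< (λ k → multiples n (suc k * suc i)) N) N ∎
      where
      open ≡-Reasoning
      count : ∀ i p → length p ≡ suc i → Σ (valuation N p) (words q n) ≡ Σ< (λ k → multiples n (suc k * suc i)) N
      count i p e = trans (Σ-Σ< (λ f k → quotients (pow p (suc k)) f) N (words q n))
        (Σ<-cong N (λ k _ → trans (count-multiples n (pow p (suc k))) (cong (multiples n) (trans (length-pow p (suc k)) (cong (suc k *_) e)))))
      shuffle : ∀ x i s → x * (suc i * s) ≡ suc i * s * x
      shuffle = solve-∀
      shuffle′ : ∀ i s t → suc i * s * t ≡ suc i * t * s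
      shuffle′ = solve-∀
      inner : ∀ i → Σ (λ p → Σ (λ f → is-irreducible p * (suc i * valuation N p f)) (words q n)) (words q (suc i)) ≡ suc i * #irreducible (suc i) * Σ< (λ k → multiples n (suc k * suc i)) N
      inner i = begin
        Σ (λ p → Σ (λ f → is-irreducible p * (suc i * valuation N p f)) (words q n)) (words q (suc i))
          ≡⟨ Σ-cong (words q (suc i)) (λ p p∈ → trans (Σ-* (is-irreducible p) _ (words q n)) (trans (cong (is-irreducible p *_) (trans (Σ-* (suc i) _ (words q n))
               (cong (suc i *_) (count i p (length-words (suc i) p∈))))) (shuffle (is-irreducible p) i T))) ⟩
        Σ (λ p → suc i * T * is-irreducible p) (words q (suc i))
          ≡⟨ Σ-* (suc i * T) is-irreducible (words q (suc i)) ⟩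
        suc i * T * #irreducible (suc i)
          ≡⟨ shuffle′ i T (#irreducible (suc i)) ⟩
        suc i * #irreducible (suc i) * T ∎
        where
        T : ℕ
        T = Σ< (λ k → multiples n (suc k * suc i)) N

    -- Raising the degree multiplies the number of multiples by q, except that at m = n + 1 a first
    -- multiple appears. These exceptional terms are all that the comparison in `gauss` leaves.
    multiples-suc : ∀ n m → multiples (suc n) m ≡ q * multiples n m + 𝟙 (m ≟ suc n)
    multiples-suc n m with m ℕP.≤? n
    ... | yes m≤n = trans (cong₂ _*_ (cong (q ^_) (ℕP.+-∸-assoc 1 m≤n)) (𝟙-yes (m ℕP.≤? suc n) (ℕP.m≤n⇒m≤1+n m≤n)))
      (trans (shuffle q (q ^ (n ∸ m))) (cong (q * (q ^ (n ∸ m) * 1) +_) (sym (𝟙-no (m ≟ suc n) (ℕP.<⇒≢ (s≤s m≤n))))))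
      where
      shuffle : ∀ q x → q * x * 1 ≡ q * (x * 1) + 0
      shuffle = solve-∀
    ... | no m≰n = trans (cong₂ (λ x y → x * y) (cong (q ^_) (ℕP.m≤n⇒m∸n≡0 (ℕP.≰⇒> m≰n))) (𝟙-⇔ (m ℕP.≤? suc n) (m ≟ suc n)
        (λ le → ℕP.≤-antisym le (ℕP.≰⇒> m≰n)) ℕP.≤-reflexive))
      (trans (ℕP.*-identityˡ _) (sym (cong (_+ 𝟙 (m ≟ suc n)) (trans (cong (q *_) (ℕP.*-zeroʳ (q ^ (n ∸ m)))) (ℕP.*-zeroʳ q)))))

    -- The left sides of `total-degree` give (n + 1)·qⁿ⁺¹ - q·n·qⁿ = qⁿ⁺¹, carried out by adding and
    -- cancelling q·n·qⁿ. The inner sum on the right is the indicator of i + 1 dividing n + 1.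
    gauss : ∀ n → q ^ suc n ≡ Σ< (λ i → suc i * #irreducible (suc i) * Σ< (λ k → 𝟙 (suc k * suc i ≟ suc n)) (suc n)) (suc n)
    gauss n = ℕP.+-cancelˡ-≡ (q * (n * q ^ n)) _ _ (begin
      q * (n * q ^ n) + q ^ suc n
        ≡⟨ shuffle q n (q ^ n) ⟩
      suc n * q ^ suc n
        ≡⟨ total-degree N (suc n) ℕP.≤-refl ⟩
      Σ< (λ i → suc i * #irreducible (suc i) * Σ< (λ k → multiples (suc n) (suc k * suc i)) N) N
        ≡⟨ Σ<-cong N (λ i _ → trans (cong (suc i * #irreducible (suc i) *_) (trans (Σ<-cong N (λ k _ → multiples-suc n (suc k * suc i)))
             (trans (Σ<-+ _ _ N) (cong (_+ E i) (Σ<-* q _ N))))) (shuffle′ (suc i * #irreducible (suc i)) q (Σ< (λ k → multiples n (suc k * suc i)) N) (E i))) ⟩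
      Σ< (λ i → q * (suc i * #irreducible (suc i) * Σ< (λ k → multiples n (suc k * suc i)) N) + suc i * #irreducible (suc i) * E i) N
        ≡⟨ trans (Σ<-+ _ _ N) (cong (_+ Σ< (λ i → suc i * #irreducible (suc i) * E i) N) (Σ<-* q _ N)) ⟩
      q * Σ< (λ i → suc i * #irreducible (suc i) * Σ< (λ k → multiples n (suc k * suc i)) N) N + Σ< (λ i → suc i * #irreducible (suc i) * E i) N
        ≡⟨ cong (λ t → q * t + Σ< (λ i → suc i * #irreducible (suc i) * E i) N) (total-degree N n (ℕP.n≤1+n n)) ⟨
      q * (n * q ^ n) + Σ< (λ i → suc i * #irreducible (suc i) * E i) N ∎)
      where
      open ≡-Reasoning
      N : ℕ
      N = suc n
      E : ℕ → ℕ
      E i = Σ< (λ k → 𝟙 (suc k * suc i ≟ suc n)) N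
      shuffle : ∀ q n x → q * (n * x) + q * x ≡ suc n * (q * x)
      shuffle = solve-∀
      shuffle′ : ∀ a q s e → a * (q * s + e) ≡ q * (a * s) + a * e
      shuffle′ = solve-∀

    -- Bounds for the number of irreducible polynomials

    cofactors : ℕ → ℕ → ℕ
    cofactors n i = Σ< (λ k → 𝟙 (suc k * suc i ≟ suc n)) (suc n)

    #irreducible-upper : ∀ n → suc n * #irreducible (suc n) ≤ q ^ suc n
    #irreducible-upper n = begin
      suc n * #irreducible (suc n)
        ≡⟨ ℕP.*-identityʳ _ ⟨
      suc n * #irreducible (suc n) * 1
        ≡⟨ cong (suc n * #irreducible (suc n) *_) (𝟙-yes (1 * suc n ≟ suc n) (ℕP.*-identityˡ (suc n))) ⟨
      suc n * #irreducible (suc n) * 𝟙 (1 * suc n ≟ suc n)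
        ≤⟨ ℕP.*-monoʳ-≤ (suc n * #irreducible (suc n)) (Σ<-term (λ k → 𝟙 (suc k * suc n ≟ suc n)) {0} {suc n} (s≤s z≤n)) ⟩
      suc n * #irreducible (suc n) * cofactors n n
        ≤⟨ Σ<-term (λ i → suc i * #irreducible (suc i) * cofactors n i) (ℕP.n<1+n n) ⟩
      Σ< (λ i → suc i * #irreducible (suc i) * cofactors n i) (suc n)
        ≡⟨ gauss n ⟨
      q ^ suc n ∎
      where open ℕP.≤-Reasoning

    cofactors≤1 : ∀ n i → cofactors n i ≤ 1
    cofactors≤1 n i = Σ<-unique (λ k → suc k * suc i ≟ suc n) (suc n)
      (λ j k e e′ → ℕP.suc-injective (ℕP.*-cancelʳ-≡ (suc j) (suc k) (suc i) (trans e (sym e′))))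

    -- A proper divisor d = i + 1 satisfies 2d ≤ n + 1, so 2i + 1 ≤ n ≤ 2h and hence i < h.
    cofactors-proper : ∀ n h i → n ≤ h + h → i < n → cofactors n i ≤ 𝟙 (i ℕP.<? h)
    cofactors-proper n h i n≤2h i<n = split (i ℕP.<? h)
      where
      open ℕP.≤-Reasoning
      too-small : ∀ {k} → h ≤ i → ¬ (suc k * suc i ≡ suc n)
      too-small {zero}  h≤i e = ℕP.<⇒≢ i<n (ℕP.suc-injective (trans (sym (ℕP.*-identityˡ (suc i))) e))
      too-small {suc k} h≤i e = ℕP.<-irrefl refl (begin-strict
        suc n                ≤⟨ s≤s (ℕP.≤-trans n≤2h (ℕP.+-mono-≤ h≤i h≤i)) ⟩
        suc (i + i)          <⟨ ℕP.≤-reflexive (shuffle i) ⟩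
        suc i + suc i        ≤⟨ ℕP.+-monoʳ-≤ (suc i) (ℕP.m≤m+n (suc i) (k * suc i)) ⟩
        suc (suc k) * suc i  ≡⟨ e ⟩
        suc n                ∎)
        where
        shuffle : ∀ i → suc (suc (i + i)) ≡ suc i + suc i
        shuffle = solve-∀
      split : (d : Dec (i < h)) → cofactors n i ≤ 𝟙 d
      split (yes _)  = cofactors≤1 n i
      split (no i≮h) = ℕP.≤-reflexive (Σ<-zero (suc n) (λ k _ → 𝟙-no (suc k * suc i ≟ suc n) (too-small {k} (ℕP.≮⇒≥ i≮h))))

    -- In Gauss's formula a proper divisor d contributes d·I_d ≤ q^d by the upper bound, and all
    -- such d are at most h. Multiplied by p = q - 1, the geometric sum of the q^d is at most q·q^h.
    #irreducible-lower : ∀ p n h → q ≡ suc p → n ≤ h + h → p * q ^ suc n ≤ p * (suc n * #irreducible (suc n)) + q * q ^ h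
    #irreducible-lower p n h refl n≤2h = begin
      p * q ^ suc n
        ≡⟨ cong (p *_) (gauss n) ⟩
      p * (Σ< (λ i → suc i * #irreducible (suc i) * cofactors n i) n + suc n * #irreducible (suc n) * cofactors n n)
        ≤⟨ ℕP.*-monoʳ-≤ p (ℕP.+-mono-≤
             (Σ<-mono n (λ i i<n → ℕP.*-mono-≤ (#irreducible-upper i) (cofactors-proper n h i n≤2h i<n)))
             (ℕP.*-monoʳ-≤ (suc n * #irreducible (suc n)) (cofactors≤1 n n))) ⟩
      p * (Σ< (λ i → q ^ suc i * 𝟙 (i ℕP.<? h)) n + suc n * #irreducible (suc n) * 1)
        ≤⟨ ℕP.*-monoʳ-≤ p (ℕP.+-monoˡ-≤ (suc n * #irreducible (suc n) * 1) (Σ<-restrict (λ i → q ^ suc i) h n)) ⟩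
      p * (Σ< (λ i → q ^ suc i) h + suc n * #irreducible (suc n) * 1)
        ≡⟨ shuffle p (Σ< (λ i → q ^ suc i) h) (suc n * #irreducible (suc n)) ⟩
      p * (suc n * #irreducible (suc n)) + p * Σ< (λ i → q ^ suc i) h
        ≤⟨ ℕP.+-monoʳ-≤ (p * (suc n * #irreducible (suc n))) (ℕP.≤-trans (ℕP.m≤m+n _ (suc p)) (ℕP.≤-reflexive (geometric p h))) ⟩
      p * (suc n * #irreducible (suc n)) + q * q ^ h ∎
      where
      open ℕP.≤-Reasoning
      shuffle : ∀ p t x → p * (t + x * 1) ≡ p * x + p * t
      shuffle = solve-∀

open Counting
open import Data.Rational using (ℚ; 0ℚ; 1ℚ; ½; _+_; _*_; _-_; -_; ∣_∣; _≤_; _<_)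
open import Data.Rational.Properties
open import Data.Rational.Solver using (module +-*-Solver)
open +-*-Solver using (solve; _:+_; _:*_; _:-_; :-_; _:=_; con)

-- The value of ζ(2)

∑-cong : ∀ {f g} n → (∀ k → k <ℕ n → f k ≡ g k) → ∑ f n ≡ ∑ g n
∑-cong zero    h = refl
∑-cong (suc n) h = cong₂ _+_ (∑-cong n (λ k k<n → h k (ℕP.m<n⇒m<1+n k<n))) (h n (ℕP.n<1+n n))

∑-mono : ∀ {f g} n → (∀ k → k <ℕ n → f k ≤ g k) → ∑ f n ≤ ∑ g n
∑-mono zero    h = ≤-refl
∑-mono (suc n) h = +-mono-≤ (∑-mono n (λ k k<n → h k (ℕP.m<n⇒m<1+n k<n))) (h n (ℕP.n<1+n n))

∑-+ : ∀ f g n → ∑ (λ k → f k + g k) n ≡ ∑ f n + ∑ g n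
∑-+ f g zero    = refl
∑-+ f g (suc n) = trans (cong (_+ (f n + g n)) (∑-+ f g n))
  (solve 4 (λ a b c d → (a :+ b) :+ (c :+ d) := (a :+ c) :+ (b :+ d)) refl (∑ f n) (∑ g n) (f n) (g n))

∑-* : ∀ c f n → ∑ (λ k → c * f k) n ≡ c * ∑ f n
∑-* c f zero    = sym (*-zeroʳ c)
∑-* c f (suc n) = trans (cong (_+ c * f n) (∑-* c f n)) (sym (*-distribˡ-+ c (∑ f n) (f n)))

∑-first : ∀ f n → ∑ f (suc n) ≡ f 0 + ∑ (λ k → f (suc k)) n
∑-first f zero    = +-comm 0ℚ (f 0)
∑-first f (suc n) = trans (cong (_+ f (suc n)) (∑-first f n)) (+-assoc (f 0) _ (f (suc n)))

∑-reverse : ∀ f n → ∑ (λ k → f (n ∸ suc k)) n ≡ ∑ f n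
∑-reverse f zero    = refl
∑-reverse f (suc n) = trans (∑-first (λ k → f (n ∸ k)) n)
  (trans (cong (f n +_) (∑-reverse f n)) (+-comm (f n) (∑ f n)))

∑-split : ∀ f m n → ∑ f (m ℕ.+ n) ≡ ∑ f m + ∑ (λ k → f (m ℕ.+ k)) n
∑-split f m zero    = trans (cong (∑ f) (ℕP.+-identityʳ m)) (sym (+-identityʳ (∑ f m)))
∑-split f m (suc n) = trans (cong (∑ f) (ℕP.+-suc m n))
  (trans (cong (_+ f (m ℕ.+ n)) (∑-split f m n)) (+-assoc (∑ f m) _ (f (m ℕ.+ n))))

∣∑∣≤ : ∀ f n → ∣ ∑ f n ∣ ≤ ∑ (λ k → ∣ f k ∣) n
∣∑∣≤ f zero    = ≤-refl
∣∑∣≤ f (suc n) = ≤-trans (∣p+q∣≤∣p∣+∣q∣ (∑ f n) (f n)) (+-monoˡ-≤ ∣ f n ∣ (∣∑∣≤ f n))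

1/suc : ℕ → ℚ
1/suc k = ι (suc k) ⁻¹

1/suc-pos : ∀ k → 0ℚ < 1/suc k
1/suc-pos k = ⁻¹-pos (ι-suc-pos k)

0≤1/suc : ∀ k → 0ℚ ≤ 1/suc k
0≤1/suc k = <⇒≤ (1/suc-pos k)

1/suc-anti : ∀ {j k} → j ≤ℕ k → 1/suc k ≤ 1/suc j
1/suc-anti {j} j≤k = ⁻¹-anti (ι-suc-pos j) (ι-≤ (ℕ.s≤s j≤k))

∣sign∣ : ∀ k → ∣ sign k ∣ ≡ 1ℚ
∣sign∣ zero    = refl
∣sign∣ (suc k) = trans (∣-p∣≡∣p∣ (sign k)) (∣sign∣ k)

∣sign*∣ : ∀ k x → ∣ sign k * x ∣ ≡ ∣ x ∣
∣sign*∣ k x = trans (∣p*q∣≡∣p∣*∣q∣ (sign k) x) (trans (cong (_* ∣ x ∣) (∣sign∣ k)) (*-identityˡ ∣ x ∣))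

sign-square : ∀ k → sign k * sign k ≡ 1ℚ
sign-square zero    = refl
sign-square (suc k) = trans (solve 1 (λ s → :- s :* :- s := s :* s) refl (sign k)) (sign-square k)

sign-+ : ∀ m n → sign (m ℕ.+ n) ≡ sign m * sign n
sign-+ zero    n = sym (*-identityˡ (sign n))
sign-+ (suc m) n = trans (cong -_ (sign-+ m n)) (solve 2 (λ s t → :- (s :* t) := :- s :* t) refl (sign m) (sign n))

alternating : ℕ → ℕ → ℚ
alternating p = ∑ (λ i → sign i * 1/suc (p ℕ.+ i))

alternating-first : ∀ p c → alternating p (suc c) ≡ 1/suc p - alternating (suc p) c
alternating-first p c = begin-equality
  alternating p (suc c)
    ≡⟨ ∑-first (λ i → sign i * 1/suc (p ℕ.+ i)) c ⟩
  1ℚ * 1/suc (p ℕ.+ 0) + ∑ (λ i → - sign i * 1/suc (p ℕ.+ suc i)) c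
    ≡⟨ cong₂ _+_ (trans (*-identityˡ _) (cong 1/suc (ℕP.+-identityʳ p))) (∑-cong c λ i _ → term i) ⟩
  1/suc p + ∑ (λ i → (- 1ℚ) * (sign i * 1/suc (suc p ℕ.+ i))) c
    ≡⟨ cong (1/suc p +_) (∑-* (- 1ℚ) (λ i → sign i * 1/suc (suc p ℕ.+ i)) c) ⟩
  1/suc p + (- 1ℚ) * alternating (suc p) c
    ≡⟨ solve 2 (λ a b → a :+ (con (- 1ℚ)) :* b := a :- b) refl (1/suc p) (alternating (suc p) c) ⟩
  1/suc p - alternating (suc p) c ∎
  where
  open ≤-Reasoning
  term : ∀ i → - sign i * 1/suc (p ℕ.+ suc i) ≡ (- 1ℚ) * (sign i * 1/suc (suc p ℕ.+ i))
  term i = trans (cong (λ k → - sign i * 1/suc k) (ℕP.+-suc p i))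
    (solve 2 (λ s x → :- s :* x := con (- 1ℚ) :* (s :* x)) refl (sign i) (1/suc (suc p ℕ.+ i)))

-- The usual estimate for alternating decreasing terms: by `alternating-first`, the sum is its first
-- term minus a sum of the same kind.
alternating-bounds : ∀ c p → 0ℚ ≤ alternating p c × alternating p c ≤ 1/suc p
alternating-bounds zero    p = ≤-refl , 0≤1/suc p
alternating-bounds (suc c) p = subst (λ t → 0ℚ ≤ t × t ≤ 1/suc p) (sym (alternating-first p c)) (step (alternating-bounds c (suc p)))
  where
  A : ℚ
  A = alternating (suc p) c
  step : 0ℚ ≤ A × A ≤ 1/suc (suc p) → 0ℚ ≤ 1/suc p - A × 1/suc p - A ≤ 1/suc p
  step (lo , hi) = ≤-trans (≤-reflexive (sym (+-inverseʳ A))) (+-monoˡ-≤ (- A) (≤-trans hi (1/suc-anti (ℕP.n≤1+n p))))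
    , ≤-trans (+-monoʳ-≤ (1/suc p) (neg-antimono-≤ lo)) (≤-reflexive (+-identityʳ (1/suc p)))

-- Borwein's proof squares the symmetric sum of (-1)ⁿ/(2n+1) over -N ≤ n < N. Partial fractions turn the
-- off-diagonal products with a given n into a sum of ±1/(m-n) over m ≠ n, in which j and -j cancel, leaving
-- one alternating block of 2n+1 terms.
odd-sum : ℕ → ℚ
odd-sum = ∑ λ n → sign n * 1/suc (2 ℕ.* n)

odd-squares : ℕ → ℚ
odd-squares = ∑ λ n → 1/suc (2 ℕ.* n) * 1/suc (2 ℕ.* n)

-- The surviving terms ±1/j, with j running from N - n to N + n and a plus at both ends.
block : ℕ → ℕ → ℚ
block N n = alternating (N ∸ suc n) (suc (2 ℕ.* n))

-- Up to the factor -(-1)^N this is half the off-diagonal part of the squared symmetric sum; that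
-- sum is twice `odd-sum`.
defect : ℕ → ℚ
defect N = ∑ (λ n → sign n * (1/suc (2 ℕ.* n) * block N n)) N

-- The square of the Leibniz sum

inverse-identity : ∀ p c o m P C O M → p * P ≡ 1ℚ → c * C ≡ 1ℚ → o * O ≡ 1ℚ → m * M ≡ 1ℚ →
  c ≡ p + o → m ≡ c + p → O * (P + C) + M * (C - P) ≡ ι 4 * (O * M)
inverse-identity p c o m P C O M pP cC oO mM refl refl = begin-equality
  O * (P + C) + M * (C - P)
    -- With P = 1/p and so on, the left side is (m/o - o/m)/(p·c), and m² - o² = (m - o)(m + o) =
    -- 2p·2c. The ring solver knows no inverses, so products such as m·M are inserted for 1 until
    -- every term carries the same inverses.
    ≡⟨ solve 4 (λ P C O M → O :* (P :+ C) :+ M :* (C :- P) :=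
         (O :* con 1ℚ) :* (P :* con 1ℚ :+ C :* con 1ℚ) :+ (M :* con 1ℚ) :* (C :* con 1ℚ :- P :* con 1ℚ)) refl P C O M ⟩
  (O * 1ℚ) * (P * 1ℚ + C * 1ℚ) + (M * 1ℚ) * (C * 1ℚ - P * 1ℚ)
    ≡⟨ cong₂ _+_ (cong₂ (λ u v → (O * u) * v) (sym mM) (cong₂ (λ u v → P * u + C * v) (sym cC) (sym pP)))
                 (cong₂ (λ u v → (M * u) * v) (sym oO) (cong₂ (λ u v → C * u - P * v) (sym pP) (sym cC))) ⟩
  (O * (m * M)) * (P * (c * C) + C * (p * P)) + (M * (o * O)) * (C * (p * P) - P * (c * C))
    ≡⟨ solve 6 (λ p o P C O M →
          (O :* (((p :+ o) :+ p) :* M)) :* (P :* ((p :+ o) :* C) :+ C :* (p :* P)) :+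
          (M :* (o :* O)) :* (C :* (p :* P) :- P :* ((p :+ o) :* C))
          := con (ι 4) :* (((p :* P) :* ((p :+ o) :* C)) :* (O :* M))) refl p o P C O M ⟩
  ι 4 * (((p * P) * (c * C)) * (O * M))
    ≡⟨ cong₂ (λ u v → ι 4 * ((u * v) * (O * M))) pP cC ⟩
  ι 4 * ((1ℚ * 1ℚ) * (O * M))
    ≡⟨ cong (ι 4 *_) (*-identityˡ (O * M)) ⟩
  ι 4 * (O * M) ∎
  where open ≤-Reasoning

1/suc-inverse : ∀ k → ι (suc k) * 1/suc k ≡ 1ℚ
1/suc-inverse = ι-⁻¹-*

-- The instance p = N - n, c = N + n + 1, o = 2n + 1, m = 2N + 1, with N given as n + d + 1 so that
-- no subtraction occurs.
1/suc-identity : ∀ d n → let N = suc (n ℕ.+ d) in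
  1/suc (2 ℕ.* n) * (1/suc d + 1/suc (N ℕ.+ n)) + 1/suc (2 ℕ.* N) * (1/suc (N ℕ.+ n) - 1/suc d) ≡ ι 4 * (1/suc (2 ℕ.* n) * 1/suc (2 ℕ.* N))
1/suc-identity d n = inverse-identity (ι (suc d)) (ι (suc (N ℕ.+ n))) (ι (suc (2 ℕ.* n))) (ι (suc (2 ℕ.* N)))
  (1/suc d) (1/suc (N ℕ.+ n)) (1/suc (2 ℕ.* n)) (1/suc (2 ℕ.* N)) (1/suc-inverse d) (1/suc-inverse (N ℕ.+ n)) (1/suc-inverse (2 ℕ.* n)) (1/suc-inverse (2 ℕ.* N))
  (trans (cong ι (e₁ d n)) (ι-+ (suc d) (suc (2 ℕ.* n)))) (trans (cong ι (e₂ d n)) (ι-+ (suc (N ℕ.+ n)) (suc d)))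
  where
  N = suc (n ℕ.+ d)
  e₁ : ∀ d n → suc (suc (n ℕ.+ d) ℕ.+ n) ≡ suc d ℕ.+ suc (2 ℕ.* n)
  e₁ = solve-∀
  e₂ : ∀ d n → suc (2 ℕ.* suc (n ℕ.+ d)) ≡ suc (suc (n ℕ.+ d) ℕ.+ n) ℕ.+ suc d
  e₂ = solve-∀

1/suc-identity′ : ∀ {n N} → n <ℕ N →
  1/suc (2 ℕ.* n) * (1/suc (N ∸ suc n) + 1/suc (N ℕ.+ n)) + 1/suc (2 ℕ.* N) * (1/suc (N ℕ.+ n) - 1/suc (N ∸ suc n)) ≡ ι 4 * (1/suc (2 ℕ.* n) * 1/suc (2 ℕ.* N))
1/suc-identity′ {n} {N} n<N = subst (λ K → 1/suc (2 ℕ.* n) * (1/suc (N ∸ suc n) + 1/suc (K ℕ.+ n)) + 1/suc (2 ℕ.* K) * (1/suc (K ℕ.+ n) - 1/suc (N ∸ suc n)) ≡ ι 4 * (1/suc (2 ℕ.* n) * 1/suc (2 ℕ.* K)))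
  (ℕP.m+[n∸m]≡n n<N) (1/suc-identity (N ∸ suc n) n)

-- The window from N - n to N + n slides by one place. Common terms get opposite signs and cancel in
-- the sum of the two blocks; the odd length leaves both outer terms, 1/(N - n) and 1/(N + n + 1),
-- with a plus.
block-step : ∀ {n N} → n <ℕ N → block (suc N) n ≡ (1/suc (N ∸ suc n) + 1/suc (N ℕ.+ n)) - block N n
block-step {n} {N} n<N = begin-equality
  alternating (N ∸ n) (suc (2 ℕ.* n))
    ≡⟨ cong (λ k → alternating k (suc (2 ℕ.* n))) (ℕP.+-∸-assoc 1 n<N) ⟩
  alternating (suc p) (suc (2 ℕ.* n))
    ≡⟨ solve 2 (λ a b → a := b :- (b :- a)) refl (alternating (suc p) (suc (2 ℕ.* n))) (1/suc p) ⟩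
  1/suc p - (1/suc p - alternating (suc p) (suc (2 ℕ.* n)))
    ≡⟨ cong (λ t → 1/suc p - t) (alternating-first p (suc (2 ℕ.* n))) ⟨
  1/suc p - (block N n + - sign (2 ℕ.* n) * 1/suc (p ℕ.+ suc (2 ℕ.* n)))
    ≡⟨ cong₂ (λ s k → 1/suc p - (block N n + - s * 1/suc k)) even index ⟩
  1/suc p - (block N n + - 1ℚ * 1/suc (N ℕ.+ n))
    ≡⟨ solve 3 (λ a b c → a :- (b :+ con (- 1ℚ) :* c) := (a :+ c) :- b) refl (1/suc p) (block N n) (1/suc (N ℕ.+ n)) ⟩
  (1/suc p + 1/suc (N ℕ.+ n)) - block N n ∎
  where
  open ≤-Reasoning
  p = N ∸ suc n
  even : sign (2 ℕ.* n) ≡ 1ℚ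
  even = trans (cong (λ k → sign (n ℕ.+ k)) (ℕP.+-identityʳ n)) (trans (sign-+ n n) (sign-square n))
  shuffle : ∀ p n → p ℕ.+ suc (2 ℕ.* n) ≡ (suc n ℕ.+ p) ℕ.+ n
  shuffle = solve-∀
  index : p ℕ.+ suc (2 ℕ.* n) ≡ N ℕ.+ n
  index = trans (shuffle p n) (cong (ℕ._+ n) (ℕP.m+[n∸m]≡n n<N))

sign-∸ : ∀ {n N} → n <ℕ N → sign (N ∸ suc n) ≡ - (sign N * sign n)
sign-∸ {n} {N} n<N = begin-equality
  sign p                            ≡⟨ *-identityˡ (sign p) ⟨
  1ℚ * sign p                       ≡⟨ cong (_* sign p) (sign-square n) ⟨
  sign n * sign n * sign p          ≡⟨ solve 2 (λ s t → s :* s :* t := :- (:- (s :* t) :* s)) refl (sign n) (sign p) ⟩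
  - (- (sign n * sign p) * sign n)  ≡⟨ cong (λ t → - (- t * sign n)) (sign-+ n p) ⟨
  - (sign (suc n ℕ.+ p) * sign n)   ≡⟨ cong (λ k → - (sign k * sign n)) (ℕP.m+[n∸m]≡n n<N) ⟩
  - (sign N * sign n)               ∎
  where
  open ≤-Reasoning
  p = N ∸ suc n

-- For n = N the window starts at 1. Its denominators are paired as N - n with N + n + 1 for n < N,
-- and 2N + 1 is left over.
block-last : ∀ N → block (suc N) N ≡ ∑ (λ n → sign N * sign n * (1/suc (N ℕ.+ n) - 1/suc (N ∸ suc n))) N + 1/suc (2 ℕ.* N)
block-last N = begin-equality
  alternating (N ∸ N) (suc (2 ℕ.* N))
    ≡⟨ cong₂ alternating (ℕP.n∸n≡0 N) (trans (cong (λ k → suc (N ℕ.+ k)) (ℕP.+-identityʳ N)) (sym (ℕP.+-suc N N))) ⟩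
  alternating 0 (N ℕ.+ suc N)
    ≡⟨ ∑-split f N (suc N) ⟩
  ∑ f N + (∑ (λ n → f (N ℕ.+ n)) N + f (N ℕ.+ N))
    ≡⟨ cong₂ (λ u v → u + (∑ (λ n → f (N ℕ.+ n)) N + v)) (sym (∑-reverse f N)) last ⟩
  ∑ (λ n → f (N ∸ suc n)) N + (∑ (λ n → f (N ℕ.+ n)) N + 1/suc (2 ℕ.* N))
    ≡⟨ +-assoc (∑ (λ n → f (N ∸ suc n)) N) _ _ ⟨
  (∑ (λ n → f (N ∸ suc n)) N + ∑ (λ n → f (N ℕ.+ n)) N) + 1/suc (2 ℕ.* N)
    ≡⟨ cong (_+ 1/suc (2 ℕ.* N)) (∑-+ (λ n → f (N ∸ suc n)) (λ n → f (N ℕ.+ n)) N) ⟨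
  ∑ (λ n → f (N ∸ suc n) + f (N ℕ.+ n)) N + 1/suc (2 ℕ.* N)
    ≡⟨ cong (_+ 1/suc (2 ℕ.* N)) (∑-cong N term) ⟩
  ∑ (λ n → sign N * sign n * (1/suc (N ℕ.+ n) - 1/suc (N ∸ suc n))) N + 1/suc (2 ℕ.* N) ∎
  where
  open ≤-Reasoning
  f : ℕ → ℚ
  f i = sign i * 1/suc i
  last : f (N ℕ.+ N) ≡ 1/suc (2 ℕ.* N)
  last = trans (cong₂ _*_ (trans (sign-+ N N) (sign-square N)) (cong (λ k → 1/suc (N ℕ.+ k)) (sym (ℕP.+-identityʳ N)))) (*-identityˡ _)
  term : ∀ n → n <ℕ N → f (N ∸ suc n) + f (N ℕ.+ n) ≡ sign N * sign n * (1/suc (N ℕ.+ n) - 1/suc (N ∸ suc n))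
  term n n<N = trans (cong₂ (λ s t → s * 1/suc (N ∸ suc n) + t * 1/suc (N ℕ.+ n)) (sign-∸ n<N) (sign-+ N n))
    (solve 4 (λ S s a b → :- (S :* s) :* a :+ (S :* s) :* b := S :* s :* (b :- a)) refl (sign N) (sign n) (1/suc (N ∸ suc n)) (1/suc (N ℕ.+ n)))

-- In the sum of consecutive defects the old blocks cancel by `block-step`. The pairs of the new
-- block join the remaining end terms, and for each n `1/suc-identity′` condenses them to 4/((2n +
-- 1)(2N + 1)).
defect-step : ∀ N → defect (suc N) + defect N ≡ ι 4 * (odd-sum N * 1/suc (2 ℕ.* N)) + sign N * (1/suc (2 ℕ.* N) * 1/suc (2 ℕ.* N))
defect-step N = begin-equality
  (∑ (λ n → sign n * (1/suc (2 ℕ.* n) * block (suc N) n)) N + S * (R * block (suc N) N)) + defect N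
    ≡⟨ cong (λ t → (∑ (λ n → sign n * (1/suc (2 ℕ.* n) * block (suc N) n)) N + t) + defect N)
         (trans (cong (λ t → S * (R * t)) (block-last N)) distribute) ⟩
  (∑ (λ n → sign n * (1/suc (2 ℕ.* n) * block (suc N) n)) N + (∑ (λ n → S * R * G n) N + S * (R * R))) + defect N
    ≡⟨ solve 4 (λ a b c d → (a :+ (b :+ c)) :+ d := ((a :+ b) :+ d) :+ c) refl
         (∑ (λ n → sign n * (1/suc (2 ℕ.* n) * block (suc N) n)) N) (∑ (λ n → S * R * G n) N) (S * (R * R)) (defect N) ⟩
  ((∑ (λ n → sign n * (1/suc (2 ℕ.* n) * block (suc N) n)) N + ∑ (λ n → S * R * G n) N) + defect N) + S * (R * R)
    ≡⟨ cong (_+ S * (R * R)) (trans (cong (_+ defect N) (sym (∑-+ _ _ N))) (sym (∑-+ _ _ N))) ⟩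
  ∑ (λ n → (sign n * (1/suc (2 ℕ.* n) * block (suc N) n) + S * R * G n) + sign n * (1/suc (2 ℕ.* n) * block N n)) N + S * (R * R)
    ≡⟨ cong (_+ S * (R * R)) (∑-cong N term) ⟩
  ∑ (λ n → ι 4 * R * (sign n * 1/suc (2 ℕ.* n))) N + S * (R * R)
    ≡⟨ cong (_+ S * (R * R)) (trans (∑-* (ι 4 * R) _ N) (solve 3 (λ f R L → f :* R :* L := f :* (L :* R)) refl (ι 4) R (odd-sum N))) ⟩
  ι 4 * (odd-sum N * R) + S * (R * R) ∎
  where
  open ≤-Reasoning
  S R : ℚ
  S = sign N
  R = 1/suc (2 ℕ.* N)
  G : ℕ → ℚ
  G n = S * sign n * (1/suc (N ℕ.+ n) - 1/suc (N ∸ suc n))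
  distribute : S * (R * (∑ G N + R)) ≡ ∑ (λ n → S * R * G n) N + S * (R * R)
  distribute = trans (solve 3 (λ S R g → S :* (R :* (g :+ R)) := S :* R :* g :+ S :* (R :* R)) refl S R (∑ G N))
    (cong (_+ S * (R * R)) (sym (∑-* (S * R) G N)))
  algebra : ∀ S s O P C M B → S * S ≡ 1ℚ → O * (P + C) + M * (C - P) ≡ ι 4 * (O * M) →
    (s * (O * ((P + C) - B)) + S * M * (S * s * (C - P))) + s * (O * B) ≡ ι 4 * M * (s * O)
  algebra S s O P C M B SS e = begin-equality
    (s * (O * ((P + C) - B)) + S * M * (S * s * (C - P))) + s * (O * B)
      ≡⟨ solve 7 (λ S s O P C M B → (s :* (O :* ((P :+ C) :- B)) :+ S :* M :* (S :* s :* (C :- P))) :+ s :* (O :* B)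
            := s :* (O :* (P :+ C)  :+ (S :* S) :* (M :* (C :- P)))) refl S s O P C M B ⟩
    s * (O * (P + C) + (S * S) * (M * (C - P)))
      ≡⟨ cong (λ t → s * (O * (P + C) + t)) (trans (cong (_* (M * (C - P))) SS) (*-identityˡ _)) ⟩
    s * (O * (P + C) + M * (C - P))
      ≡⟨ cong (s *_) e ⟩
    s * (ι 4 * (O * M))
      ≡⟨ solve 4 (λ s f O M → s :* (f :* (O :* M)) := f :* M :* (s :* O)) refl s (ι 4) O M ⟩
    ι 4 * M * (s * O) ∎
  term : ∀ n → n <ℕ N → (sign n * (1/suc (2 ℕ.* n) * block (suc N) n) + S * R * G n) + sign n * (1/suc (2 ℕ.* n) * block N n) ≡ ι 4 * R * (sign n * 1/suc (2 ℕ.* n))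
  term n n<N = trans
    (cong (λ t → (sign n * (1/suc (2 ℕ.* n) * t) + S * R * G n) + sign n * (1/suc (2 ℕ.* n) * block N n)) (block-step n<N))
    (algebra S (sign n) (1/suc (2 ℕ.* n)) (1/suc (N ∸ suc n)) (1/suc (N ℕ.+ n)) R (block N n) (sign-square N) (1/suc-identity′ n<N))

-- No double sum is rearranged: induction on N compares increments. With R = 1/(2N + 1), both sides
-- grow by 4·(-1)^N·`odd-sum N`·R + 2R², the right one through `defect-step`.
odd-square-defect : ∀ N → ι 2 * (odd-sum N * odd-sum N) ≡ odd-squares N - sign N * defect N
odd-square-defect zero    = refl
odd-square-defect (suc N) = begin-equality
  ι 2 * ((L + S * R) * (L + S * R))
    ≡⟨ solve 3 (λ L S R → con (ι 2) :* ((L :+ S :* R) :* (L :+ S :* R)) :=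
          con (ι 2) :* (L :* L) :+ (con (ι 4) :* (S :* (L :* R)) :+ con (ι 2) :* ((S :* S) :* (R :* R)))) refl L S R ⟩
  ι 2 * (L * L) + (ι 4 * (S * (L * R)) + ι 2 * ((S * S) * (R * R)))
    ≡⟨ cong₂ (λ t u → t + (ι 4 * (S * (L * R)) + ι 2 * (u * (R * R)))) (odd-square-defect N) (sign-square N) ⟩
  (B - S * defect N) + (ι 4 * (S * (L * R)) + ι 2 * (1ℚ * (R * R)))
    ≡⟨ solve 5 (λ B S D L R → (B :- S :* D) :+ (con (ι 4) :* (S :* (L :* R)) :+ con (ι 2) :* (con 1ℚ :* (R :* R)))
          := (B :+ R :* R) :+ ((:- S :* D :+ con (ι 4) :* (S :* (L :* R))) :+ con 1ℚ :* (R :* R))) refl B S (defect N) L R ⟩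
  (B + R * R) + ((- S * defect N + ι 4 * (S * (L * R))) + 1ℚ * (R * R))
    ≡⟨ cong (λ u → (B + R * R) + ((- S * defect N + ι 4 * (S * (L * R))) + u * (R * R))) (sign-square N) ⟨
  (B + R * R) + ((- S * defect N + ι 4 * (S * (L * R))) + S * S * (R * R))
    ≡⟨ solve 5 (λ Q S D L R → Q :+ ((:- S :* D :+ con (ι 4) :* (S :* (L :* R))) :+ S :* S :* (R :* R))
          := Q :+ (S :* ((con (ι 4) :* (L :* R) :+ S :* (R :* R)) :- D))) refl (B + R * R) S (defect N) L R ⟩
  (B + R * R) + S * ((ι 4 * (L * R) + S * (R * R)) - defect N)
    ≡⟨ cong (λ t → (B + R * R) + S * (t - defect N)) (defect-step N) ⟨
  (B + R * R) + S * ((defect (suc N) + defect N) - defect N)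
    ≡⟨ solve 4 (λ Q S E D → Q :+ S :* ((E :+ D) :- D) := Q :- (:- S :* E)) refl (B + R * R) S (defect (suc N)) (defect N) ⟩
  (B + R * R) - (- S * defect (suc N)) ∎
  where
  open ≤-Reasoning
  L S R B : ℚ
  L = odd-sum N
  S = sign N
  R = 1/suc (2 ℕ.* N)
  B = odd-squares N

-- The defect tends to zero

harmonic : ℕ → ℚ
harmonic = ∑ 1/suc

-- Partial fractions: 2N + 1 = (2n + 1) + 2(N - n) splits 1/((2n + 1)(N - n)) into (1/(N - n) +
-- 2/(2n + 1))/(2N + 1), after which odd denominators are replaced by smaller ones.
odd-product-bound : ∀ {n N} → n <ℕ N → 1/suc (2 ℕ.* n) * 1/suc (N ∸ suc n) ≤ 1/suc N * (1/suc (N ∸ suc n) + ι 2 * 1/suc n)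
odd-product-bound {n} {N} n<N = begin
  O * P                                    ≡⟨ *-identityʳ (O * P) ⟨
  (O * P) * 1ℚ                             ≡⟨ cong ((O * P) *_) (1/suc-inverse (2 ℕ.* N)) ⟨
  (O * P) * (ι (suc (2 ℕ.* N)) * M)        ≡⟨ cong (λ t → (O * P) * (t * M)) sum ⟩
  (O * P) * ((o + ι 2 * p) * M)            ≡⟨ solve 5 (λ O P o p M → (O :* P) :* ((o :+ con (ι 2) :* p) :* M)
                                              := M :* ((o :* O) :* P :+ con (ι 2) :* ((p :* P) :* O))) refl O P o p M ⟩
  M * ((o * O) * P + ι 2 * ((p * P) * O))  ≡⟨ cong₂ (λ u v → M * (u * P + ι 2 * (v * O))) (1/suc-inverse (2 ℕ.* n)) (1/suc-inverse (N ∸ suc n)) ⟩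
  M * (1ℚ * P + ι 2 * (1ℚ * O))            ≡⟨ cong₂ (λ u v → M * (u + ι 2 * v)) (*-identityˡ P) (*-identityˡ O) ⟩
  M * (P + ι 2 * O)                        ≤⟨ *-mono (+-mono-≤ (0≤1/suc (N ∸ suc n)) (*-nonNeg (0≤ι 2) (0≤1/suc (2 ℕ.* n)))) (0≤1/suc N)
                                              (1/suc-anti (ℕP.m≤m+n N _)) (+-monoʳ-≤ P (*-monoˡ (0≤ι 2) (1/suc-anti (ℕP.m≤m+n n _)))) ⟩
  1/suc N * (P + ι 2 * 1/suc n)            ∎
  where
  open ≤-Reasoning
  O P M o p : ℚ
  O = 1/suc (2 ℕ.* n)
  P = 1/suc (N ∸ suc n)
  M = 1/suc (2 ℕ.* N)
  o = ι (suc (2 ℕ.* n))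
  p = ι (suc (N ∸ suc n))
  shuffle : ∀ d n → suc (2 ℕ.* (suc n ℕ.+ d)) ≡ suc (2 ℕ.* n) ℕ.+ 2 ℕ.* suc d
  shuffle = solve-∀
  sum : ι (suc (2 ℕ.* N)) ≡ o + ι 2 * p
  sum = trans (cong ι (trans (cong (λ k → suc (2 ℕ.* k)) (sym (ℕP.m+[n∸m]≡n n<N))) (shuffle (N ∸ suc n) n)))
    (trans (ι-+ (suc (2 ℕ.* n)) _) (cong (o +_) (ι-* 2 (suc (N ∸ suc n)))))

defect-bound : ∀ N → ∣ defect N ∣ ≤ ι 3 * (1/suc N * harmonic N)
defect-bound N = begin
  ∣ defect N ∣
    ≤⟨ ∣∑∣≤ _ N ⟩
  ∑ (λ n → ∣ sign n * (1/suc (2 ℕ.* n) * block N n) ∣) N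
    ≤⟨ ∑-mono N term ⟩
  ∑ (λ n → 1/suc N * (1/suc (N ∸ suc n) + ι 2 * 1/suc n)) N
    ≡⟨ ∑-* (1/suc N) _ N ⟩
  1/suc N * ∑ (λ n → 1/suc (N ∸ suc n) + ι 2 * 1/suc n) N
    ≡⟨ cong (1/suc N *_) (trans (∑-+ _ _ N) (cong₂ _+_ (∑-reverse 1/suc N) (∑-* (ι 2) 1/suc N))) ⟩
  1/suc N * (harmonic N + ι 2 * harmonic N)
    ≡⟨ solve 2 (λ a h → a :* (h :+ con (ι 2) :* h) := con (ι 3) :* (a :* h)) refl (1/suc N) (harmonic N) ⟩
  ι 3 * (1/suc N * harmonic N) ∎
  where
  open ≤-Reasoning
  term : ∀ n → n <ℕ N → ∣ sign n * (1/suc (2 ℕ.* n) * block N n) ∣ ≤ 1/suc N * (1/suc (N ∸ suc n) + ι 2 * 1/suc n)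
  term n n<N = begin
    ∣ sign n * (1/suc (2 ℕ.* n) * block N n) ∣     ≡⟨ ∣sign*∣ n _ ⟩
    ∣ 1/suc (2 ℕ.* n) * block N n ∣                ≡⟨ 0≤p⇒∣p∣≡p (*-nonNeg (0≤1/suc (2 ℕ.* n)) (proj₁ bounds)) ⟩
    1/suc (2 ℕ.* n) * block N n                    ≤⟨ *-monoˡ (0≤1/suc (2 ℕ.* n)) (proj₂ bounds) ⟩
    1/suc (2 ℕ.* n) * 1/suc (N ∸ suc n)            ≤⟨ odd-product-bound n<N ⟩
    1/suc N * (1/suc (N ∸ suc n) + ι 2 * 1/suc n)  ∎
    where
    bounds : 0ℚ ≤ block N n × block N n ≤ 1/suc (N ∸ suc n)
    bounds = alternating-bounds (suc (2 ℕ.* n)) (N ∸ suc n)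

-- A substitute for the logarithm: the first M terms are at most 1, the others at most 1/(M + 1).
-- Choosing M before N makes `harmonic N` of smaller order than N.
harmonic-bound : ∀ M N → harmonic N ≤ ι M + ι N * 1/suc M
harmonic-bound M N = [ small , (λ M≤N → subst (λ K → harmonic K ≤ ι M + ι K * 1/suc M) (ℕP.m+[n∸m]≡n M≤N) (large (N ∸ M))) ]′ (ℕP.≤-total N M)
  where
  open ≤-Reasoning
  crude : ∀ N → harmonic N ≤ ι N
  crude zero    = ≤-refl
  crude (suc N) = ≤-trans (+-mono-≤ (crude N) (1/suc-anti {0} {N} ℕ.z≤n)) (≤-reflexive (trans (+-comm (ι N) 1ℚ) (sym (ι-+ 1 N))))
  small : N ≤ℕ M → harmonic N ≤ ι M + ι N * 1/suc M
  small N≤M = begin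
    harmonic N           ≤⟨ ≤-trans (crude N) (ι-≤ N≤M) ⟩
    ι M                  ≡⟨ +-identityʳ (ι M) ⟨
    ι M + 0ℚ             ≤⟨ +-monoʳ-≤ (ι M) (*-nonNeg (0≤ι N) (0≤1/suc M)) ⟩
    ι M + ι N * 1/suc M  ∎
  large : ∀ j → harmonic (M ℕ.+ j) ≤ ι M + ι (M ℕ.+ j) * 1/suc M
  large zero = subst (λ K → harmonic K ≤ ι M + ι K * 1/suc M) (sym (ℕP.+-identityʳ M))
    (≤-trans (crude M) (≤-trans (≤-reflexive (sym (+-identityʳ (ι M)))) (+-monoʳ-≤ (ι M) (*-nonNeg (0≤ι M) (0≤1/suc M)))))
  large (suc j) = begin
    harmonic (M ℕ.+ suc j)           ≡⟨ cong harmonic (ℕP.+-suc M j) ⟩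
    harmonic K + 1/suc K             ≤⟨ +-mono-≤ (large j) (1/suc-anti (ℕP.m≤m+n M j)) ⟩
    (ι M + ι K * 1/suc M) + 1/suc M  ≡⟨ solve 3 (λ m k x → (m :+ k :* x) :+ x := m :+ (con 1ℚ :+ k) :* x) refl (ι M) (ι K) (1/suc M) ⟩
    ι M + (1ℚ + ι K) * 1/suc M       ≡⟨ cong (λ t → ι M + t * 1/suc M) (ι-+ 1 K) ⟨
    ι M + ι (suc K) * 1/suc M        ≡⟨ cong (λ k → ι M + ι k * 1/suc M) (ℕP.+-suc M j) ⟨
    ι M + ι (M ℕ.+ suc j) * 1/suc M  ∎
    where
    K : ℕ
    K = M ℕ.+ j

harmonic-small : ∀ ε → 0ℚ < ε → ∃ λ N → ∀ n → N ≤ℕ n → 1/suc n * harmonic n ≤ ε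
harmonic-small ε 0<ε = choose (ι⁻¹-archimedean (½ * ε) (½-pos 0<ε))
  where
  open ≤-Reasoning
  choose : (∃ λ M → ∀ n → M ≤ℕ n → 1/suc n ≤ ½ * ε) → ∃ λ N → ∀ n → N ≤ℕ n → 1/suc n * harmonic n ≤ ε
  choose (M , hM) = choose′ (scaled-archimedean (ι (suc M)) (½ * ε) (ι-suc-pos M) (½-pos 0<ε))
    where
    choose′ : (∃ λ N → ∀ n → N ≤ℕ n → ι (suc M) * 1/suc n ≤ ½ * ε) → ∃ λ N → ∀ n → N ≤ℕ n → 1/suc n * harmonic n ≤ ε
    choose′ (N , hN) = N , λ n N≤n → begin
      1/suc n * harmonic n                                   ≤⟨ *-monoˡ (0≤1/suc n) (harmonic-bound M n) ⟩
      1/suc n * (ι M + ι n * 1/suc M)                        ≤⟨ *-monoˡ (0≤1/suc n) (+-mono-≤ (ι-≤ (ℕP.n≤1+n M)) (*-monoʳ (0≤1/suc M) (ι-≤ (ℕP.n≤1+n n)))) ⟩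
      1/suc n * (ι (suc M) + ι (suc n) * 1/suc M)            ≡⟨ solve 4 (λ x m k y → x :* (m :+ k :* y) := m :* x :+ (k :* x) :* y) refl (1/suc n) (ι (suc M)) (ι (suc n)) (1/suc M) ⟩
      ι (suc M) * 1/suc n + (ι (suc n) * 1/suc n) * 1/suc M  ≡⟨ cong (λ t → ι (suc M) * 1/suc n + t * 1/suc M) (1/suc-inverse n) ⟩
      ι (suc M) * 1/suc n + 1ℚ * 1/suc M                     ≤⟨ +-mono-≤ (hN n N≤n) (≤-trans (≤-reflexive (*-identityˡ (1/suc M))) (hM M ℕP.≤-refl)) ⟩
      ½ * ε + ½ * ε                                          ≡⟨ halves ε ⟩
      ε                                                      ∎

inverse-unique : ∀ a x y → a * x ≡ 1ℚ → a * y ≡ 1ℚ → x ≡ y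
inverse-unique a x y ax ay = begin-equality
  x            ≡⟨ *-identityʳ x ⟨
  x * 1ℚ       ≡⟨ cong (x *_) ay ⟨
  x * (a * y)  ≡⟨ solve 3 (λ a x y → x :* (a :* y) := y :* (a :* x)) refl a x y ⟩
  y * (a * x)  ≡⟨ cong (y *_) ax ⟩
  y * 1ℚ       ≡⟨ *-identityʳ y ⟩
  y            ∎
  where open ≤-Reasoning

-- From odd squares to all squares

ζ₂-term : ℕ → ℚ
ζ₂-term k = ι (suc k ℕ.^ 2) ⁻¹

ζ₂ : ℕ → ℚ
ζ₂ = ∑ ζ₂-term

ζ₂-term≡1/suc² : ∀ k → ζ₂-term k ≡ 1/suc k * 1/suc k
ζ₂-term≡1/suc² k = inverse-unique (ι (suc k ℕ.^ 2)) (ζ₂-term k) (1/suc k * 1/suc k) (*-⁻¹ (ι-square-pos k)) (begin-equality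
  ι (suc k ℕ.^ 2) * (1/suc k * 1/suc k)          ≡⟨ cong (_* (1/suc k * 1/suc k)) (ι-square k) ⟩
  (ι (suc k) * ι (suc k)) * (1/suc k * 1/suc k)  ≡⟨ solve 2 (λ a x → (a :* a) :* (x :* x) := (a :* x) :* (a :* x)) refl (ι (suc k)) (1/suc k) ⟩
  (ι (suc k) * 1/suc k) * (ι (suc k) * 1/suc k)  ≡⟨ cong (λ t → t * t) (1/suc-inverse k) ⟩
  1ℚ                                             ∎)
  where open ≤-Reasoning

1/suc-double : ∀ k → 1/suc (suc (2 ℕ.* k)) ≡ ½ * 1/suc k
1/suc-double k = inverse-unique (ι (suc (suc (2 ℕ.* k)))) (1/suc (suc (2 ℕ.* k))) (½ * 1/suc k) (1/suc-inverse (suc (2 ℕ.* k))) (begin-equality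
  ι (suc (suc (2 ℕ.* k))) * (½ * 1/suc k)  ≡⟨ cong (λ n → ι n * (½ * 1/suc k)) (index k) ⟩
  ι (2 ℕ.* suc k) * (½ * 1/suc k)          ≡⟨ cong (_* (½ * 1/suc k)) (ι-* 2 (suc k)) ⟩
  (ι 2 * ι (suc k)) * (½ * 1/suc k)        ≡⟨ solve 2 (λ a x → (con (ι 2) :* a) :* (con ½ :* x) := a :* x) refl (ι (suc k)) (1/suc k) ⟩
  ι (suc k) * 1/suc k                      ≡⟨ 1/suc-inverse k ⟩
  1ℚ                                       ∎)
  where
  open ≤-Reasoning
  index : ∀ k → suc (suc (2 ℕ.* k)) ≡ 2 ℕ.* suc k
  index = solve-∀

ζ₂-split : ∀ N → ζ₂ (2 ℕ.* N) ≡ odd-squares N + ι 4 ⁻¹ * ζ₂ N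
ζ₂-split zero    = refl
ζ₂-split (suc N) = begin-equality
  ζ₂ (2 ℕ.* suc N)
    ≡⟨ cong ζ₂ (index N) ⟩
  (ζ₂ (2 ℕ.* N) + ζ₂-term (2 ℕ.* N)) + ζ₂-term (suc (2 ℕ.* N))
    ≡⟨ cong₂ (λ t u → (t + u) + ζ₂-term (suc (2 ℕ.* N))) (ζ₂-split N) (ζ₂-term≡1/suc² (2 ℕ.* N)) ⟩
  ((odd-squares N + ι 4 ⁻¹ * ζ₂ N) + R * R) + ζ₂-term (suc (2 ℕ.* N))
    ≡⟨ cong (((odd-squares N + ι 4 ⁻¹ * ζ₂ N) + R * R) +_) (trans (ζ₂-term≡1/suc² (suc (2 ℕ.* N))) (cong (λ t → t * t) (1/suc-double N))) ⟩
  ((odd-squares N + ι 4 ⁻¹ * ζ₂ N) + R * R) + (½ * 1/suc N) * (½ * 1/suc N)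
    ≡⟨ solve 4 (λ B Z R x → ((B :+ con (ι 4 ⁻¹) :* Z) :+ R :* R) :+ (con ½ :* x) :* (con ½ :* x)
          := (B :+ R :* R) :+ con (ι 4 ⁻¹) :* (Z :+ x :* x)) refl (odd-squares N) (ζ₂ N) R (1/suc N) ⟩
  (odd-squares N + R * R) + ι 4 ⁻¹ * (ζ₂ N + 1/suc N * 1/suc N)
    ≡⟨ cong (λ t → (odd-squares N + R * R) + ι 4 ⁻¹ * (ζ₂ N + t)) (ζ₂-term≡1/suc² N) ⟨
  (odd-squares N + R * R) + ι 4 ⁻¹ * (ζ₂ N + ζ₂-term N) ∎
  where
  open ≤-Reasoning
  R : ℚ
  R = 1/suc (2 ℕ.* N)
  index : ∀ k → 2 ℕ.* suc k ≡ suc (suc (2 ℕ.* k))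
  index = solve-∀

0≤ζ₂-term : ∀ k → 0ℚ ≤ ζ₂-term k
0≤ζ₂-term k = <⇒≤ (⁻¹-pos (ι-square-pos k))

leibniz-sum : ∀ N → seq π N ≡ ι 4 * odd-sum N
leibniz-sum N = trans (∑-cong N λ k _ → solve 3 (λ s f x → s :* (f :* x) := f :* (s :* x)) refl (sign k) (ι 4) (1/suc (2 ℕ.* k)))
  (∑-* (ι 4) _ N)

-- With π = 4L one has π²/6 = (4/3)·2L², and the odd squares make up three quarters of ζ(2). At a
-- finite stage the deviation is the stretch of ζ₂ from N to 2N together with the defect.
basel-error : ∀ N → seq π²/6 N - ζ₂ N ≡ (ι 4 * ι 3 ⁻¹) * ((ζ₂ (2 ℕ.* N) - ζ₂ N) - sign N * defect N)
basel-error N = begin-equality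
  (seq π N * (seq π N * 1ℚ)) * ι 6 ⁻¹ - Z
    ≡⟨ cong (λ t → (t * (t * 1ℚ)) * ι 6 ⁻¹ - Z) (leibniz-sum N) ⟩
  ((ι 4 * L) * ((ι 4 * L) * 1ℚ)) * ι 6 ⁻¹ - Z
    ≡⟨ solve 2 (λ L Z → ((con (ι 4) :* L) :* ((con (ι 4) :* L) :* con 1ℚ)) :* con (ι 6 ⁻¹) :- Z
          := con (ι 4 * ι 3 ⁻¹) :* (con (ι 2) :* (L :* L)) :- Z) refl L Z ⟩
  c * (ι 2 * (L * L)) - Z
    ≡⟨ cong (λ t → c * t - Z) (odd-square-defect N) ⟩
  c * (odd-squares N - D) - Z
    ≡⟨ solve 3 (λ B D Z → con (ι 4 * ι 3 ⁻¹) :* (B :- D) :- Z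
          := con (ι 4 * ι 3 ⁻¹) :* (((B :+ con (ι 4 ⁻¹) :* Z) :- Z) :- D)) refl (odd-squares N) D Z ⟩
  c * (((odd-squares N + ι 4 ⁻¹ * Z) - Z) - D)
    ≡⟨ cong (λ t → c * ((t - Z) - D)) (ζ₂-split N) ⟨
  c * ((ζ₂ (2 ℕ.* N) - Z) - D) ∎
  where
  open ≤-Reasoning
  c L Z D : ℚ
  c = ι 4 * ι 3 ⁻¹
  L = odd-sum N
  Z = ζ₂ N
  D = sign N * defect N

basel : ∀ ε → 0ℚ < ε → ∃ λ N → ∀ n → N ≤ℕ n → ∣ seq π²/6 n - ζ₂ n ∣ ≤ ε
basel ε 0<ε = choose (scaled-archimedean (ι 2) η (ι-suc-pos 1) 0<η) (harmonic-small (ι 3 ⁻¹ * η) (*-pos (⁻¹-pos (ι-suc-pos 2)) 0<η))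
  where
  open ≤-Reasoning
  -- Two errors of size η are scaled by 4/3, and (4/3)·(η + η) = ε.
  η : ℚ
  η = (ι 3 * ι 8 ⁻¹) * ε
  0<η : 0ℚ < η
  0<η = *-pos (*-pos (ι-suc-pos 2) (⁻¹-pos (ι-suc-pos 7))) 0<ε
  c : ℚ
  c = ι 4 * ι 3 ⁻¹
  0≤c : 0ℚ ≤ c
  0≤c = *-nonNeg (0≤ι 4) (<⇒≤ (⁻¹-pos (ι-suc-pos 2)))
  choose : (∃ λ N → ∀ n → N ≤ℕ n → ι 2 * 1/suc n ≤ η) → (∃ λ N → ∀ n → N ≤ℕ n → 1/suc n * harmonic n ≤ ι 3 ⁻¹ * η) →
    ∃ λ N → ∀ n → N ≤ℕ n → ∣ seq π²/6 n - ζ₂ n ∣ ≤ ε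
  choose (M , hM) (N , hN) = M ℕ.⊔ N , λ n h → let Δ = ζ₂ (2 ℕ.* n) - ζ₂ n ; D = sign n * defect n in begin
    ∣ seq π²/6 n - ζ₂ n ∣         ≡⟨ cong ∣_∣ (basel-error n) ⟩
    ∣ c * (Δ - D) ∣               ≡⟨ trans (∣p*q∣≡∣p∣*∣q∣ c (Δ - D)) (cong (_* ∣ Δ - D ∣) (0≤p⇒∣p∣≡p 0≤c)) ⟩
    c * ∣ Δ - D ∣                 ≤⟨ *-monoˡ 0≤c (≤-trans (∣p+q∣≤∣p∣+∣q∣ Δ (- D)) (≤-reflexive (cong (∣ Δ ∣ +_) (∣-p∣≡∣p∣ D)))) ⟩
    c * (∣ Δ ∣ + ∣ D ∣)           ≤⟨ *-monoˡ 0≤c (+-mono-≤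
                                       -- `2 ℕ.* n` unfolds to `n ℕ.+ (n ℕ.+ 0)`, hence the length
                                       -- `n ℕ.+ 0` of the tail.
                                       (≤-trans (dilog-tail ζ₂-term (λ k → ≤-reflexive (0≤p⇒∣p∣≡p (0≤ζ₂-term k))) n (n ℕ.+ 0)) (hM n (⊔ˡ M N h)))
                                       (≤-trans (≤-reflexive (∣sign*∣ n (defect n))) (≤-trans (defect-bound n) (*-monoˡ (0≤ι 3) (hN n (⊔ʳ M N h)))))) ⟩
    c * (η + ι 3 * (ι 3 ⁻¹ * η))  ≡⟨ solve 1 (λ e → con (ι 4 * ι 3 ⁻¹) :* (con (ι 3 * ι 8 ⁻¹) :* e :+ con (ι 3) :* (con (ι 3 ⁻¹) :* (con (ι 3 * ι 8 ⁻¹) :* e))) := e) refl ε ⟩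
    ε                             ∎

-- Sums over monic irreducible polynomials

Σ-mono : ∀ {a} {A : Set a} {f g : A → ℕ} xs → (∀ x → f x ≤ℕ g x) → Σ f xs ≤ℕ Σ g xs
Σ-mono []       le = ℕ.z≤n
Σ-mono (x ∷ xs) le = ℕP.+-mono-≤ (le x) (Σ-mono xs le)

∑-zero : ∀ n → ∑ (λ _ → 0ℚ) n ≡ 0ℚ
∑-zero zero    = refl
∑-zero (suc n) = trans (+-identityʳ _) (∑-zero n)

∑-nonNeg : ∀ {f} → (∀ k → 0ℚ ≤ f k) → ∀ n → 0ℚ ≤ ∑ f n
∑-nonNeg 0≤f zero    = ≤-refl
∑-nonNeg 0≤f (suc n) = +-mono-≤ (∑-nonNeg 0≤f n) (0≤f n)

∑-extend : ∀ {f} → (∀ k → 0ℚ ≤ f k) → ∀ {m n} → m ≤ℕ n → ∑ f m ≤ ∑ f n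
∑-extend {f} 0≤f {m} {n} m≤n = subst (λ k → ∑ f m ≤ ∑ f k) (ℕP.m+[n∸m]≡n m≤n) (≤-trans (≤-reflexive (sym (+-identityʳ (∑ f m))))
  (≤-trans (+-monoʳ-≤ (∑ f m) (∑-nonNeg (λ k → 0≤f (m ℕ.+ k)) (n ℕ.∸ m))) (≤-reflexive (sym (∑-split f m (n ℕ.∸ m))))))

∑-pick : ∀ (f : ℕ → ℚ) {i n} → i <ℕ n → ∑ (λ k → ι (𝟙 (suc i ℕP.≟ suc k)) * f k) n ≡ f i
∑-pick f {i} {suc n} i<1+n = [ earlier , last ]′ (ℕP.m<1+n⇒m<n∨m≡n i<1+n)
  where
  other : ∀ {k} → i ≢ k → ι (𝟙 (suc i ℕP.≟ suc k)) * f k ≡ 0ℚ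
  other {k} i≢k = trans (cong (λ d → ι d * f k) (𝟙-no (suc i ℕP.≟ suc k) (i≢k ∘ ℕP.suc-injective))) (*-zeroˡ (f k))
  earlier : i <ℕ n → _
  earlier i<n = trans (cong₂ _+_ (∑-pick f i<n) (other (ℕP.<⇒≢ i<n))) (+-identityʳ (f i))
  last : i ≡ n → _
  last refl = trans (cong₂ _+_ (trans (∑-cong i (λ k k<i → other (ℕP.>⇒≢ k<i))) (∑-zero i))
      (trans (cong (λ d → ι d * f i) (𝟙-yes (suc i ℕP.≟ suc i) refl)) (*-identityˡ (f i)))) (+-identityˡ (f i))

module MonicIrreducibles {c ℓ} {q : ℕ} (F : FiniteField c ℓ q) where

  open Polynomials F
  open PolynomialRing F
  open GaussFormula F
  open Inverse (FiniteField.enumeration F) using (to; from; strictlyInverseˡ)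

  word-of : NonconstantMonic → Word q
  word-of m = map to (toList (lower m))

  poly≋mon : ∀ m → poly m ≋ mon (word-of m)
  poly≋mon m = ≋.sym (monic-of-from-to (toList (lower m)))

  length-word-of : ∀ m → length (word-of m) ≡ degree m
  length-word-of m = trans (ListP.length-map to (toList (lower m))) (VecP.length-toList (lower m))

  0<word-of : ∀ m → 0 <ℕ length (word-of m)
  0<word-of m = ℕP.<-≤-trans (ℕ.s≤s ℕ.z≤n) (ℕP.≤-reflexive (sym (length-word-of m)))

  word-of-injective : ∀ m m′ → word-of m ≡ word-of m′ → ¬ (m ≉ₘ m′)
  word-of-injective m m′ e distinct = distinct (_≋_.at (≋.trans (poly≋mon m) (≋.trans (≋.reflexive (cong mon e)) (≋.sym (poly≋mon m′)))))

  word-of-irreducible : ∀ {m} → 𝓘 m → IrreducibleWord (word-of m)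
  word-of-irreducible {m} = irreducible⇒word (poly≋mon m) (0<word-of m)

  to-monic : ∀ w → 0 <ℕ length w → NonconstantMonic
  to-monic (x ∷ w) _ = monic (length (map from w)) (fromList (map from (x ∷ w)))

  word-of-to-monic : ∀ w 0<w → word-of (to-monic w 0<w) ≡ w
  word-of-to-monic (x ∷ w) _ = trans (cong (map to) (VecP.toList∘fromList (map from (x ∷ w)))) (retract (x ∷ w))
    where
    retract : ∀ w → map to (map from w) ≡ w
    retract []      = refl
    retract (x ∷ w) = cong₂ _∷_ (strictlyInverseˡ x) (retract w)

  degree-to-monic : ∀ w 0<w → degree (to-monic w 0<w) ≡ length w
  degree-to-monic w 0<w = trans (sym (length-word-of (to-monic w 0<w))) (cong length (word-of-to-monic w 0<w))

  ω : ℕ → ℚ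
  ω d = ι (q ℕ.^ d ℕ.* d) ⁻¹

  -- Indexed from degree 1: the contribution of the irreducible polynomials of degree i + 1.
  layer : ℕ → ℚ
  layer i = ι (#irreducible (suc i)) * ω (suc i)

  of-degree : ℕ → NonconstantMonic → ℕ
  of-degree n m = 𝟙 (degree m ℕP.≟ n)

  weights-by-degree : ∀ N as → All (λ m → degree m ≤ℕ N) as → weights as ≡ ∑ (λ i → ι (Σ (of-degree (suc i)) as) * ω (suc i)) N
  weights-by-degree N [] [] = sym (trans (∑-cong N (λ i _ → *-zeroˡ (ω (suc i)))) (∑-zero N))
  weights-by-degree N (m ∷ as) (m≤N ∷ as≤N) = begin-equality
    ω (degree m) + weights as
      ≡⟨ cong₂ _+_ (sym (∑-pick (λ i → ω (suc i)) m≤N)) (weights-by-degree N as as≤N) ⟩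
    ∑ (λ i → ι (of-degree (suc i) m) * ω (suc i)) N + ∑ (λ i → ι (Σ (of-degree (suc i)) as) * ω (suc i)) N
      ≡⟨ ∑-+ (λ i → ι (of-degree (suc i) m) * ω (suc i)) (λ i → ι (Σ (of-degree (suc i)) as) * ω (suc i)) N ⟨
    ∑ (λ i → ι (of-degree (suc i) m) * ω (suc i) + ι (Σ (of-degree (suc i)) as) * ω (suc i)) N
      ≡⟨ ∑-cong N (λ i _ → trans (sym (*-distribʳ-+ (ω (suc i)) (ι (of-degree (suc i) m)) (ι (Σ (of-degree (suc i)) as))))
           (cong (_* ω (suc i)) (sym (ι-+ (of-degree (suc i) m) (Σ (of-degree (suc i)) as))))) ⟩
    ∑ (λ i → ι (of-degree (suc i) m ℕ.+ Σ (of-degree (suc i)) as) * ω (suc i)) N ∎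
    where open ≤-Reasoning

  occurrences : Word q → List NonconstantMonic → ℕ
  occurrences p = Σ (λ m → δ p (word-of m))

  no-occurrences : ∀ m as → All (m ≉ₘ_) as → occurrences (word-of m) as ≡ 0
  no-occurrences m []        []        = refl
  no-occurrences m (m′ ∷ as) (≉ ∷ all) = cong₂ ℕ._+_ (𝟙-no (word-of m ≟ʷ word-of m′) (λ e → word-of-injective m m′ e ≉)) (no-occurrences m as all)

  occurrences≤1 : ∀ p as → AllPairs _≉ₘ_ as → All 𝓘 as → occurrences p as ≤ℕ is-irreducible p
  occurrences≤1 p [] _ _ = ℕ.z≤n
  occurrences≤1 p (m ∷ as) (≉ ∷ distinct) (irr-m ∷ all) = split (p ≟ʷ word-of m)
    where
    split : (d : Dec (p ≡ word-of m)) → 𝟙 d ℕ.+ occurrences p as ≤ℕ is-irreducible p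
    split (no _)     = occurrences≤1 p as distinct all
    split (yes refl) = ℕP.≤-reflexive (trans (cong suc (no-occurrences m as ≉)) (sym (𝟙-yes (irreducible? p) (word-of-irreducible irr-m))))

  -- The count is moved from the list to `words q n`: each member of degree n is exactly one word
  -- there, and after exchanging the sums every irreducible word is hit at most once.
  count≤#irreducible : ∀ n as → AllPairs _≉ₘ_ as → All 𝓘 as → Σ (of-degree n) as ≤ℕ #irreducible n
  count≤#irreducible n as distinct all = begin
    Σ (of-degree n) as
      ≡⟨ Σ-cong as (λ m _ → trans (cong (λ k → 𝟙 (k ℕP.≟ n)) (sym (length-word-of m))) (sym (Σ-δ n (word-of m)))) ⟩
    Σ (λ m → Σ (λ p → δ p (word-of m)) (words q n)) as
      ≡⟨ Σ-swap (λ m p → δ p (word-of m)) as (words q n) ⟩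
    Σ (λ p → occurrences p as) (words q n)
      ≤⟨ Σ-mono (words q n) (λ p → occurrences≤1 p as distinct all) ⟩
    #irreducible n ∎
    where open ℕP.≤-Reasoning

  0≤ω : ∀ d → 0ℚ ≤ ω d
  0≤ω d = ⁻¹-nonNeg (q ℕ.^ d ℕ.* d)
    where
    ⁻¹-nonNeg : ∀ n → 0ℚ ≤ ι n ⁻¹
    ⁻¹-nonNeg zero    = ≤-refl
    ⁻¹-nonNeg (suc n) = 0≤1/suc n

  0≤layer : ∀ i → 0ℚ ≤ layer i
  0≤layer i = *-nonNeg (0≤ι (#irreducible (suc i))) (0≤ω (suc i))

  weights≤ : ∀ N as → AllPairs _≉ₘ_ as → All 𝓘 as → All (λ m → degree m ≤ℕ N) as → weights as ≤ ∑ layer N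
  weights≤ N as distinct all degrees = ≤-trans (≤-reflexive (weights-by-degree N as degrees))
    (∑-mono N (λ i _ → *-monoʳ (0≤ω (suc i)) (ι-≤ (count≤#irreducible (suc i) as distinct all))))

  degree-bound : ∀ as → ∃ λ N → All (λ m → degree m ≤ℕ N) as
  degree-bound []       = 0 , []
  degree-bound (m ∷ as) with degree-bound as
  ... | N , all = degree m ℕ.⊔ N , ℕP.m≤m⊔n (degree m) N ∷ All.map (λ le → ℕP.≤-trans le (ℕP.m≤n⊔m (degree m) N)) all

  -- The decision is an argument, so that proofs about `irreducibles` can split on it in a local
  -- function.
  cons-irreducible : ∀ w → Dec (IrreducibleWord w) → List NonconstantMonic → List NonconstantMonic
  cons-irreducible w (yes irr-w) ms = to-monic w (proj₁ irr-w) ∷ ms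
  cons-irreducible w (no _)      ms = ms

  irreducibles : List (Word q) → List NonconstantMonic
  irreducibles []       = []
  irreducibles (w ∷ ws) = cons-irreducible w (irreducible? w) (irreducibles ws)

  irreducibles-𝓘 : ∀ ws → All 𝓘 (irreducibles ws)
  irreducibles-𝓘 []       = []
  irreducibles-𝓘 (w ∷ ws) = split (irreducible? w)
    where
    split : (d : Dec (IrreducibleWord w)) → All 𝓘 (cons-irreducible w d (irreducibles ws))
    split (no _)      = irreducibles-𝓘 ws
    split (yes irr-w) = word⇒irreducible (poly≋mon m) (subst IrreducibleWord (sym (word-of-to-monic w (proj₁ irr-w))) irr-w) ∷ irreducibles-𝓘 ws
      where
      m : NonconstantMonic
      m = to-monic w (proj₁ irr-w)

  irreducibles-distinct : ∀ {ws} → Unique ws → AllPairs _≉ₘ_ (irreducibles ws)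
  irreducibles-distinct {[]}     []           = []
  irreducibles-distinct {w ∷ ws} (≢ ∷ unique) = split (irreducible? w)
    where
    fresh : ∀ 0<w ws → All (w ≢_) ws → All (to-monic w 0<w ≉ₘ_) (irreducibles ws)
    fresh 0<w []        []        = []
    fresh 0<w (v ∷ ws) (w≢v ∷ ≢) = split′ (irreducible? v)
      where
      split′ : (d : Dec (IrreducibleWord v)) → All (to-monic w 0<w ≉ₘ_) (cons-irreducible v d (irreducibles ws))
      split′ (no _)            = fresh 0<w ws ≢
      split′ (yes (0<v , _)) = (λ e → w≢v (trans (sym (word-of-to-monic w 0<w)) (trans (mon-injective
          (≋.trans (≋.sym (poly≋mon (to-monic w 0<w))) (≋.trans (coefficients e) (poly≋mon (to-monic v 0<v))))) (word-of-to-monic v 0<v))))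
        ∷ fresh 0<w ws ≢
    split : (d : Dec (IrreducibleWord w)) → AllPairs _≉ₘ_ (cons-irreducible w d (irreducibles ws))
    split (no _)      = irreducibles-distinct unique
    split (yes irr-w) = fresh (proj₁ irr-w) ws ≢ ∷ irreducibles-distinct unique

  weights-irreducibles : ∀ d ws → (∀ w → w ∈ ws → length w ≡ d) → weights (irreducibles ws) ≡ ι (Σ is-irreducible ws) * ω d
  weights-irreducibles d []       same = sym (*-zeroˡ (ω d))
  weights-irreducibles d (w ∷ ws) same = split (irreducible? w)
    where
    open ≤-Reasoning
    rest : weights (irreducibles ws) ≡ ι (Σ is-irreducible ws) * ω d
    rest = weights-irreducibles d ws (λ v v∈ → same v (there v∈))
    split : (e : Dec (IrreducibleWord w)) → weights (cons-irreducible w e (irreducibles ws)) ≡ ι (𝟙 e ℕ.+ Σ is-irreducible ws) * ω d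
    split (no _)      = rest
    split (yes irr-w) = begin-equality
      ω (degree (to-monic w (proj₁ irr-w))) + weights (irreducibles ws)
        ≡⟨ cong₂ _+_ (cong ω (trans (degree-to-monic w (proj₁ irr-w)) (same w (here refl)))) rest ⟩
      ω d + ι (Σ is-irreducible ws) * ω d
        ≡⟨ cong (_+ ι (Σ is-irreducible ws) * ω d) (*-identityˡ (ω d)) ⟨
      1ℚ * ω d + ι (Σ is-irreducible ws) * ω d
        ≡⟨ *-distribʳ-+ (ω d) 1ℚ (ι (Σ is-irreducible ws)) ⟨
      (1ℚ + ι (Σ is-irreducible ws)) * ω d
        ≡⟨ cong (_* ω d) (ι-+ 1 (Σ is-irreducible ws)) ⟨
      ι (suc (Σ is-irreducible ws)) * ω d ∎

  words≤ : ℕ → List (Word q)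
  words≤ zero    = []
  words≤ (suc n) = words q (suc n) ++ words≤ n

  length-words≤ : ∀ n {w} → w ∈ words≤ n → length w ≤ℕ n
  length-words≤ (suc n) w∈ = [ (λ w∈₁ → ℕP.≤-reflexive (length-words (suc n) w∈₁)) , (λ w∈₂ → ℕP.m≤n⇒m≤1+n (length-words≤ n w∈₂)) ]′
    (∈-++⁻ (words q (suc n)) w∈)

  words≤-unique : ∀ n → Unique (words≤ n)
  words≤-unique zero    = []
  words≤-unique (suc n) = Unique.++⁺ (words-unique q (suc n)) (words≤-unique n)
    (λ (w∈₁ , w∈₂) → ℕP.<⇒≢ (ℕ.s≤s (length-words≤ n w∈₂)) (length-words (suc n) w∈₁))

  irreducibles-++ : ∀ vs ws → irreducibles (vs ++ ws) ≡ irreducibles vs ++ irreducibles ws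
  irreducibles-++ []       ws = refl
  irreducibles-++ (v ∷ vs) ws = split (irreducible? v)
    where
    split : (d : Dec (IrreducibleWord v)) → cons-irreducible v d (irreducibles (vs ++ ws)) ≡ cons-irreducible v d (irreducibles vs) ++ irreducibles ws
    split (yes _) = cong (_ ∷_) (irreducibles-++ vs ws)
    split (no _)  = irreducibles-++ vs ws

  weights-++ : ∀ as bs → weights (as ++ bs) ≡ weights as + weights bs
  weights-++ []       bs = sym (+-identityˡ (weights bs))
  weights-++ (a ∷ as) bs = trans (cong (weight a +_) (weights-++ as bs)) (sym (+-assoc (weight a) (weights as) (weights bs)))

  -- The partial sums of `layer` are themselves sums over finite sets of irreducibles, which
  -- supplies the witnesses for `approached`.
  weights-irreducibles≤ : ∀ n → weights (irreducibles (words≤ n)) ≡ ∑ layer n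
  weights-irreducibles≤ zero    = refl
  weights-irreducibles≤ (suc n) = begin-equality
    weights (irreducibles (words q (suc n) ++ words≤ n))
      ≡⟨ cong weights (irreducibles-++ (words q (suc n)) (words≤ n)) ⟩
    weights (irreducibles (words q (suc n)) ++ irreducibles (words≤ n))
      ≡⟨ weights-++ (irreducibles (words q (suc n))) (irreducibles (words≤ n)) ⟩
    weights (irreducibles (words q (suc n))) + weights (irreducibles (words≤ n))
      ≡⟨ cong₂ _+_ (weights-irreducibles (suc n) (words q (suc n)) (λ w → length-words (suc n))) (weights-irreducibles≤ n) ⟩
    layer n + ∑ layer n
      ≡⟨ +-comm (layer n) (∑ layer n) ⟩
    ∑ layer n + layer n ∎
    where open ≤-Reasoning

-- Bounds for the sum of the weights

∣∣-elimʳ : ∀ p q {d} → ∣ p - q ∣ ≤ d → q ≤ p + d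
∣∣-elimʳ p q h = ∣∣-elim (≤-trans (≤-reflexive (∣-∣-comm q p)) h)

ι-pos : ∀ {n} → 0 <ℕ n → 0ℚ < ι n
ι-pos {suc n} _ = ι-suc-pos n

⁻¹-* : ∀ m n → 0 <ℕ m → 0 <ℕ n → ι (m ℕ.* n) ⁻¹ ≡ ι m ⁻¹ * ι n ⁻¹
⁻¹-* m n 0<m 0<n = inverse-unique (ι (m ℕ.* n)) (ι (m ℕ.* n) ⁻¹) (ι m ⁻¹ * ι n ⁻¹) (*-⁻¹ (ι-pos (ℕP.*-mono-< 0<m 0<n))) (begin-equality
  ι (m ℕ.* n) * (ι m ⁻¹ * ι n ⁻¹)  ≡⟨ cong (_* (ι m ⁻¹ * ι n ⁻¹)) (ι-* m n) ⟩
  (ι m * ι n) * (ι m ⁻¹ * ι n ⁻¹)  ≡⟨ solve 4 (λ a b c d → (a :* b) :* (c :* d) := (a :* c) :* (b :* d)) refl (ι m) (ι n) (ι m ⁻¹) (ι n ⁻¹) ⟩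
  (ι m * ι m ⁻¹) * (ι n * ι n ⁻¹)  ≡⟨ cong₂ _*_ (*-⁻¹ (ι-pos 0<m)) (*-⁻¹ (ι-pos 0<n)) ⟩
  1ℚ * 1ℚ                          ≡⟨ *-identityˡ 1ℚ ⟩
  1ℚ                               ∎)
  where open ≤-Reasoning

fraction-≤ : ∀ a b c d → 0 <ℕ b → 0 <ℕ d → a ℕ.* d ≤ℕ c ℕ.* b → ι a * ι b ⁻¹ ≤ ι c * ι d ⁻¹
fraction-≤ a b c d 0<b 0<d h = begin
  ι a * B                ≡⟨ *-identityʳ (ι a * B) ⟨
  (ι a * B) * 1ℚ         ≡⟨ cong ((ι a * B) *_) (*-⁻¹ (ι-pos 0<d)) ⟨
  (ι a * B) * (ι d * D)  ≡⟨ solve 4 (λ a B d D → (a :* B) :* (d :* D) := (a :* d) :* (B :* D)) refl (ι a) B (ι d) D ⟩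
  (ι a * ι d) * (B * D)  ≡⟨ cong (_* (B * D)) (ι-* a d) ⟨
  ι (a ℕ.* d) * (B * D)  ≤⟨ *-monoʳ (<⇒≤ (*-pos (⁻¹-pos (ι-pos 0<b)) (⁻¹-pos (ι-pos 0<d)))) (ι-≤ h) ⟩
  ι (c ℕ.* b) * (B * D)  ≡⟨ cong (_* (B * D)) (ι-* c b) ⟩
  (ι c * ι b) * (B * D)  ≡⟨ solve 4 (λ c b B D → (c :* b) :* (B :* D) := (c :* D) :* (b :* B)) refl (ι c) (ι b) B D ⟩
  (ι c * D) * (ι b * B)  ≡⟨ cong ((ι c * D) *_) (*-⁻¹ (ι-pos 0<b)) ⟩
  (ι c * D) * 1ℚ         ≡⟨ *-identityʳ (ι c * D) ⟩
  ι c * D                ∎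
  where
  open ≤-Reasoning
  B D : ℚ
  B = ι b ⁻¹
  D = ι d ⁻¹

ι-^ : ∀ q n → ι (q ℕ.^ n) ≡ ι q ^ℚ n
ι-^ q zero    = refl
ι-^ q (suc n) = trans (ι-* q (q ℕ.^ n)) (cong (ι q *_) (ι-^ q n))

^ℚ-nonNeg : ∀ {x} n → 0ℚ ≤ x → 0ℚ ≤ x ^ℚ n
^ℚ-nonNeg zero    0≤x = <⇒≤ (positive⁻¹ 1ℚ)
^ℚ-nonNeg (suc n) 0≤x = *-nonNeg 0≤x (^ℚ-nonNeg n 0≤x)

^ℚ-mono : ∀ {x y} n → 0ℚ ≤ x → x ≤ y → x ^ℚ n ≤ y ^ℚ n
^ℚ-mono zero    0≤x x≤y = ≤-refl
^ℚ-mono (suc n) 0≤x x≤y = *-mono (^ℚ-nonNeg n 0≤x) (≤-trans 0≤x x≤y) x≤y (^ℚ-mono n 0≤x x≤y)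

^ℚ-inverse : ∀ {x y} n → x * y ≡ 1ℚ → x ^ℚ n * y ^ℚ n ≡ 1ℚ
^ℚ-inverse zero    e = refl
^ℚ-inverse {x} {y} (suc n) e = trans
  (solve 4 (λ x X y Y → (x :* X) :* (y :* Y) := (x :* y) :* (X :* Y)) refl x (x ^ℚ n) y (y ^ℚ n))
  (trans (cong₂ _*_ e (^ℚ-inverse n e)) (*-identityˡ 1ℚ))

^ℚ-+ : ∀ x m n → x ^ℚ (m ℕ.+ n) ≡ x ^ℚ m * x ^ℚ n
^ℚ-+ x zero    n = sym (*-identityˡ (x ^ℚ n))
^ℚ-+ x (suc m) n = trans (cong (x *_) (^ℚ-+ x m n)) (sym (*-assoc x (x ^ℚ m) (x ^ℚ n)))

square-root-power : ∀ {y Q} h e → 0ℚ ≤ y → y ≤ Q → y * y ≤ Q → y ^ℚ ((h ℕ.+ h) ℕ.+ e) ≤ Q ^ℚ (h ℕ.+ e)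
square-root-power zero e 0≤y y≤Q y²≤Q = ^ℚ-mono e 0≤y y≤Q
square-root-power {y} {Q} (suc h) e 0≤y y≤Q y²≤Q = begin
  y * y ^ℚ ((h ℕ.+ suc h) ℕ.+ e)    ≡⟨ cong (λ k → y * y ^ℚ (k ℕ.+ e)) (ℕP.+-suc h h) ⟩
  y * (y * y ^ℚ ((h ℕ.+ h) ℕ.+ e))  ≡⟨ *-assoc y y (y ^ℚ ((h ℕ.+ h) ℕ.+ e)) ⟨
  (y * y) * y ^ℚ ((h ℕ.+ h) ℕ.+ e)  ≤⟨ *-mono (^ℚ-nonNeg ((h ℕ.+ h) ℕ.+ e) 0≤y) (≤-trans 0≤y y≤Q) y²≤Q (square-root-power h e 0≤y y≤Q y²≤Q) ⟩
  Q * Q ^ℚ (h ℕ.+ e)                ∎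
  where open ≤-Reasoning

-- h = ⌊(n + 1)/2⌋ and e is the parity of n + 1. The bound n ≤ 2h serves the proper divisors, the
-- equation serves the powers of 1/√q, and h ≤ n serves the uniform estimate.
halve : ∀ n → ∃₂ λ h e → suc n ≡ (h ℕ.+ h) ℕ.+ e × n ≤ℕ h ℕ.+ h × h ≤ℕ n
halve zero          = 0 , 1 , refl , ℕ.z≤n , ℕ.z≤n
halve (suc zero)    = 1 , 0 , refl , ℕ.s≤s ℕ.z≤n , ℕ.s≤s ℕ.z≤n
halve (suc (suc n)) with halve n
... | h , e , eq , n≤2h , h≤n = suc h , e
  , trans (cong (λ k → suc (suc k)) eq) (cong (λ k → suc (k ℕ.+ e)) (sym (ℕP.+-suc h h)))
  , ℕ.s≤s (ℕP.≤-trans (ℕ.s≤s n≤2h) (ℕP.≤-reflexive (sym (ℕP.+-suc h h))))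
  , ℕ.s≤s (ℕP.m≤n⇒m≤1+n h≤n)

module Bounds {c ℓ} {q : ℕ} (F : FiniteField c ℓ q) (1<q : 1 <ℕ q) where

  open GaussFormula F using (#irreducible; #irreducible-upper; #irreducible-lower)
  open MonicIrreducibles F using (ω; layer; 0≤layer)

  0<q : 0 <ℕ q
  0<q = ℕP.<-trans (ℕ.s≤s ℕ.z≤n) 1<q

  0<q^ : ∀ n → 0 <ℕ q ℕ.^ n
  0<q^ n = ℕP.m^n>0 q {{ℕ.>-nonZero 0<q}} n

  layer-upper : ∀ i → layer i ≤ ζ₂-term i
  layer-upper i = ≤-trans
    (fraction-≤ (#irreducible n) (q ℕ.^ n ℕ.* n) 1 (n ℕ.^ 2) (ℕP.*-mono-< (0<q^ n) (ℕ.s≤s ℕ.z≤n)) (ℕ.s≤s ℕ.z≤n) (begin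
      #irreducible n ℕ.* n ℕ.^ 2    ≡⟨ shuffle n (#irreducible n) ⟩
      (n ℕ.* #irreducible n) ℕ.* n  ≤⟨ ℕP.*-monoˡ-≤ n (#irreducible-upper i) ⟩
      q ℕ.^ n ℕ.* n                 ≡⟨ ℕP.*-identityˡ _ ⟨
      1 ℕ.* (q ℕ.^ n ℕ.* n)         ∎))
    (≤-reflexive (*-identityˡ (ζ₂-term i)))
    where
    open ℕP.≤-Reasoning
    n : ℕ
    n = suc i
    shuffle : ∀ n x → x ℕ.* (n ℕ.* (n ℕ.* 1)) ≡ (n ℕ.* x) ℕ.* n
    shuffle = solve-∀

  q-1 : q ≡ suc (q ∸ 1)
  q-1 = sym (ℕP.m+[n∸m]≡n {1} {q} 0<q)

  0<q-1 : 0 <ℕ q ∸ 1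
  0<q-1 = ℕP.m<n⇒0<n∸m 1<q

  0<q/[q-1] : 0ℚ < ι q * ι (q ∸ 1) ⁻¹
  0<q/[q-1] = *-pos (ι-pos 0<q) (⁻¹-pos (ι-pos 0<q-1))

  layer-lower : ∀ i h → i ≤ℕ h ℕ.+ h → ζ₂-term i ≤ layer i + (ι q * ι (q ∸ 1) ⁻¹) * ((ι (q ℕ.^ h) * ι (q ℕ.^ suc i) ⁻¹) * ζ₂-term i)
  layer-lower i h i≤2h = begin
    ζ₂-term i
      ≡⟨ ζ₂-term≡1/suc² i ⟩
    R * R
      -- The two ones become (q - 1)/(q - 1) and qⁿ/qⁿ, so that the integer inequality `cleared` can
      -- act on the numerators.
      ≡⟨ solve 1 (λ x → x :* x := (con 1ℚ :* con 1ℚ) :* (x :* x)) refl R ⟩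
    (1ℚ * 1ℚ) * (R * R)
      ≡⟨ cong₂ (λ u v → (u * v) * (R * R)) PP′ AA′ ⟨
    ((P * P′) * (A * A′)) * (R * R)
      ≡⟨ solve 5 (λ P P′ A A′ x → ((P :* P′) :* (A :* A′)) :* (x :* x) := (P :* A) :* ((P′ :* A′) :* (x :* x))) refl P P′ A A′ R ⟩
    (P * A) * ((P′ * A′) * (R * R))
      ≤⟨ *-monoʳ (*-nonNeg (*-nonNeg (<⇒≤ (⁻¹-pos (ι-pos 0<q-1))) (<⇒≤ (⁻¹-pos (ι-pos (0<q^ n))))) (*-nonNeg (0≤1/suc i) (0≤1/suc i))) cleared ⟩
    (P * (m * X) + Q * H) * ((P′ * A′) * (R * R))
      ≡⟨ solve 8 (λ P P′ A′ m x X Q H → (P :* (m :* X) :+ Q :* H) :* ((P′ :* A′) :* (x :* x))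
            := ((P :* P′) :* (m :* x)) :* (X :* (A′ :* x)) :+ (Q :* P′) :* ((H :* A′) :* (x :* x))) refl P P′ A′ m R X Q H ⟩
    ((P * P′) * (m * R)) * (X * (A′ * R)) + (Q * P′) * ((H * A′) * (R * R))
      ≡⟨ cong₂ (λ u v → (u * v) * (X * (A′ * R)) + (Q * P′) * ((H * A′) * (R * R))) PP′ (1/suc-inverse i) ⟩
    (1ℚ * 1ℚ) * (X * (A′ * R)) + (Q * P′) * ((H * A′) * (R * R))
      ≡⟨ cong₂ _+_ (trans (*-identityˡ (X * (A′ * R))) (cong (X *_) (sym (⁻¹-* (q ℕ.^ n) n (0<q^ n) (ℕ.s≤s ℕ.z≤n)))))
                   (cong (λ t → (ι q * ι (q ∸ 1) ⁻¹) * ((H * A′) * t)) (sym (ζ₂-term≡1/suc² i))) ⟩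
    layer i + (ι q * ι (q ∸ 1) ⁻¹) * ((H * A′) * ζ₂-term i) ∎
    where
    open ≤-Reasoning
    n : ℕ
    n = suc i
    P P′ A A′ m R X Q H : ℚ
    P = ι (q ∸ 1)
    P′ = ι (q ∸ 1) ⁻¹
    A = ι (q ℕ.^ n)
    A′ = ι (q ℕ.^ n) ⁻¹
    m = ι n
    R = 1/suc i
    X = ι (#irreducible n)
    Q = ι q
    H = ι (q ℕ.^ h)
    PP′ : P * P′ ≡ 1ℚ
    PP′ = *-⁻¹ (ι-pos 0<q-1)
    AA′ : A * A′ ≡ 1ℚ
    AA′ = *-⁻¹ (ι-pos (0<q^ n))
    cleared : P * A ≤ P * (m * X) + Q * H
    cleared = begin
      P * A                                                       ≡⟨ ι-* (q ∸ 1) (q ℕ.^ n) ⟨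
      ι ((q ∸ 1) ℕ.* q ℕ.^ n)                                     ≤⟨ ι-≤ (#irreducible-lower (q ∸ 1) i h q-1 i≤2h) ⟩
      ι ((q ∸ 1) ℕ.* (n ℕ.* #irreducible n) ℕ.+ q ℕ.* q ℕ.^ h)    ≡⟨ ι-+ ((q ∸ 1) ℕ.* (n ℕ.* #irreducible n)) (q ℕ.* q ℕ.^ h) ⟩
      ι ((q ∸ 1) ℕ.* (n ℕ.* #irreducible n)) + ι (q ℕ.* q ℕ.^ h)  ≡⟨ cong₂ _+_ (trans (ι-* (q ∸ 1) (n ℕ.* #irreducible n)) (cong (P *_) (ι-* n (#irreducible n)))) (ι-* q (q ℕ.^ h)) ⟩
      P * (m * X) + Q * H                                         ∎

  -- With x = 1/y and n = 2h + e the claim is yⁿ ≤ qʰ⁺ᵉ: pairs of factors y are traded for q, and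
  -- leftover factors are bounded by y ≤ q. Any such rational y not above √q is admissible.
  power-bound : ∀ {x y} h e → 0ℚ ≤ x → 0ℚ ≤ y → x * y ≡ 1ℚ → y ≤ ι q → y * y ≤ ι q →
    ι (q ℕ.^ h) * ι (q ℕ.^ ((h ℕ.+ h) ℕ.+ e)) ⁻¹ ≤ x ^ℚ ((h ℕ.+ h) ℕ.+ e)
  power-bound {x} {y} h e 0≤x 0≤y xy y≤q y²≤q = begin
    H * A′                             ≡⟨ solve 2 (λ H A′ → H :* A′ := (con 1ℚ :* H) :* A′) refl H A′ ⟩
    (1ℚ * H) * A′                      ≡⟨ cong (λ t → (t * H) * A′) (^ℚ-inverse n xy) ⟨
    ((X * Y) * H) * A′                 ≡⟨ solve 4 (λ X Y H A′ → ((X :* Y) :* H) :* A′ := (X :* A′) :* (H :* Y)) refl X Y H A′ ⟩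
    (X * A′) * (H * Y)                 ≤⟨ *-monoˡ (*-nonNeg (^ℚ-nonNeg n 0≤x) (<⇒≤ (⁻¹-pos (ι-pos (0<q^ n)))))
                                                (*-monoˡ (0≤ι (q ℕ.^ h)) (square-root-power h e 0≤y y≤q y²≤q)) ⟩
    (X * A′) * (H * ι q ^ℚ (h ℕ.+ e))  ≡⟨ cong ((X * A′) *_) total ⟩
    (X * A′) * A                       ≡⟨ solve 3 (λ X A′ A → (X :* A′) :* A := X :* (A :* A′)) refl X A′ A ⟩
    X * (A * A′)                       ≡⟨ cong (X *_) (*-⁻¹ (ι-pos (0<q^ n))) ⟩
    X * 1ℚ                             ≡⟨ *-identityʳ X ⟩
    X                                  ∎
    where
    open ≤-Reasoning
    n : ℕ
    n = (h ℕ.+ h) ℕ.+ e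
    H A A′ X Y : ℚ
    H = ι (q ℕ.^ h)
    A = ι (q ℕ.^ n)
    A′ = ι (q ℕ.^ n) ⁻¹
    X = x ^ℚ n
    Y = y ^ℚ n
    total : H * ι q ^ℚ (h ℕ.+ e) ≡ A
    total = trans (cong (_* ι q ^ℚ (h ℕ.+ e)) (ι-^ q h)) (trans (sym (^ℚ-+ (ι q) h (h ℕ.+ e)))
      (trans (cong (ι q ^ℚ_) (sym (ℕP.+-assoc h h e))) (sym (ι-^ q n))))

  layer-lower-power : ∀ {x y} i → 0ℚ ≤ x → 0ℚ ≤ y → x * y ≡ 1ℚ → y ≤ ι q → y * y ≤ ι q →
    ζ₂-term i ≤ layer i + (ι q * ι (q ∸ 1) ⁻¹) * (x ^ℚ suc i * ζ₂-term i)
  layer-lower-power {x} {y} i 0≤x 0≤y xy y≤q y²≤q = use (halve i)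
    where
    use : (∃₂ λ h e → suc i ≡ (h ℕ.+ h) ℕ.+ e × i ≤ℕ h ℕ.+ h × h ≤ℕ i) → ζ₂-term i ≤ layer i + (ι q * ι (q ∸ 1) ⁻¹) * (x ^ℚ suc i * ζ₂-term i)
    use (h , e , eq , i≤2h , _) = ≤-trans (layer-lower i h i≤2h)
      (+-monoʳ-≤ (layer i) (*-monoˡ (<⇒≤ 0<q/[q-1]) (*-monoʳ (0≤ζ₂-term i)
        (subst (λ n → ι (q ℕ.^ h) * ι (q ℕ.^ n) ⁻¹ ≤ x ^ℚ n) (sym eq) (power-bound h e 0≤x 0≤y xy y≤q y²≤q)))))

  -- Since h ≤ i, the power q^h / qⁱ⁺¹ is at most 1/q, which cancels the numerator of q/(q - 1).
  -- This rational bound drives the limit and spares an estimate of Li₂ near 0.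
  layer-lower-uniform : ∀ i → ζ₂-term i ≤ layer i + ι (q ∸ 1) ⁻¹ * ζ₂-term i
  layer-lower-uniform i = use (halve i)
    where
    open ≤-Reasoning
    use : (∃₂ λ h e → suc i ≡ (h ℕ.+ h) ℕ.+ e × i ≤ℕ h ℕ.+ h × h ≤ℕ i) → ζ₂-term i ≤ layer i + ι (q ∸ 1) ⁻¹ * ζ₂-term i
    use (h , e , eq , i≤2h , h≤i) = ≤-trans (layer-lower i h i≤2h) (+-monoʳ-≤ (layer i) (begin
      (ι q * ι (q ∸ 1) ⁻¹) * ((ι (q ℕ.^ h) * ι (q ℕ.^ suc i) ⁻¹) * ζ₂-term i)
        ≤⟨ *-monoˡ (<⇒≤ 0<q/[q-1]) (*-monoʳ (0≤ζ₂-term i) (fraction-≤ (q ℕ.^ h) (q ℕ.^ suc i) 1 q (0<q^ (suc i)) 0<q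
             (ℕP.≤-trans (ℕP.≤-reflexive (ℕP.*-comm (q ℕ.^ h) q)) (ℕP.≤-trans (ℕP.^-monoʳ-≤ q {{ℕ.>-nonZero 0<q}} (ℕ.s≤s h≤i)) (ℕP.≤-reflexive (sym (ℕP.*-identityˡ _))))))) ⟩
      (ι q * ι (q ∸ 1) ⁻¹) * ((1ℚ * ι q ⁻¹) * ζ₂-term i)
        ≡⟨ solve 4 (λ Q P′ Q′ z → (Q :* P′) :* ((con 1ℚ :* Q′) :* z) := (Q :* Q′) :* (P′ :* z)) refl (ι q) (ι (q ∸ 1) ⁻¹) (ι q ⁻¹) (ζ₂-term i) ⟩
      (ι q * ι q ⁻¹) * (ι (q ∸ 1) ⁻¹ * ζ₂-term i)
        ≡⟨ cong (_* (ι (q ∸ 1) ⁻¹ * ζ₂-term i)) (*-⁻¹ (ι-pos 0<q)) ⟩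
      1ℚ * (ι (q ∸ 1) ⁻¹ * ζ₂-term i)
        ≡⟨ *-identityˡ _ ⟩
      ι (q ∸ 1) ⁻¹ * ζ₂-term i ∎))

-- Passage to the real numbers

seq-dilog : ∀ x n i → seq (∑ᵣ (dilog-term x) n) i ≡ ∑ (λ k → seq x i ^ℚ suc k * ζ₂-term k) n
seq-dilog x n i = trans (seq-∑ (dilog-term x) n i) (∑-cong n (λ k _ → cong (_* ζ₂-term k) (seq-^ x (suc k) i)))

-- The term 1/(n + 1) allows for the error with which the n-th entry of a `lim` represents the n-th
-- member of its sequence.
subtract-≤ : ∀ x y z c (w : ℕ → ℚ) → 0ℚ < c → (∀ ε → 0ℚ < ε → ∃ λ N → ∀ n → N ≤ℕ n → ∣ seq x n - w n ∣ ≤ ε) →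
  (∀ n → w n ≤ seq z n + c * (seq y n + 1/suc n)) → x -ᵣ fromℚ c *ᵣ y ≤ᵣ z
subtract-≤ x y z c w 0<c x≈w w≤ ε 0<ε = choose (x≈w (½ * ε) (½-pos 0<ε)) (scaled-archimedean c (½ * ε) 0<c (½-pos 0<ε))
  where
  open ≤-Reasoning
  choose : (∃ λ N → ∀ n → N ≤ℕ n → ∣ seq x n - w n ∣ ≤ ½ * ε) → (∃ λ N → ∀ n → N ≤ℕ n → c * 1/suc n ≤ ½ * ε) →
    ∃ λ N → ∀ n → N ≤ℕ n → seq x n + - (c * seq y n) ≤ seq z n + ε
  choose (M , hM) (N , hN) = M ℕ.⊔ N , λ n h → begin
    seq x n + - (c * seq y n)
      ≤⟨ +-monoˡ-≤ (- (c * seq y n)) (≤-trans (∣∣-elim {seq x n} {w n} {½ * ε} (hM n (⊔ˡ M N h))) (+-monoˡ-≤ (½ * ε) (w≤ n))) ⟩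
    ((seq z n + c * (seq y n + 1/suc n)) + ½ * ε) + - (c * seq y n)
      ≡⟨ solve 5 (λ z c y d e → ((z :+ c :* (y :+ d)) :+ e) :+ :- (c :* y) := z :+ (c :* d :+ e)) refl (seq z n) c (seq y n) (1/suc n) (½ * ε) ⟩
    seq z n + (c * 1/suc n + ½ * ε)
      ≤⟨ +-monoʳ-≤ (seq z n) (+-monoˡ-≤ (½ * ε) (hN n (⊔ʳ M N h))) ⟩
    seq z n + (½ * ε + ½ * ε)
      ≡⟨ cong (seq z n +_) (halves ε) ⟩
    seq z n + ε ∎

module RootApproximation (q : ℕ) (1<q : 1 <ℕ q) where

  start : ℕ
  start = proj₁ (proj₂ (proj₂ (1<√ q 1<q)))

  y : ℕ → ℚ
  y i = seq (√ q) i

  1≤y : ∀ i → start ≤ℕ i → 1ℚ ≤ y i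
  1≤y i h = ≤-trans (≤-reflexive (sym (+-identityʳ 1ℚ))) (≤-trans (+-monoʳ-≤ 1ℚ (<⇒≤ (proj₁ (proj₂ (1<√ q 1<q))))) (proj₂ (proj₂ (proj₂ (1<√ q 1<q))) i h))

  0<y : ∀ i → start ≤ℕ i → 0ℚ < y i
  0<y i h = <-≤-trans (positive⁻¹ 1ℚ) (1≤y i h)

  -- The approximation is a floor and lies below √q, so the inequality is exact at every index.
  y²≤q : ∀ i → y i * y i ≤ ι q
  y²≤q i = begin
    (ι a * R) * (ι a * R)                      ≡⟨ solve 2 (λ a R → (a :* R) :* (a :* R) := (a :* a) :* (R :* R)) refl (ι a) R ⟩
    (ι a * ι a) * (R * R)                      ≡⟨ cong (_* (R * R)) (ι-* a a) ⟨
    ι (a ℕ.* a) * (R * R)                      ≤⟨ *-monoʳ (*-nonNeg (0≤1/suc i) (0≤1/suc i)) (ι-≤ (proj₁ (isqrt-spec (q ℕ.* (suc i ℕ.* suc i))))) ⟩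
    ι (q ℕ.* (suc i ℕ.* suc i)) * (R * R)      ≡⟨ cong (_* (R * R)) (trans (ι-* q (suc i ℕ.* suc i)) (cong (ι q *_) (ι-* (suc i) (suc i)))) ⟩
    (ι q * (ι (suc i) * ι (suc i))) * (R * R)  ≡⟨ solve 3 (λ q m R → (q :* (m :* m)) :* (R :* R) := q :* ((m :* R) :* (m :* R))) refl (ι q) (ι (suc i)) R ⟩
    ι q * ((ι (suc i) * R) * (ι (suc i) * R))  ≡⟨ cong (λ t → ι q * (t * t)) (1/suc-inverse i) ⟩
    ι q * 1ℚ                                   ≡⟨ *-identityʳ (ι q) ⟩
    ι q                                        ∎
    where
    open ≤-Reasoning
    a : ℕ
    a = isqrt (q ℕ.* (suc i ℕ.* suc i))
    R : ℚ
    R = 1/suc i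

  y≤q : ∀ i → start ≤ℕ i → y i ≤ ι q
  y≤q i h = ≤-trans (≤-reflexive (sym (*-identityʳ (y i)))) (≤-trans (*-monoˡ (<⇒≤ (0<y i h)) (1≤y i h)) (y²≤q i))

module IrreducibleSum {c ℓ} {q : ℕ} (F : FiniteField c ℓ q) (1<q : 1 <ℕ q) where

  open Polynomials F
  open MonicIrreducibles F
  open Bounds F 1<q
  open RootApproximation q 1<q

  ∣layer∣≤ : ∀ i → ∣ layer i ∣ ≤ ζ₂-term i
  ∣layer∣≤ i = ≤-trans (≤-reflexive (0≤p⇒∣p∣≡p (0≤layer i))) (layer-upper i)

  -- `dilog-tail` serves every series dominated by ∑ 1/n².
  layer-tail : ∀ n j → ∣ ∑ layer (n ℕ.+ j) - ∑ layer n ∣ ≤ ι 2 * 1/suc n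
  layer-tail = dilog-tail layer ∣layer∣≤

  total : ℝ
  total = mkℝ (∑ layer) (tail-cauchy (∑ layer) (ι 2) (ι-suc-pos 1) layer-tail)

  𝓕-total : 𝓕 𝓘 ≔ total
  𝓕-total = record { upper-bound = upper ; approached = below }
    where
    upper : ∀ as → AllPairs _≉ₘ_ as → All 𝓘 as → fromℚ (weights as) ≤ᵣ total
    upper as distinct all ε 0<ε = proj₁ (degree-bound as) , λ n N≤n → begin
      weights as                         ≤⟨ weights≤ (proj₁ (degree-bound as)) as distinct all (proj₂ (degree-bound as)) ⟩
      ∑ layer (proj₁ (degree-bound as))  ≤⟨ ∑-extend 0≤layer N≤n ⟩
      ∑ layer n                          ≡⟨ +-identityʳ (∑ layer n) ⟨
      ∑ layer n + 0ℚ                     ≤⟨ +-monoʳ-≤ (∑ layer n) (<⇒≤ 0<ε) ⟩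
      ∑ layer n + ε                      ∎
      where open ≤-Reasoning
    below : ∀ ε → 0ℚ < ε → ∃ λ as → AllPairs _≉ₘ_ as × All 𝓘 as × total ≤ᵣ fromℚ (weights as + ε)
    below ε 0<ε = choose (scaled-archimedean (ι 2) ε (ι-suc-pos 1) 0<ε)
      where
      open ≤-Reasoning
      choose : (∃ λ N → ∀ n → N ≤ℕ n → ι 2 * 1/suc n ≤ ε) → ∃ λ as → AllPairs _≉ₘ_ as × All 𝓘 as × total ≤ᵣ fromℚ (weights as + ε)
      choose (N , hN) = irreducibles (words≤ N) , irreducibles-distinct (words≤-unique N) , irreducibles-𝓘 (words≤ N) , λ η 0<η → N , λ n N≤n → begin
        ∑ layer n                                   ≡⟨ cong (∑ layer) (ℕP.m+[n∸m]≡n N≤n) ⟨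
        ∑ layer (N ℕ.+ (n ∸ N))                     ≤⟨ ∣∣-elim {∑ layer (N ℕ.+ (n ∸ N))} {∑ layer N} {ε} (≤-trans (layer-tail N (n ∸ N)) (hN N ℕP.≤-refl)) ⟩
        ∑ layer N + ε                               ≡⟨ cong (_+ ε) (weights-irreducibles≤ N) ⟨
        weights (irreducibles (words≤ N)) + ε       ≡⟨ +-identityʳ _ ⟨
        weights (irreducibles (words≤ N)) + ε + 0ℚ  ≤⟨ +-monoʳ-≤ (weights (irreducibles (words≤ N)) + ε) (<⇒≤ 0<η) ⟩
        weights (irreducibles (words≤ N)) + ε + η   ∎

  total≤π²/6 : total ≤ᵣ π²/6
  total≤π²/6 ε 0<ε = choose (basel ε 0<ε)
    where
    open ≤-Reasoning
    choose : (∃ λ N → ∀ n → N ≤ℕ n → ∣ seq π²/6 n - ζ₂ n ∣ ≤ ε) → ∃ λ N → ∀ n → N ≤ℕ n → ∑ layer n ≤ seq π²/6 n + ε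
    choose (N , hN) = N , λ n N≤n → begin
      ∑ layer n       ≤⟨ ∑-mono n (λ i _ → layer-upper i) ⟩
      ζ₂ n            ≤⟨ ∣∣-elimʳ (seq π²/6 n) (ζ₂ n) (hN n N≤n) ⟩
      seq π²/6 n + ε  ∎

  ζ₂≤dilog : ∀ n i → start ≤ℕ i → ζ₂ n ≤ seq total n + (ι q * ι (q ∸ 1) ⁻¹) * seq (∑ᵣ (dilog-term (1/√ q 1<q)) n) i
  ζ₂≤dilog n i h = begin
    ζ₂ n
      ≤⟨ ∑-mono n (λ k _ → layer-lower-power k (<⇒≤ (⁻¹-pos (0<y i h))) (<⇒≤ (0<y i h))
           (trans (*-comm (y i ⁻¹) (y i)) (*-⁻¹ (0<y i h))) (y≤q i h) (y²≤q i)) ⟩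
    ∑ (λ k → layer k + (ι q * ι (q ∸ 1) ⁻¹) * ((y i ⁻¹) ^ℚ suc k * ζ₂-term k)) n
      ≡⟨ trans (∑-+ layer _ n) (cong (∑ layer n +_) (∑-* (ι q * ι (q ∸ 1) ⁻¹) _ n)) ⟩
    ∑ layer n + (ι q * ι (q ∸ 1) ⁻¹) * ∑ (λ k → (y i ⁻¹) ^ℚ suc k * ζ₂-term k) n
      ≡⟨ cong (λ t → ∑ layer n + (ι q * ι (q ∸ 1) ⁻¹) * t) (seq-dilog (1/√ q 1<q) n i) ⟨
    ∑ layer n + (ι q * ι (q ∸ 1) ⁻¹) * seq (∑ᵣ (dilog-term (1/√ q 1<q)) n) i ∎
    where open ≤-Reasoning

  -- Two indices are at play: the number n of terms and the precision i of 1/√q. As `ζ₂≤dilog` holds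
  -- for all i from `start` on, i may be taken past `lim-index` as well, where the partial sum is
  -- within 1/(n + 1) of the n-th entry of `Li₂`.
  dilog≤Li : ∀ n → ∃ λ i → start ≤ℕ i × seq (∑ᵣ (dilog-term (1/√ q 1<q)) n) i ≤ seq (Li₂ (1/√ q 1<q) (∣1/√∣<1 q 1<q)) n + 1/suc n
  dilog≤Li n = i , ℕP.m≤n⊔m (lim-index a n) start , ∣∣-elimʳ (lim-approx a n) (seq (a n) i)
      (lim-near a n i (ℕP.m≤m⊔n (lim-index a n) start))
    where
    a : ℕ → ℝ
    a = ∑ᵣ (dilog-term (1/√ q 1<q))
    i : ℕ
    i = lim-index a n ℕ.⊔ start

  ζ₂≤Li : ∀ n → ζ₂ n ≤ seq total n + (ι q * ι (q ∸ 1) ⁻¹) * (seq (Li₂ (1/√ q 1<q) (∣1/√∣<1 q 1<q)) n + 1/suc n)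
  ζ₂≤Li n = use (dilog≤Li n)
    where
    use : (∃ λ i → start ≤ℕ i × seq (∑ᵣ (dilog-term (1/√ q 1<q)) n) i ≤ seq (Li₂ (1/√ q 1<q) (∣1/√∣<1 q 1<q)) n + 1/suc n) →
      ζ₂ n ≤ seq total n + (ι q * ι (q ∸ 1) ⁻¹) * (seq (Li₂ (1/√ q 1<q) (∣1/√∣<1 q 1<q)) n + 1/suc n)
    use (i , h , le) = ≤-trans (ζ₂≤dilog n i h) (+-monoʳ-≤ (seq total n) (*-monoˡ (<⇒≤ 0<q/[q-1]) le))

  π²/6-Li≤total : π²/6 -ᵣ fromℚ (ι q * ι (q ∸ 1) ⁻¹) *ᵣ Li₂ (1/√ q 1<q) (∣1/√∣<1 q 1<q) ≤ᵣ total
  π²/6-Li≤total = subtract-≤ π²/6 (Li₂ (1/√ q 1<q) (∣1/√∣<1 q 1<q)) total (ι q * ι (q ∸ 1) ⁻¹) ζ₂ 0<q/[q-1] basel ζ₂≤Li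

  ζ₂≤2 : ∀ n → ζ₂ n ≤ ι 2
  ζ₂≤2 n = ≤-trans (∣∣-elim {ζ₂ n} {0ℚ} {ι 2 * 1/suc 0} (dilog-tail ζ₂-term (λ k → ≤-reflexive (0≤p⇒∣p∣≡p (0≤ζ₂-term k))) 0 n)) (≤-reflexive (+-identityˡ (ι 2)))

  ζ₂≤uniform : ∀ n → ζ₂ n ≤ ∑ layer n + ι 2 * ι (q ∸ 1) ⁻¹
  ζ₂≤uniform n = begin
    ζ₂ n                                            ≤⟨ ∑-mono n (λ i _ → layer-lower-uniform i) ⟩
    ∑ (λ i → layer i + ι (q ∸ 1) ⁻¹ * ζ₂-term i) n  ≡⟨ trans (∑-+ layer _ n) (cong (∑ layer n +_) (∑-* (ι (q ∸ 1) ⁻¹) ζ₂-term n)) ⟩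
    ∑ layer n + ι (q ∸ 1) ⁻¹ * ζ₂ n                 ≤⟨ +-monoʳ-≤ (∑ layer n) (*-monoˡ (<⇒≤ (⁻¹-pos (ι-pos 0<q-1))) (ζ₂≤2 n)) ⟩
    ∑ layer n + ι (q ∸ 1) ⁻¹ * ι 2                  ≡⟨ cong (∑ layer n +_) (*-comm (ι (q ∸ 1) ⁻¹) (ι 2)) ⟩
    ∑ layer n + ι 2 * ι (q ∸ 1) ⁻¹                  ∎
    where open ≤-Reasoning

  near-π²/6 : ∀ s ε → s ≤ᵣ total → total ≤ᵣ s → ι 2 * ι (q ∸ 1) ⁻¹ ≤ ε → ∣ s -ᵣ π²/6 ∣ᵣ ≤ᵣ fromℚ ε
  near-π²/6 s ε s≤total total≤s small η 0<η = choose (s≤total (½ * η) (½-pos 0<η)) (total≤s (½ * η) (½-pos 0<η)) (basel (½ * η) (½-pos 0<η))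
    where
    open ≤-Reasoning
    h : ℚ
    h = ½ * η
    0≤ε : 0ℚ ≤ ε
    0≤ε = ≤-trans (*-nonNeg (0≤ι 2) (<⇒≤ (⁻¹-pos (ι-pos 0<q-1)))) small
    choose : (∃ λ N → ∀ n → N ≤ℕ n → seq s n ≤ ∑ layer n + h) → (∃ λ N → ∀ n → N ≤ℕ n → ∑ layer n ≤ seq s n + h) →
      (∃ λ N → ∀ n → N ≤ℕ n → ∣ seq π²/6 n - ζ₂ n ∣ ≤ h) → ∃ λ N → ∀ n → N ≤ℕ n → ∣ seq s n - seq π²/6 n ∣ ≤ ε + η
    choose (L , hL) (M , hM) (N , hN) = L ℕ.⊔ (M ℕ.⊔ N) , λ n le →
      let le′ = ⊔ʳ L (M ℕ.⊔ N) le in ∣∣-intro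
      (begin
        seq s n                ≤⟨ hL n (⊔ˡ L (M ℕ.⊔ N) le) ⟩
        ∑ layer n + h          ≤⟨ +-monoˡ-≤ h (∑-mono n (λ i _ → layer-upper i)) ⟩
        ζ₂ n + h               ≤⟨ +-monoˡ-≤ h (∣∣-elimʳ (seq π²/6 n) (ζ₂ n) (hN n (⊔ʳ M N le′))) ⟩
        (seq π²/6 n + h) + h   ≡⟨ trans (+-assoc (seq π²/6 n) h h) (cong (seq π²/6 n +_) (trans (halves η) (sym (+-identityˡ η)))) ⟩
        seq π²/6 n + (0ℚ + η)  ≤⟨ +-monoʳ-≤ (seq π²/6 n) (+-monoˡ-≤ η 0≤ε) ⟩
        seq π²/6 n + (ε + η)   ∎)
      (begin
        seq π²/6 n               ≤⟨ ∣∣-elim {seq π²/6 n} {ζ₂ n} {h} (hN n (⊔ʳ M N le′)) ⟩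
        ζ₂ n + h                 ≤⟨ +-monoˡ-≤ h (≤-trans (ζ₂≤uniform n) (+-mono-≤ (hM n (⊔ˡ M N le′)) small)) ⟩
        ((seq s n + h) + ε) + h  ≡⟨ solve 3 (λ s h e → ((s :+ h) :+ e) :+ h := s :+ (e :+ (h :+ h))) refl (seq s n) h ε ⟩
        seq s n + (ε + (h + h))  ≡⟨ cong (λ t → seq s n + (ε + t)) (halves η) ⟩
        seq s n + (ε + η)        ∎)

module _ {c ℓ} {q : ℕ} (F : FiniteField c ℓ q) where

  open Polynomials F

  -- Suprema are unique: a finite set whose weight comes close to s has weight at most s′. This
  -- carries the estimates for `total` over to the arbitrary sum s in the limit statement.
  𝓕-≤ : ∀ {s s′} → 𝓕 𝓘 ≔ s → 𝓕 𝓘 ≔ s′ → s ≤ᵣ s′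
  𝓕-≤ {s} {s′} S S′ ε 0<ε = choose (𝓕_≔_.approached S (½ * ε) (½-pos 0<ε))
    where
    open ≤-Reasoning
    h k : ℚ
    h = ½ * ε
    k = ½ * h
    0<k : 0ℚ < k
    0<k = ½-pos (½-pos 0<ε)
    choose : (∃ λ as → AllPairs _≉ₘ_ as × All 𝓘 as × s ≤ᵣ fromℚ (weights as + h)) → ∃ λ N → ∀ n → N ≤ℕ n → seq s n ≤ seq s′ n + ε
    choose (as , distinct , all , s≤) = combine (s≤ k 0<k) (𝓕_≔_.upper-bound S′ as distinct all k 0<k)
      where
      combine : (∃ λ N → ∀ n → N ≤ℕ n → seq s n ≤ (weights as + h) + k) → (∃ λ N → ∀ n → N ≤ℕ n → weights as ≤ seq s′ n + k) →
        ∃ λ N → ∀ n → N ≤ℕ n → seq s n ≤ seq s′ n + ε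
      combine (M , hM) (N , hN) = M ℕ.⊔ N , λ n le → begin
        seq s n                   ≤⟨ hM n (⊔ˡ M N le) ⟩
        (weights as + h) + k      ≤⟨ +-monoˡ-≤ k (+-monoˡ-≤ h (hN n (⊔ʳ M N le))) ⟩
        ((seq s′ n + k) + h) + k  ≡⟨ solve 3 (λ s k h → ((s :+ k) :+ h) :+ k := s :+ (h :+ (k :+ k))) refl (seq s′ n) k h ⟩
        seq s′ n + (h + (k + k))  ≡⟨ cong (λ t → seq s′ n + (h + t)) (halves h) ⟩
        seq s′ n + (h + h)        ≡⟨ cong (seq s′ n +_) (halves ε) ⟩
        seq s′ n + ε              ∎

proposition2p2 : {c ℓ : Level} →
    ((q : ℕ) (pp : IsPrimePower q) (F : FiniteField c ℓ q) (let open Polynomials F) →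
    ∃ λ (s : ℝ) →
    (𝓕 𝓘 ≔ s) ×
    (π²/6 -ᵣ fromℚ (ι q * ι (q ∸ 1) ⁻¹) *ᵣ Li₂ (1/√ q (primePower>1 pp)) (∣1/√∣<1 q (primePower>1 pp)) ≤ᵣ s) ×
    (s ≤ᵣ π²/6))
    ×
    ((ε : ℚ) → 0ℚ < ε →
    ∃ λ (Q : ℕ) → (q : ℕ) → Q ≤ℕ q → IsPrimePower q → (F : FiniteField c ℓ q) (let open Polynomials F) →
    (s : ℝ) → 𝓕 𝓘 ≔ s → ∣ s -ᵣ π²/6 ∣ᵣ ≤ᵣ fromℚ ε)
proposition2p2 {c} {ℓ} = bounds , limit
  where
  bounds : (q : ℕ) (pp : IsPrimePower q) (F : FiniteField c ℓ q) (let open Polynomials F) →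
    ∃ λ (s : ℝ) →
    (𝓕 𝓘 ≔ s) ×
    (π²/6 -ᵣ fromℚ (ι q * ι (q ∸ 1) ⁻¹) *ᵣ Li₂ (1/√ q (primePower>1 pp)) (∣1/√∣<1 q (primePower>1 pp)) ≤ᵣ s) ×
    (s ≤ᵣ π²/6)
  bounds q pp F = total , 𝓕-total , π²/6-Li≤total , total≤π²/6
    where open IrreducibleSum F (primePower>1 pp)
  limit : (ε : ℚ) → 0ℚ < ε →
    ∃ λ (Q : ℕ) → (q : ℕ) → Q ≤ℕ q → IsPrimePower q → (F : FiniteField c ℓ q) (let open Polynomials F) →
    (s : ℝ) → 𝓕 𝓘 ≔ s → ∣ s -ᵣ π²/6 ∣ᵣ ≤ᵣ fromℚ ε
  limit ε 0<ε = choose (scaled-archimedean (ι 2) ε (ι-suc-pos 1) 0<ε)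
    where
    choose : (∃ λ N → ∀ n → N ≤ℕ n → ι 2 * 1/suc n ≤ ε) →
      ∃ λ (Q : ℕ) → (q : ℕ) → Q ≤ℕ q → IsPrimePower q → (F : FiniteField c ℓ q) (let open Polynomials F) →
      (s : ℝ) → 𝓕 𝓘 ≔ s → ∣ s -ᵣ π²/6 ∣ᵣ ≤ᵣ fromℚ ε
    -- For q ≥ N + 2 one has q - 1 = n + 1 with n ≥ N, so 2/(q - 1) is literally the quantity
    -- bounded by `hN`.
    choose (N , hN) = suc (suc N) , result
      where
      result : (q : ℕ) → suc (suc N) ≤ℕ q → IsPrimePower q → (F : FiniteField c ℓ q) (let open Polynomials F) →
        (s : ℝ) → 𝓕 𝓘 ≔ s → ∣ s -ᵣ π²/6 ∣ᵣ ≤ᵣ fromℚ ε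
      result (suc (suc n)) (ℕ.s≤s (ℕ.s≤s N≤n)) pp F s S =
        near-π²/6 s ε (𝓕-≤ F S 𝓕-total) (𝓕-≤ F 𝓕-total S) (hN n N≤n)
        where open IrreducibleSum F (primePower>1 pp)
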